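{- Let $\mathsf{M}$ be a matroid of corank $2$ (i.e. $\operatorname{rk}\mathsf{M}=n-2$) on a ground set $E$ of size $n$, without coloops. For each integer $r$, let $\lambda_r$ be the number of stressed subsets of $\mathsf{M}$ of rank $r$ and size $r+1$. Then \begin{align*} Q_{\mathsf{M}}(x)&=Q_{\mathsf{U}_{n-2,n}}(x)-\sum_r\lambda_r\sum_{a=2}^{n-r-1}\Big(Q_{\mathsf{C}_{a,n+1-a}}(x)-Q_{\mathsf{U}_{a-1,a}}(x)\,Q_{\mathsf{U}_{n-a-1,n-a}}(x)\Big),\\ Y_{\mathsf{M}}(x)&=Y_{\mathsf{U}_{n-2,n}}(x)-\sum_r\lambda_r\sum_{a=2}^{n-r-1}\Big(Y_{\mathsf{C}_{a,n+1-a}}(x)-Y_{\mathsf{U}_{a-1,a}}(x)\,Y_{\mathsf{U}_{n-a-1,n-a}}(x)\Big). \end{align*} In particular, if $E=[n]$ and $\mathsf{M}$ is the matroid arising from a set partition $\lambda$ of $[n]$, then \begin{align*} Q_{\mathsf{M}}(x)&=Q_{\mathsf{U}_{n-2,n}}(x)-\sum_{S\in\lambda,\,|S|\ge2}\ \sum_{a=2}^{|S|}\Big(Q_{\mathsf{C}_{a,n+1-a}}(x)-Q_{\mathsf{U}_{a-1,a}}(x)\,Q_{\mathsf{U}_{n-a-1,n-a}}(x)\Big),\\ Y_{\mathsf{M}}(x)&=Y_{\mathsf{U}_{n-2,n}}(x)-\sum_{S\in\lambda,\,|S|\ge2}\ \sum_{a=2}^{|S|}\Big(Y_{\mathsf{C}_{a,n+1-a}}(x)-Y_{\mathsf{U}_{a-1,a}}(x)\,Y_{\mathsf{U}_{n-a-1,n-a}}(x)\Big).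 \end{align*}
   Context: A subset $A\subseteq E$ is stressed if both $\mathsf{M}/A$ and $\mathsf{M}|_A$ are uniform matroids. $\mathsf{U}_{k,m}$ is the uniform matroid of rank $k$ on $m$ elements. For $a,b\ge2$, $\mathsf{C}_{a,b}$ is the graphic matroid of the graph obtained by gluing a cycle of length $a$ and a cycle of length $b$ along a common edge. The matroid arising from a set partition $\lambda$ of $[n]$ is the dual of the loopless rank-$2$ matroid on $[n]$ whose rank-$1$ flats are exactly the blocks of $\lambda$. $\mu(\mathsf{N})$ is the Möbius value $\mu(\varnothing,E)$ of the lattice of flats $\mathcal{L}(\mathsf{N})$. The inverse Kazhdan–Lusztig polynomial $Q_{\mathsf{N}}$ is the unique assignment to loopless matroids with $Q_{\mathsf{N}}=1$ in rank $0$, $\deg Q_{\mathsf{N}}<\operatorname{rk}(\mathsf{N})/2$ in positive rank, and $Y_{\mathsf{N}}(x):=\sum_{F}(-1)^{\operatorname{rk}\mathsf{N}-\operatorname{rk}F}\mu(\mathsf{N}/F)x^{\operatorname{rk}\mathsf{N}-\operatorname{rk}F}Q_{\mathsf{N}|_F}(x)$ palindromic of degree $\operatorname{rk}\mathsf{N}$; $Y_{\mathsf{N}}$ is the inverse $Z$-polynomial. -}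

module Defs where

open import Data.Bool using (Bool; true; false; _∧_; _∨_; not; if_then_else_; T)
open import Data.Nat as ℕ using (ℕ; zero; suc; _+_; _∸_; _⊓_; _≤_; _<_; _≡ᵇ_; _≤ᵇ_)
open import Data.Integer as ℤ using (ℤ; +_; -_; -[1+_])
open import Data.Fin using (Fin; toℕ)
open import Data.Fin.Subset using (Subset; inside; outside; _∈_; _⊆_; _∪_; _∩_; _─_; _-_; ∁; ⁅_⁆; ∣_∣; ⊤; Nonempty; Empty)
open import Data.Fin.Subset.Properties using (_⊆?_)
open import Data.Vec using (Vec; []; _∷_; lookup)
open import Data.Vec.Properties using (≡-dec)
import Data.Bool.Properties as BoolP
open import Data.List using (List; []; _∷_; map; foldr; length; filterᵇ; upTo; _++_; replicate; allFin)
open import Data.Bool.ListAction using (all; any)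
open import Data.List.Membership.Propositional using () renaming (_∈_ to _∈ˡ_)
open import Data.List.Relation.Unary.All using (All)
open import Data.List.Relation.Unary.Any using (Any)
open import Data.List.Relation.Unary.AllPairs using (AllPairs)
open import Data.Product using (_×_; _,_; proj₁; proj₂)
open import Relation.Nullary using (¬_; does)
open import Relation.Binary.PropositionalEquality using (_≡_)

-- Polynomials with integer coefficients: coefficient lists, constant
-- term first.  Equality of polynomials is coefficientwise (so trailing
-- zeros are irrelevant).

Poly : Set
Poly = List ℤ

infixl 6 _+P_ _-P_
infixl 7 _*P_

_+P_ : Poly → Poly → Poly
[]      +P q       = q
(a ∷ p) +P []      = a ∷ p
(a ∷ p) +P (b ∷ q) = (a ℤ.+ b) ∷ (p +P q)

scaleP : ℤ → Poly → Poly
scaleP c p = map (c ℤ.*_) p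

negP : Poly → Poly
negP = scaleP (- (+ 1))

_-P_ : Poly → Poly → Poly
p -P q = p +P negP q

_*P_ : Poly → Poly → Poly
[]      *P q = []
(a ∷ p) *P q = scaleP a q +P ((+ 0) ∷ (p *P q))

shiftP : ℕ → Poly → Poly
shiftP k p = replicate k (+ 0) ++ p

oneP : Poly
oneP = + 1 ∷ []

sumP : List Poly → Poly
sumP = foldr _+P_ []

coeff : Poly → ℕ → ℤ
coeff []      _       = + 0
coeff (a ∷ p) zero    = a
coeff (a ∷ p) (suc i) = coeff p i

infix 4 _≈P_
_≈P_ : Poly → Poly → Set
p ≈P q = ∀ i → coeff p i ≡ coeff q i

Palindromic : Poly → ℕ → Set
Palindromic p d = (∀ i → i ≤ d → coeff p i ≡ coeff p (d ∸ i))
                × (∀ i → d < i → coeff p i ≡ + 0)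

sumRange : ℕ → ℕ → (ℕ → Poly) → Poly
sumRange lo hi f = sumP (map (λ t → f (lo + t)) (upTo (suc hi ∸ lo)))

sgn : ℕ → ℤ
sgn zero    = + 1
sgn (suc k) = - sgn k

-- Finite matroids given by rank functions.  A (raw) matroid has an
-- ambient finite type Fin amb, a ground set E ⊆ Fin amb, and a rank
-- function which is only ever evaluated on subsets of E.

record RawMatroid : Set where
  constructor mkRaw
  field
    amb    : ℕ
    ground : Subset amb
    rk     : Subset amb → ℕ
open RawMatroid public

IsMatroid : RawMatroid → Set
IsMatroid M =
    (∀ A → A ⊆ E → rk M A ≤ ∣ A ∣)
  × (∀ A B → A ⊆ E → B ⊆ E → A ⊆ B → rk M A ≤ rk M B)
  × (∀ A B → A ⊆ E → B ⊆ E → rk M (A ∪ B) + rk M (A ∩ B) ≤ rk M A + rk M B)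
  where E = ground M

IsLoop : (M : RawMatroid) → Fin (amb M) → Set
IsLoop M e = e ∈ ground M × rk M ⁅ e ⁆ ≡ 0

Loopless : RawMatroid → Set
Loopless M = ∀ e → ¬ IsLoop M e

IsColoop : (M : RawMatroid) → Fin (amb M) → Set
IsColoop M e = e ∈ ground M × rk M (ground M - e) < rk M (ground M)

NoColoops : RawMatroid → Set
NoColoops M = ∀ e → ¬ IsColoop M e

restrict : (M : RawMatroid) → Subset (amb M) → RawMatroid
restrict M A = mkRaw (amb M) A (rk M)

contract : (M : RawMatroid) → Subset (amb M) → RawMatroid
contract M A = mkRaw (amb M) (ground M ─ A) (λ B → rk M (B ∪ A) ∸ rk M A)

dualFull : (n : ℕ) → (Subset n → ℕ) → RawMatroid
dualFull n r = mkRaw n ⊤ (λ A → ∣ A ∣ + r (∁ A) ∸ r ⊤)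

subsets : (n : ℕ) → List (Subset n)
subsets zero    = [] ∷ []
subsets (suc n) = map (outside ∷_) (subsets n) ++ map (inside ∷_) (subsets n)

_⊆ᵇ_ : ∀ {n} → Subset n → Subset n → Bool
A ⊆ᵇ B = does (A ⊆? B)

_≟ᵇ_ : ∀ {n} → Subset n → Subset n → Bool
A ≟ᵇ B = does (≡-dec BoolP._≟_ A B)

memᵇ : ∀ {n} → Fin n → Subset n → Bool
memᵇ e A = lookup A e

isFlatᵇ : (M : RawMatroid) → Subset (amb M) → Bool
isFlatᵇ M F = (F ⊆ᵇ ground M) ∧
  all (λ e → not (memᵇ e (ground M) ∧ not (memᵇ e F))
             ∨ not (rk M (F ∪ ⁅ e ⁆) ≡ᵇ rk M F))
      (allFin (amb M))

flats : (M : RawMatroid) → List (Subset (amb M))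
flats M = filterᵇ (isFlatᵇ M) (subsets (amb M))

-- closure of the empty set (the bottom element of the lattice of flats)
loopSet : (M : RawMatroid) → Subset (amb M)
loopSet M = Data.Vec.tabulate (λ e → memᵇ e (ground M) ∧ (rk M ⁅ e ⁆ ≡ᵇ 0))

sumℤ : List ℤ → ℤ
sumℤ = foldr ℤ._+_ (+ 0)

mobius : (M : RawMatroid) → ℕ → Subset (amb M) → Subset (amb M) → ℤ
mobius M zero    X Y = + 0
mobius M (suc k) X Y =
  if X ≟ᵇ Y then + 1
  else - sumℤ (map (mobius M k X)
                   (filterᵇ (λ Z → isFlatᵇ M Z ∧ (X ⊆ᵇ Z) ∧ (Z ⊆ᵇ Y) ∧ not (Z ≟ᵇ Y))
                            (subsets (amb M))))

-- μ(N) = μ(0̂, 1̂) in L(N)   (fuel amb+1 suffices: chains of flats are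
-- strictly increasing subsets)
μ : RawMatroid → ℤ
μ N = mobius N (suc (amb N)) (loopSet N) (ground N)

Yof : (RawMatroid → Poly) → RawMatroid → Poly
Yof Q N = sumP (map term (flats N))
  where
    rN = rk N (ground N)
    term : Subset (amb N) → Poly
    term F = scaleP (sgn (rN ∸ rk N F) ℤ.* μ (contract N F))
                    (shiftP (rN ∸ rk N F) (Q (restrict N F)))

-- Q is the inverse Kazhdan–Lusztig polynomial (characterising
-- properties, on all loopless matroids)
IsInverseKL : (RawMatroid → Poly) → Set
IsInverseKL Q = ∀ N → IsMatroid N → Loopless N →
    (rk N (ground N) ≡ 0 → Q N ≈P oneP)
  × (0 < rk N (ground N) → ∀ i → rk N (ground N) ≤ 2 ℕ.* i → coeff (Q N) i ≡ + 0)
  × Palindromic (Yof Q N) (rk N (ground N))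

Unif : ℕ → ℕ → RawMatroid
Unif k m = mkRaw m ⊤ (λ A → ∣ A ∣ ⊓ k)

-- graphic matroid of a multigraph with vertices 0..V-1 and edges
-- Fin m, edge i joining the vertices ends i; rank(A) = V - c(A), where
-- c(A) is the number of connected components of (V, A).
module Graphic (V m : ℕ) (ends : Fin m → ℕ × ℕ) (A : Subset m) where
  reach : ℕ → ℕ → ℕ → Bool
  reach zero    u v = u ≡ᵇ v
  reach (suc k) u v = reach k u v ∨
    any (λ e → memᵇ e A ∧
               ((reach k u (proj₁ (ends e)) ∧ (proj₂ (ends e) ≡ᵇ v)) ∨
                (reach k u (proj₂ (ends e)) ∧ (proj₁ (ends e) ≡ᵇ v))))
        (allFin m)

  -- components counted by their least vertex
  components : ℕ
  components = length (filterᵇ (λ v → not (any (λ u → reach V u v) (upTo v))) (upTo V))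

  rank : ℕ
  rank = V ∸ components

graphicRank : (V m : ℕ) → (Fin m → ℕ × ℕ) → Subset m → ℕ
graphicRank V m ends A = Graphic.rank V m ends A

-- The graph for C_{a,b}: vertices 0..a+b-3, shared edge 0 = {0,1};
-- edges 1..a-1 form the path 1 → 2 → … → a-1 → 0 (cycle of length a
-- together with edge 0); edges a..a+b-2 form the path
-- 1 → a → a+1 → … → a+b-3 → 0 (cycle of length b with edge 0).
cEnds : (a b : ℕ) → Fin (a + b ∸ 1) → ℕ × ℕ
cEnds a b i = edge (toℕ i)
  where
    u : ℕ → ℕ
    u zero    = 1
    u (suc t) = if suc t ≡ᵇ (a ∸ 1) then 0 else suc (suc t)
    v : ℕ → ℕ
    v zero    = 1
    v (suc s) = if suc s ≡ᵇ (b ∸ 1) then 0 else a + s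
    edge : ℕ → ℕ × ℕ
    edge zero    = 0 , 1
    edge (suc j) = if suc j ≤ᵇ (a ∸ 1) then (u j , u (suc j))
                   else (v (j ∸ (a ∸ 1)) , v (suc j ∸ (a ∸ 1)))

C : ℕ → ℕ → RawMatroid
C a b = mkRaw (a + b ∸ 1) ⊤ (graphicRank (a + b ∸ 2) (a + b ∸ 1) (cEnds a b))

-- M is uniform: M ≅ U_{k,m} (necessarily k = rk M), i.e. rk A = min(|A|, k)
isUniformᵇ : RawMatroid → Bool
isUniformᵇ M = all (λ A → not (A ⊆ᵇ ground M) ∨ (rk M A ≡ᵇ (∣ A ∣ ⊓ rk M (ground M))))
                   (subsets (amb M))

isStressedᵇ : (M : RawMatroid) → Subset (amb M) → Bool
isStressedᵇ M A = (A ⊆ᵇ ground M) ∧ isUniformᵇ (contract M A) ∧ isUniformᵇ (restrict M A)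

stressedCount : RawMatroid → ℕ → ℕ
stressedCount M r = length (filterᵇ
  (λ A → isStressedᵇ M A ∧ (rk M A ≡ᵇ r) ∧ (∣ A ∣ ≡ᵇ suc r)) (subsets (amb M)))

corrTerm : (RawMatroid → Poly) → ℕ → ℕ → Poly
corrTerm F n a = F (C a (n + 1 ∸ a)) -P (F (Unif (a ∸ 1) a) *P F (Unif (n ∸ a ∸ 1) (n ∸ a)))

-- F(U_{n-2,n}) - Σ_r λ_r Σ_{a=2}^{n-r-1} corrTerm   (n = |E|; λ_r = 0 for r > n)
rhsCorank2 : (RawMatroid → Poly) → RawMatroid → Poly
rhsCorank2 F M = F (Unif (n ∸ 2) n) -P
  sumP (map (λ r → scaleP (+ stressedCount M r) (sumRange 2 (n ∸ r ∸ 1) (corrTerm F n)))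
            (upTo (suc n)))
  where n = ∣ ground M ∣

rhsPartition : (RawMatroid → Poly) → (n : ℕ) → List (Subset n) → Poly
rhsPartition F n blocks = F (Unif (n ∸ 2) n) -P
  sumP (map (λ S → if 2 ≤ᵇ ∣ S ∣ then sumRange 2 ∣ S ∣ (corrTerm F n) else []) blocks)

IsSetPartition : (n : ℕ) → List (Subset n) → Set
IsSetPartition n blocks =
    All Nonempty blocks
  × AllPairs (λ A B → Empty (A ∩ B)) blocks
  × (∀ e → Any (e ∈_) blocks)

RankOneFlatsAre : (n : ℕ) → (Subset n → ℕ) → List (Subset n) → Set
RankOneFlatsAre n r blocks = ∀ F →
    ((T (isFlatᵇ (mkRaw n ⊤ r) F) × r F ≡ 1) → F ∈ˡ blocks)
  × (F ∈ˡ blocks → (T (isFlatᵇ (mkRaw n ⊤ r) F) × r F ≡ 1))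

-- Write ρ for the dual rank function. By Whitney's formula for the Möbius value, and since the
-- contraction by a non-flat contributes 0, the inverse Z-polynomial is a sum over all T ⊆ E:
--   Y_N = Σ_T (-1)^ρ(T) (Σ_{D ⊆ T independent in the dual} (-1)^|D|) x^(|T|-ρ(T)) Q_{N|(E ─ T)}.
-- The term of T = ∅ is Q_N, so a palindromic Y_N together with deg Q_N < rk N / 2 determines Q_N
-- linearly from the remaining terms. In corank at most one they depend only on the number of
-- non-coloops. In corank two a set T lies in a unique line (flat of rank 1 of the dual), or in no
-- line, or is empty, and the sum becomes
--   Y_M = Q_M + A_n - Σ_{lines S} B_{n,|S|},   with B_{n,1} = 0.
-- Hence F_M = F(U_{n-2,n}) - Σ_S β_{n,|S|} with β_{n,1} = 0, for F = Q and for F = Y. The lines of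
-- C_{a,n+1-a} have sizes a-1, n-a and 1, and F(U_{a-1,a}) F(U_{n-a-1,n-a}) behaves like the direct
-- sum, whose lines have sizes a and n-a; so the correction term of a is β_{n,a} - β_{n,a-1}, and the
-- sum over a telescopes to β_{n,|S|}. The stressed sets A with |A| = rk A + 1 are the complements of
-- the lines.
module Submission where

-- Two encodings shape the proof. A dual rank enters through the equation
-- `r (E ─ T) + ∣ T ∣ ≡ r E + ρ T`, so that nothing is subtracted, and a polynomial enters as the
-- linear functional `ev p`: a product becomes an iterated functional, and palindromicity of degree
-- d becomes invariance under the reflection of exponents `j ↦ d ∸ j`. The quantities A and B come
-- from a deliberate miscount and its repair. A counts as if the dual were U_{2,n}, with every pair
-- independent. Each line S then takes back its dependent pairs in T, and it replaces the terms of
-- the nonempty T inside S, whose dual rank is 1 and not 2. A line with one element has no pair, and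
-- its replacement carries the factor |T| - 1 = 0. The direct sum of two circuits is never built as
-- a matroid. The product of the two inverse Z-polynomials is palindromic, the product of the two Q
-- has low degree, and their difference is the functional that A and B predict for lines of sizes a
-- and n - a; the uniqueness in `half-unique` then applies to the product just as it does to a
-- matroid.

open import Defs
open import Data.Bool using (Bool; true; false; _∧_; _∨_; not; if_then_else_; T)
import Data.Bool.Properties as BoolP
open import Data.Nat using (ℕ; zero; suc; _+_; _*_; _∸_; _⊓_; _≤_; _<_; _≡ᵇ_; _≤ᵇ_; z≤n; s≤s)
import Data.Nat.Properties as ℕP
import Data.Nat.Tactic.RingSolver as ℕR
open import Data.Integer using (ℤ; +_; -_; 0ℤ; 1ℤ; -1ℤ) renaming (_+_ to _+ᶻ_; _*_ to _*ᶻ_; _-_ to _-ᶻ_)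
import Data.Integer.Properties as ℤP
import Data.Integer.Tactic.RingSolver as ℤR
open import Data.Fin using (Fin; zero; suc; toℕ; fromℕ<)
import Data.Fin.Properties as FinP
open import Data.Fin.Subset using (Subset; inside; outside; _∈_; _∉_; _⊆_; _∪_; _∩_; _─_; _-_; ∁; ⁅_⁆; ∣_∣; ⊤; ⊥; Empty)
open import Data.Fin.Subset.Properties as SubP using (_⊆?_; _∈?_; ⊆-antisym)
open import Data.Vec using ([]; _∷_; lookup; here; there)
import Data.Vec as Vec
import Data.Vec.Properties as VecP
open import Data.List using (List; []; _∷_; map; length; filterᵇ; upTo; applyUpTo; _++_)
import Data.List as List
open import Data.Bool.ListAction using (all; any)
open import Data.List.Membership.Propositional using () renaming (_∈_ to _∈ˡ_)
open import Data.List.Relation.Unary.All as All using (All; []; _∷_)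
open import Data.List.Relation.Unary.Any using (here; there)
open import Data.List.Relation.Unary.AllPairs using (AllPairs; []; _∷_)
open import Data.Product using (_×_; _,_; proj₁; proj₂; ∃)
open import Data.Sum using (_⊎_; inj₁; inj₂; [_,_]′)
open import Data.Empty using (⊥-elim)
open import Data.Unit using (tt)
open import Function using (_∘_; id; case_of_)
open import Relation.Nullary using (¬_; Dec; yes; no; does; ¬?; _×-dec_)
open import Relation.Nullary.Decidable using (dec-true; dec-false; decidable-stable; T?)
open import Relation.Binary.PropositionalEquality using (_≡_; _≢_; refl; sym; trans; cong; cong₂; subst; module ≡-Reasoning)
open import Data.List.Membership.Propositional.Properties using (∈-filter⁺; ∈-filter⁻; ∈-map⁺; ∈-++⁺ˡ; ∈-++⁺ʳ)
import Data.List.Properties as ListP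

-- Sums over subsets

-- Recursion on the ground set, and not a filtered list of subsets, turns complementation,
-- restriction and splitting along a subset into structural inductions.
Σ⊆ : ∀ {n} → Subset n → (Subset n → ℤ) → ℤ
Σ⊆ []            f = f []
Σ⊆ (outside ∷ E) f = Σ⊆ E (f ∘ (outside ∷_))
Σ⊆ (inside  ∷ E) f = Σ⊆ E (f ∘ (outside ∷_)) +ᶻ Σ⊆ E (f ∘ (inside ∷_))

Σ⊆-cong : ∀ {n} (E : Subset n) {f g : Subset n → ℤ} → (∀ A → A ⊆ E → f A ≡ g A) → Σ⊆ E f ≡ Σ⊆ E g
Σ⊆-cong []            h = h [] id
Σ⊆-cong (outside ∷ E) h = Σ⊆-cong E (λ A s → h _ (SubP.s⊆s s))
Σ⊆-cong (inside  ∷ E) h = cong₂ _+ᶻ_ (Σ⊆-cong E (λ A s → h _ (SubP.out⊆ s))) (Σ⊆-cong E (λ A s → h _ (SubP.s⊆s s)))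

interchange : ∀ a b c d → (a +ᶻ b) +ᶻ (c +ᶻ d) ≡ (a +ᶻ c) +ᶻ (b +ᶻ d)
interchange = ℤR.solve-∀

Σ⊆-+ : ∀ {n} (E : Subset n) (f g : Subset n → ℤ) → Σ⊆ E (λ A → f A +ᶻ g A) ≡ Σ⊆ E f +ᶻ Σ⊆ E g
Σ⊆-+ []            f g = refl
Σ⊆-+ (outside ∷ E) f g = Σ⊆-+ E _ _
Σ⊆-+ (inside  ∷ E) f g = trans (cong₂ _+ᶻ_ (Σ⊆-+ E _ _) (Σ⊆-+ E _ _))
  (interchange (Σ⊆ E (f ∘ (outside ∷_))) (Σ⊆ E (g ∘ (outside ∷_))) (Σ⊆ E (f ∘ (inside ∷_))) (Σ⊆ E (g ∘ (inside ∷_))))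

Σ⊆-* : ∀ {n} (E : Subset n) c (f : Subset n → ℤ) → Σ⊆ E (λ A → c *ᶻ f A) ≡ c *ᶻ Σ⊆ E f
Σ⊆-* []            c f = refl
Σ⊆-* (outside ∷ E) c f = Σ⊆-* E c _
Σ⊆-* (inside  ∷ E) c f = trans (cong₂ _+ᶻ_ (Σ⊆-* E c _) (Σ⊆-* E c _)) (sym (ℤP.*-distribˡ-+ c _ _))

Σ⊆-zero : ∀ {n} (E : Subset n) {f : Subset n → ℤ} → (∀ A → A ⊆ E → f A ≡ 0ℤ) → Σ⊆ E f ≡ 0ℤ
Σ⊆-zero E h = trans (Σ⊆-cong E {g = λ _ → 0ℤ *ᶻ 0ℤ} h) (Σ⊆-* E 0ℤ (λ _ → 0ℤ))

Σ⊆-swap : ∀ {m n} (E : Subset m) (F : Subset n) (f : Subset m → Subset n → ℤ) →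
          Σ⊆ E (λ A → Σ⊆ F (f A)) ≡ Σ⊆ F (λ B → Σ⊆ E (λ A → f A B))
Σ⊆-swap []            F f = refl
Σ⊆-swap (outside ∷ E) F f = Σ⊆-swap E F _
Σ⊆-swap (inside  ∷ E) F f = trans (cong₂ _+ᶻ_ (Σ⊆-swap E F _) (Σ⊆-swap E F _)) (sym (Σ⊆-+ F _ _))

Σ⊆-compl : ∀ {n} (E : Subset n) (f : Subset n → ℤ) → Σ⊆ E f ≡ Σ⊆ E (λ A → f (E ─ A))
Σ⊆-compl []            f = refl
Σ⊆-compl (outside ∷ E) f = Σ⊆-compl E _
Σ⊆-compl (inside  ∷ E) f = trans (cong₂ _+ᶻ_ (Σ⊆-compl E _) (Σ⊆-compl E _)) (ℤP.+-comm (Σ⊆ E (λ A → f (outside ∷ (E ─ A)))) _)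

in⊈out : ∀ {n} {A B : Subset n} → ¬ (inside ∷ A ⊆ outside ∷ B)
in⊈out s with () ← s here

Σ⊆-restrict : ∀ {n} {S E : Subset n} → S ⊆ E → (f : Subset n → ℤ) →
              (∀ A → A ⊆ E → ¬ (A ⊆ S) → f A ≡ 0ℤ) → Σ⊆ E f ≡ Σ⊆ S f
Σ⊆-restrict {S = []} {[]} S⊆E f h = refl
Σ⊆-restrict {S = outside ∷ S} {outside ∷ E} S⊆E f h =
  Σ⊆-restrict (SubP.drop-∷-⊆ S⊆E) _ (λ A A⊆E ns → h _ (SubP.s⊆s A⊆E) (λ s → ns (SubP.drop-∷-⊆ s)))
Σ⊆-restrict {S = inside ∷ S} {outside ∷ E} S⊆E f h = ⊥-elim (in⊈out S⊆E)
Σ⊆-restrict {S = outside ∷ S} {inside ∷ E} S⊆E f h =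
  trans (cong₂ _+ᶻ_
    (Σ⊆-restrict (SubP.drop-∷-⊆ S⊆E) _ (λ A A⊆E ns → h _ (SubP.out⊆ A⊆E) (λ s → ns (SubP.drop-∷-⊆ s))))
    (Σ⊆-zero E (λ A A⊆E → h _ (SubP.s⊆s A⊆E) in⊈out)))
  (ℤP.+-identityʳ _)
Σ⊆-restrict {S = inside ∷ S} {inside ∷ E} S⊆E f h = cong₂ _+ᶻ_
  (Σ⊆-restrict (SubP.drop-∷-⊆ S⊆E) _ (λ A A⊆E ns → h _ (SubP.out⊆ A⊆E) (λ s → ns (SubP.drop-∷-⊆ s))))
  (Σ⊆-restrict (SubP.drop-∷-⊆ S⊆E) _ (λ A A⊆E ns → h _ (SubP.s⊆s A⊆E) (λ s → ns (SubP.drop-∷-⊆ s))))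

Σ⊆-⊥ : ∀ {n} (f : Subset n → ℤ) → Σ⊆ ⊥ f ≡ f ⊥
Σ⊆-⊥ {zero}  f = refl
Σ⊆-⊥ {suc n} f = Σ⊆-⊥ (f ∘ (outside ∷_))

Σ⊆-unique : ∀ {n} {Z E : Subset n} → Z ⊆ E → (f : Subset n → ℤ) →
            (∀ A → A ⊆ E → A ≢ Z → f A ≡ 0ℤ) → Σ⊆ E f ≡ f Z
Σ⊆-unique {Z = Z} {E} Z⊆E f h = begin
  Σ⊆ E f ≡⟨ Σ⊆-restrict Z⊆E f (λ A A⊆E ns → h A A⊆E (λ { refl → ns id })) ⟩
  -- `Σ⊆-restrict` only discards sets that are not contained in a given one. Complementing inside
  -- `Z` turns the term of `Z` into that of `⊥`, which can be isolated in this way.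
  Σ⊆ Z f ≡⟨ Σ⊆-compl Z f ⟩
  Σ⊆ Z (λ A → f (Z ─ A)) ≡⟨ Σ⊆-restrict (SubP.⊆-min Z) _ (λ A A⊆Z ns → h _ (λ x → Z⊆E (SubP.p─q⊆p Z A x)) (λ eq → ns (sub A A⊆Z eq))) ⟩
  Σ⊆ ⊥ (λ A → f (Z ─ A)) ≡⟨ Σ⊆-⊥ (λ A → f (Z ─ A)) ⟩
  f (Z ─ ⊥) ≡⟨ cong f (SubP.p─⊥≡p Z) ⟩
  f Z ∎
  where
  open ≡-Reasoning
  sub : ∀ A → A ⊆ Z → Z ─ A ≡ Z → A ⊆ ⊥
  sub A A⊆Z eq {x} x∈A = ⊥-elim (∉─ (subst (x ∈_) (sym eq) (A⊆Z x∈A)) x∈A)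
    where
    ∉─ : ∀ {n} {p q : Subset n} {x} → x ∈ p ─ q → x ∉ q
    ∉─ {p = _ ∷ p} {outside ∷ q} (there m) (there m') = ∉─ m m'
    ∉─ {p = _ ∷ p} {inside ∷ q} (there m) (there m') = ∉─ m m'

-- Pair each `A` that avoids `e` with `A ∪ ⁅ e ⁆`; the two terms cancel.
Σ⊆-alternating : ∀ {n} (E : Subset n) {e} → e ∈ E → (f : Subset n → ℤ) →
                 (∀ A → A ⊆ E → e ∉ A → f (A ∪ ⁅ e ⁆) ≡ - f A) → Σ⊆ E f ≡ 0ℤ
Σ⊆-alternating (inside ∷ E) here f h = begin
  Σ⊆ E f₀ +ᶻ Σ⊆ E (f ∘ (inside ∷_)) ≡⟨ cong (Σ⊆ E f₀ +ᶻ_) (Σ⊆-cong E (λ A s → trans (cong (f ∘ (inside ∷_)) (sym (SubP.∪-identityʳ A))) (trans (h (outside ∷ A) (SubP.out⊆ s) (λ ())) (sym (ℤP.-1*i≡-i _))))) ⟩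
  Σ⊆ E f₀ +ᶻ Σ⊆ E (λ A → -1ℤ *ᶻ f₀ A) ≡⟨ cong (Σ⊆ E f₀ +ᶻ_) (trans (Σ⊆-* E -1ℤ f₀) (ℤP.-1*i≡-i _)) ⟩
  Σ⊆ E f₀ +ᶻ - Σ⊆ E f₀ ≡⟨ ℤP.+-inverseʳ (Σ⊆ E f₀) ⟩
  0ℤ ∎
  where
  open ≡-Reasoning
  f₀ = f ∘ (outside ∷_)
Σ⊆-alternating (outside ∷ E) (there e∈E) f h =
  Σ⊆-alternating E e∈E _ (λ A s n → h _ (SubP.s⊆s s) (λ { (there m) → n m }))
Σ⊆-alternating (inside ∷ E) (there e∈E) f h = cong₂ _+ᶻ_
  (Σ⊆-alternating E e∈E _ (λ A s n → h _ (SubP.out⊆ s) (λ { (there m) → n m })))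
  (Σ⊆-alternating E e∈E _ (λ A s n → h _ (SubP.s⊆s s) (λ { (there m) → n m })))

-- Sums over lists and binomial sums

ΣL : ∀ {a} {A : Set a} → List A → (A → ℤ) → ℤ
ΣL xs f = sumℤ (map f xs)

module _ {a} {A : Set a} where

  ΣL-cong : ∀ (xs : List A) {f g : A → ℤ} → (∀ {x} → x ∈ˡ xs → f x ≡ g x) → ΣL xs f ≡ ΣL xs g
  ΣL-cong []       h = refl
  ΣL-cong (x ∷ xs) h = cong₂ _+ᶻ_ (h (here refl)) (ΣL-cong xs (h ∘ there))

  ΣL-++ : ∀ (xs ys : List A) (f : A → ℤ) → ΣL (xs ++ ys) f ≡ ΣL xs f +ᶻ ΣL ys f
  ΣL-++ []       ys f = sym (ℤP.+-identityˡ _)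
  ΣL-++ (x ∷ xs) ys f = trans (cong (f x +ᶻ_) (ΣL-++ xs ys f)) (sym (ℤP.+-assoc (f x) _ _))

  ΣL-map : ∀ {b} {B : Set b} (h : B → A) (xs : List B) (f : A → ℤ) → ΣL (map h xs) f ≡ ΣL xs (f ∘ h)
  ΣL-map h []       f = refl
  ΣL-map h (x ∷ xs) f = cong (f (h x) +ᶻ_) (ΣL-map h xs f)

  ΣL-filter : ∀ (p : A → Bool) (xs : List A) (f : A → ℤ) →
              ΣL (filterᵇ p xs) f ≡ ΣL xs (λ x → if p x then f x else 0ℤ)
  ΣL-filter p []       f = refl
  ΣL-filter p (x ∷ xs) f with p x
  ... | true  = cong (f x +ᶻ_) (ΣL-filter p xs f)
  ... | false = trans (ΣL-filter p xs f) (sym (ℤP.+-identityˡ _))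

  ΣL-+ : ∀ (xs : List A) (f g : A → ℤ) → ΣL xs (λ x → f x +ᶻ g x) ≡ ΣL xs f +ᶻ ΣL xs g
  ΣL-+ []       f g = refl
  ΣL-+ (x ∷ xs) f g = trans (cong ((f x +ᶻ g x) +ᶻ_) (ΣL-+ xs f g)) (interchange (f x) (g x) _ _)

  ΣL-* : ∀ (xs : List A) c (f : A → ℤ) → ΣL xs (λ x → c *ᶻ f x) ≡ c *ᶻ ΣL xs f
  ΣL-* []       c f = sym (ℤP.*-zeroʳ c)
  ΣL-* (x ∷ xs) c f = trans (cong (c *ᶻ f x +ᶻ_) (ΣL-* xs c f)) (sym (ℤP.*-distribˡ-+ c _ _))

  ΣL-zero : ∀ (xs : List A) {f : A → ℤ} → (∀ {x} → x ∈ˡ xs → f x ≡ 0ℤ) → ΣL xs f ≡ 0ℤ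
  ΣL-zero xs h = trans (ΣL-cong xs {g = λ _ → 0ℤ *ᶻ 0ℤ} h) (ΣL-* xs 0ℤ (λ _ → 0ℤ))

  ΣL-Σ⊆ : ∀ (xs : List A) {n} (E : Subset n) (f : A → Subset n → ℤ) →
          Σ⊆ E (λ B → ΣL xs (λ x → f x B)) ≡ ΣL xs (λ x → Σ⊆ E (f x))
  ΣL-Σ⊆ []       E f = Σ⊆-zero E (λ _ _ → refl)
  ΣL-Σ⊆ (x ∷ xs) E f = trans (Σ⊆-+ E _ _) (cong (Σ⊆ E (f x) +ᶻ_) (ΣL-Σ⊆ xs E f))

ΣL-subsets : ∀ n (f : Subset n → ℤ) → ΣL (subsets n) f ≡ Σ⊆ ⊤ f
ΣL-subsets zero    f = ℤP.+-identityʳ _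
ΣL-subsets (suc n) f = trans (ΣL-++ (map (outside ∷_) (subsets n)) _ f)
  (cong₂ _+ᶻ_ (trans (ΣL-map _ (subsets n) f) (ΣL-subsets n _)) (trans (ΣL-map _ (subsets n) f) (ΣL-subsets n _)))

ΣL-filter-subsets : ∀ {n} (E : Subset n) (p : Subset n → Bool) (f : Subset n → ℤ) →
  (∀ A → p A ≡ true → A ⊆ E) →
  ΣL (filterᵇ p (subsets n)) f ≡ Σ⊆ E (λ A → if p A then f A else 0ℤ)
ΣL-filter-subsets {n} E p f h = trans (ΣL-filter p (subsets n) f) (trans (ΣL-subsets n _)
  (Σ⊆-restrict (SubP.⊆-max E) _ off))
  where
  off : ∀ A → A ⊆ ⊤ → ¬ (A ⊆ E) → (if p A then f A else 0ℤ) ≡ 0ℤ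
  off A _ ns with p A in eq
  ... | true  = ⊥-elim (ns (h A eq))
  ... | false = refl

-- Bin s f = Σ_t (s choose t) f t
Bin : ℕ → (ℕ → ℤ) → ℤ
Bin zero    f = f 0
Bin (suc s) f = Bin s f +ᶻ Bin s (f ∘ suc)

Bin-cong≤ : ∀ s {f g : ℕ → ℤ} → (∀ t → t ≤ s → f t ≡ g t) → Bin s f ≡ Bin s g
Bin-cong≤ zero    h = h 0 z≤n
Bin-cong≤ (suc s) h = cong₂ _+ᶻ_ (Bin-cong≤ s (λ t l → h t (ℕP.m≤n⇒m≤1+n l))) (Bin-cong≤ s (λ t l → h (suc t) (s≤s l)))

Bin-cong : ∀ s {f g : ℕ → ℤ} → (∀ t → f t ≡ g t) → Bin s f ≡ Bin s g
Bin-cong s h = Bin-cong≤ s (λ t _ → h t)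

Bin-+ : ∀ s (f g : ℕ → ℤ) → Bin s (λ t → f t +ᶻ g t) ≡ Bin s f +ᶻ Bin s g
Bin-+ zero    f g = refl
Bin-+ (suc s) f g = trans (cong₂ _+ᶻ_ (Bin-+ s f g) (Bin-+ s (f ∘ suc) (g ∘ suc)))
  (interchange (Bin s f) (Bin s g) (Bin s (f ∘ suc)) (Bin s (g ∘ suc)))

Bin-* : ∀ s c (f : ℕ → ℤ) → Bin s (λ t → c *ᶻ f t) ≡ c *ᶻ Bin s f
Bin-* zero    c f = refl
Bin-* (suc s) c f = trans (cong₂ _+ᶻ_ (Bin-* s c f) (Bin-* s c (f ∘ suc))) (sym (ℤP.*-distribˡ-+ c _ _))

Bin-zero : ∀ s {f : ℕ → ℤ} → (∀ t → f t ≡ 0ℤ) → Bin s f ≡ 0ℤ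
Bin-zero s h = trans (Bin-cong s {g = λ _ → 0ℤ *ᶻ 0ℤ} h) (Bin-* s 0ℤ (λ _ → 0ℤ))

-- Vandermonde's convolution: choose from the two parts of a disjoint union separately.
Bin-Bin : ∀ a c (f : ℕ → ℤ) → Bin (a + c) f ≡ Bin a (λ i → Bin c (λ j → f (i + j)))
Bin-Bin zero    c f = refl
Bin-Bin (suc a) c f = cong₂ _+ᶻ_ (Bin-Bin a c f) (Bin-Bin a c (f ∘ suc))

Bin-swap : ∀ a c (f : ℕ → ℕ → ℤ) → Bin a (λ i → Bin c (f i)) ≡ Bin c (λ j → Bin a (λ i → f i j))
Bin-swap zero    c f = refl
Bin-swap (suc a) c f = trans (cong₂ _+ᶻ_ (Bin-swap a c f) (Bin-swap a c (f ∘ suc))) (sym (Bin-+ c _ _))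

Bin-reverse : ∀ s (f : ℕ → ℤ) → Bin s f ≡ Bin s (λ t → f (s ∸ t))
Bin-reverse zero    f = refl
Bin-reverse (suc s) f = trans (ℤP.+-comm (Bin s f) _) (cong₂ _+ᶻ_
  (trans (Bin-reverse s (f ∘ suc)) (Bin-cong≤ s (λ t l → cong f (sym (ℕP.+-∸-assoc 1 l)))))
  (Bin-reverse s f))

-- The binomial theorem for (1 - 1)^(s+1).
Bin-sgn : ∀ s → Bin (suc s) sgn ≡ 0ℤ
Bin-sgn s = trans (cong (Bin s sgn +ᶻ_) (trans (Bin-cong s (λ t → sym (ℤP.-1*i≡-i (sgn t)))) (trans (Bin-* s -1ℤ sgn) (ℤP.-1*i≡-i _)))) (ℤP.+-inverseʳ (Bin s sgn))

Σ⊆-card : ∀ {n} (E : Subset n) (f : ℕ → ℤ) → Σ⊆ E (λ A → f ∣ A ∣) ≡ Bin ∣ E ∣ f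
Σ⊆-card []            f = refl
Σ⊆-card (outside ∷ E) f = Σ⊆-card E f
Σ⊆-card (inside  ∷ E) f = cong₂ _+ᶻ_ (Σ⊆-card E f) (Σ⊆-card E (f ∘ suc))

-- A subset `A` of `E` amounts to an independent choice of `A ∩ S` and `A ─ S`, of sizes `i` and
-- `j`.
Σ⊆-card₂ : ∀ {n} {S E : Subset n} → S ⊆ E → (h : ℕ → ℕ → ℤ) →
  Σ⊆ E (λ A → h ∣ A ∩ S ∣ ∣ A ∣) ≡ Bin ∣ S ∣ (λ i → Bin ∣ E ─ S ∣ (λ j → h i (i + j)))
Σ⊆-card₂ {S = []} {[]} s h = refl
Σ⊆-card₂ {S = inside ∷ S} {outside ∷ E} s h = ⊥-elim (in⊈out s)
Σ⊆-card₂ {S = outside ∷ S} {outside ∷ E} s h = Σ⊆-card₂ (SubP.drop-∷-⊆ s) h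
Σ⊆-card₂ {S = inside ∷ S} {inside ∷ E} s h = cong₂ _+ᶻ_
  (Σ⊆-card₂ (SubP.drop-∷-⊆ s) h) (Σ⊆-card₂ (SubP.drop-∷-⊆ s) (λ i j → h (suc i) (suc j)))
Σ⊆-card₂ {S = outside ∷ S} {inside ∷ E} s h = trans
  (cong₂ _+ᶻ_ (Σ⊆-card₂ (SubP.drop-∷-⊆ s) h) (Σ⊆-card₂ (SubP.drop-∷-⊆ s) (λ i j → h i (suc j))))
  (trans (sym (Bin-+ ∣ S ∣ _ _)) (Bin-cong ∣ S ∣ (λ i → cong (Bin ∣ E ─ S ∣ (λ j → h i (i + j)) +ᶻ_)
     (Bin-cong ∣ E ─ S ∣ (λ j → cong (h i) (sym (ℕP.+-suc i j)))))))

-- Isolates the empty set: `f ⊥` will be the unknown Q, and `g` a closed formula that is right on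
-- nonempty sets only, so its value at `⊥` is taken out again.
Σ⊆-nonempty : ∀ {n} (E : Subset n) (f g : Subset n → ℤ) →
  (∀ A → A ⊆ E → 0 < ∣ A ∣ → f A ≡ g A) → Σ⊆ E f ≡ f ⊥ +ᶻ (Σ⊆ E g -ᶻ g ⊥)
Σ⊆-nonempty {n} E f g h = begin
  Σ⊆ E f ≡⟨ Σ⊆-cong E (λ A _ → lem (f A) (g A)) ⟩
  Σ⊆ E (λ A → (f A -ᶻ g A) +ᶻ g A) ≡⟨ Σ⊆-+ E _ _ ⟩
  Σ⊆ E (λ A → f A -ᶻ g A) +ᶻ Σ⊆ E g ≡⟨ cong (_+ᶻ Σ⊆ E g) (Σ⊆-unique (SubP.⊆-min E) _ off) ⟩
  (f ⊥ -ᶻ g ⊥) +ᶻ Σ⊆ E g ≡⟨ lem' (f ⊥) (g ⊥) (Σ⊆ E g) ⟩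
  f ⊥ +ᶻ (Σ⊆ E g -ᶻ g ⊥) ∎
  where
  open ≡-Reasoning
  lem : ∀ x y → x ≡ (x -ᶻ y) +ᶻ y
  lem = ℤR.solve-∀
  lem' : ∀ x y z → (x -ᶻ y) +ᶻ z ≡ x +ᶻ (z -ᶻ y)
  lem' = ℤR.solve-∀
  ne : ∀ {m} (A : Subset m) → A ≢ ⊥ → 0 < ∣ A ∣
  ne []            d = ⊥-elim (d refl)
  ne (outside ∷ A) d = ne A (d ∘ cong (outside ∷_))
  ne (inside  ∷ A) d = s≤s z≤n
  off : ∀ A → A ⊆ E → A ≢ ⊥ → f A -ᶻ g A ≡ 0ℤ
  off A A⊆E d = ℤP.i≡j⇒i-j≡0 (h A A⊆E (ne A d))

-- Polynomials as linear functionals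

-- ev p g = Σ_j (coeff p j) g j: the linear functional that sends x^j to g j.
ev : Poly → (ℕ → ℤ) → ℤ
ev []      g = 0ℤ
ev (a ∷ p) g = a *ᶻ g 0 +ᶻ ev p (g ∘ suc)

δ : ℕ → ℕ → ℤ
δ i j = if i ≡ᵇ j then 1ℤ else 0ℤ

ev-zero : ∀ p → ev p (λ _ → 0ℤ) ≡ 0ℤ
ev-zero []      = refl
ev-zero (a ∷ p) = cong₂ _+ᶻ_ (ℤP.*-zeroʳ a) (ev-zero p)

ev-δ : ∀ p i → ev p (δ i) ≡ coeff p i
ev-δ []      i       = refl
ev-δ (a ∷ p) zero    = trans (cong₂ _+ᶻ_ (ℤP.*-identityʳ a) (ev-zero p)) (ℤP.+-identityʳ a)
ev-δ (a ∷ p) (suc i) = trans (cong₂ _+ᶻ_ (ℤP.*-zeroʳ a) (ev-δ p i)) (ℤP.+-identityˡ _)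

-- The choice for each coefficient makes truncated subtraction harmless: an identity between
-- exponents may fail beyond the degree, where the coefficient vanishes.
ev-agree : ∀ p {g h : ℕ → ℤ} → (∀ j → coeff p j ≡ 0ℤ ⊎ g j ≡ h j) → ev p g ≡ ev p h
ev-agree []      H = refl
ev-agree (a ∷ p) {g} {h} H = cong₂ _+ᶻ_ (step (H 0)) (ev-agree p (H ∘ suc))
  where
  step : a ≡ 0ℤ ⊎ g 0 ≡ h 0 → a *ᶻ g 0 ≡ a *ᶻ h 0
  step (inj₁ refl) = refl
  step (inj₂ e)    = cong (a *ᶻ_) e

ev-cong : ∀ p {g h : ℕ → ℤ} → (∀ j → g j ≡ h j) → ev p g ≡ ev p h
ev-cong p H = ev-agree p (inj₂ ∘ H)

ev-+ : ∀ p (g h : ℕ → ℤ) → ev p (λ j → g j +ᶻ h j) ≡ ev p g +ᶻ ev p h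
ev-+ []      g h = refl
ev-+ (a ∷ p) g h = trans (cong₂ _+ᶻ_ (ℤP.*-distribˡ-+ a (g 0) (h 0)) (ev-+ p (g ∘ suc) (h ∘ suc)))
  (interchange (a *ᶻ g 0) (a *ᶻ h 0) (ev p (g ∘ suc)) (ev p (h ∘ suc)))

ev-* : ∀ p c (g : ℕ → ℤ) → ev p (λ j → c *ᶻ g j) ≡ c *ᶻ ev p g
ev-* []      c g = sym (ℤP.*-zeroʳ c)
ev-* (a ∷ p) c g = trans (cong (a *ᶻ (c *ᶻ g 0) +ᶻ_) (ev-* p c (g ∘ suc))) (lem a c (g 0) (ev p (g ∘ suc)))
  where
  lem : ∀ a c x y → a *ᶻ (c *ᶻ x) +ᶻ c *ᶻ y ≡ c *ᶻ (a *ᶻ x +ᶻ y)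
  lem = ℤR.solve-∀

ev-Bin : ∀ p s (h : ℕ → ℕ → ℤ) → ev p (λ k → Bin s (h k)) ≡ Bin s (λ t → ev p (λ k → h k t))
ev-Bin p zero    h = refl
ev-Bin p (suc s) h = trans (ev-+ p _ _) (cong₂ _+ᶻ_ (ev-Bin p s h) (ev-Bin p s (λ k → h k ∘ suc)))

ev-+P : ∀ p q g → ev (p +P q) g ≡ ev p g +ᶻ ev q g
ev-+P []      q       g = sym (ℤP.+-identityˡ _)
ev-+P (a ∷ p) []      g = sym (ℤP.+-identityʳ _)
ev-+P (a ∷ p) (b ∷ q) g = trans (cong₂ _+ᶻ_ (ℤP.*-distribʳ-+ (g 0) a b) (ev-+P p q (g ∘ suc)))
  (interchange (a *ᶻ g 0) (b *ᶻ g 0) (ev p (g ∘ suc)) (ev q (g ∘ suc)))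

ev-scale : ∀ c p g → ev (scaleP c p) g ≡ c *ᶻ ev p g
ev-scale c []      g = sym (ℤP.*-zeroʳ c)
ev-scale c (a ∷ p) g = trans (cong₂ _+ᶻ_ (ℤP.*-assoc c a (g 0)) (ev-scale c p (g ∘ suc))) (sym (ℤP.*-distribˡ-+ c _ _))

ev-shift : ∀ k p g → ev (shiftP k p) g ≡ ev p (λ j → g (k + j))
ev-shift zero    p g = refl
ev-shift (suc k) p g = trans (ℤP.+-identityˡ _) (ev-shift k p (g ∘ suc))

ev-sumP : ∀ {a} {A : Set a} (xs : List A) (f : A → Poly) g → ev (sumP (map f xs)) g ≡ ΣL xs (λ x → ev (f x) g)
ev-sumP []       f g = refl
ev-sumP (x ∷ xs) f g = trans (ev-+P (f x) _ g) (cong (ev (f x) g +ᶻ_) (ev-sumP xs f g))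

ev-*P : ∀ p q g → ev (p *P q) g ≡ ev p (λ j → ev q (λ k → g (j + k)))
ev-*P []      q g = refl
ev-*P (a ∷ p) q g = trans (ev-+P (scaleP a q) _ g) (cong₂ _+ᶻ_ (ev-scale a q g)
  (trans (ℤP.+-identityˡ _) (ev-*P p q (g ∘ suc))))

ev-≈ : ∀ {p q} → p ≈P q → ∀ g → ev p g ≡ ev q g
ev-≈ {[]}    {[]}    e g = refl
ev-≈ {[]}    {b ∷ q} e g = trans (ev-≈ {[]} {q} (e ∘ suc) (g ∘ suc)) (sym (trans (cong (λ z → z *ᶻ g 0 +ᶻ ev q (g ∘ suc)) (sym (e 0))) (ℤP.+-identityˡ _)))
ev-≈ {a ∷ p} {[]}    e g = trans (cong (λ z → z *ᶻ g 0 +ᶻ ev p (g ∘ suc)) (e 0)) (trans (ℤP.+-identityˡ _) (ev-≈ {p} {[]} (e ∘ suc) (g ∘ suc)))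
ev-≈ {a ∷ p} {b ∷ q} e g = cong₂ _+ᶻ_ (cong (_*ᶻ g 0) (e 0)) (ev-≈ {p} {q} (e ∘ suc) (g ∘ suc))

ev-oneP : ∀ g → ev oneP g ≡ g 0
ev-oneP g = trans (ℤP.+-identityʳ _) (ℤP.*-identityˡ _)

Sum< : ℕ → (ℕ → ℤ) → ℤ
Sum< zero    f = 0ℤ
Sum< (suc n) f = f 0 +ᶻ Sum< n (f ∘ suc)

Sum<-cong : ∀ n {f g : ℕ → ℤ} → (∀ j → j < n → f j ≡ g j) → Sum< n f ≡ Sum< n g
Sum<-cong zero    h = refl
Sum<-cong (suc n) h = cong₂ _+ᶻ_ (h 0 (s≤s z≤n)) (Sum<-cong n (λ j l → h (suc j) (s≤s l)))

Sum<-last : ∀ n f → Sum< (suc n) f ≡ f n +ᶻ Sum< n f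
Sum<-last zero    f = refl
Sum<-last (suc n) f = trans (cong (f 0 +ᶻ_) (Sum<-last n (f ∘ suc))) (lem (f 0) (f (suc n)) _)
  where
  lem : ∀ x y z → x +ᶻ (y +ᶻ z) ≡ y +ᶻ (x +ᶻ z)
  lem = ℤR.solve-∀

Sum<-reverse : ∀ d f → Sum< (suc d) f ≡ Sum< (suc d) (λ j → f (d ∸ j))
Sum<-reverse zero    f = refl
Sum<-reverse (suc d) f = trans (Sum<-last (suc d) f) (cong (f (suc d) +ᶻ_) (Sum<-reverse d f))

ev-Sum< : ∀ p N g → (∀ j → N ≤ j → coeff p j ≡ 0ℤ) → ev p g ≡ Sum< N (λ j → coeff p j *ᶻ g j)
ev-Sum< p       zero    g h = trans (ev-agree p (λ j → inj₁ (h j z≤n))) (ev-zero p)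
ev-Sum< []      (suc N) g h = trans (ev-Sum< [] N (g ∘ suc) (λ _ _ → refl)) (sym (ℤP.+-identityˡ _))
ev-Sum< (a ∷ p) (suc N) g h = cong (a *ᶻ g 0 +ᶻ_) (ev-Sum< p N (g ∘ suc) (λ j l → h (suc j) (s≤s l)))

palindromic⇒reverse : ∀ p {d} → Palindromic p d → ∀ g → ev p g ≡ ev p (λ j → g (d ∸ j))
palindromic⇒reverse p {d} (pal , top) g = begin
  ev p g ≡⟨ ev-Sum< p (suc d) g top ⟩
  Sum< (suc d) (λ j → coeff p j *ᶻ g j) ≡⟨ Sum<-reverse d (λ j → coeff p j *ᶻ g j) ⟩
  Sum< (suc d) (λ j → coeff p (d ∸ j) *ᶻ g (d ∸ j)) ≡⟨ Sum<-cong (suc d) (λ { j (s≤s l) → cong (_*ᶻ g (d ∸ j)) (sym (pal j l)) }) ⟩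
  Sum< (suc d) (λ j → coeff p j *ᶻ g (d ∸ j)) ≡⟨ sym (ev-Sum< p (suc d) (λ j → g (d ∸ j)) top) ⟩
  ev p (λ j → g (d ∸ j)) ∎
  where open ≡-Reasoning

δ-refl : ∀ i → δ i i ≡ 1ℤ
δ-refl zero    = refl
δ-refl (suc i) = δ-refl i

δ-≢ : ∀ {i j} → i ≢ j → δ i j ≡ 0ℤ
δ-≢ {zero}  {zero}  d = ⊥-elim (d refl)
δ-≢ {zero}  {suc j} d = refl
δ-≢ {suc i} {zero}  d = refl
δ-≢ {suc i} {suc j} d = δ-≢ {i} {j} (d ∘ cong suc)

δ-flip : ∀ {d i j} → i ≤ d → j ≤ d → δ i (d ∸ j) ≡ δ (d ∸ i) j
δ-flip {d} {i} {j} i≤d j≤d with d ∸ i ℕP.≟ j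
... | yes refl = trans (cong (δ i) (ℕP.m∸[m∸n]≡n i≤d)) (trans (δ-refl i) (sym (δ-refl (d ∸ i))))
... | no  n    = trans (δ-≢ {i} {d ∸ j} (λ e → n (trans (cong (d ∸_) e) (ℕP.m∸[m∸n]≡n j≤d)))) (sym (δ-≢ {d ∸ i} {j} n))

-- The test functions `δ i` recover the coefficients. For `i > d` the value `d ∸ j` never reaches
-- `i`, so the coefficient is zero; this in turn excuses the truncation in `d ∸ j` for `j > d`.
reverse⇒palindromic : ∀ p {d} → (∀ g → ev p g ≡ ev p (λ j → g (d ∸ j))) → Palindromic p d
reverse⇒palindromic p {d} rev = pal , top
  where
  open ≡-Reasoning
  top : ∀ i → d < i → coeff p i ≡ 0ℤ
  top i l = begin
    coeff p i ≡⟨ sym (ev-δ p i) ⟩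
    ev p (δ i) ≡⟨ rev (δ i) ⟩
    ev p (λ j → δ i (d ∸ j)) ≡⟨ ev-cong p (λ j → δ-≢ {i} {d ∸ j} (λ e → ℕP.<⇒≱ l (subst (_≤ d) (sym e) (ℕP.m∸n≤m d j)))) ⟩
    ev p (λ _ → 0ℤ) ≡⟨ ev-zero p ⟩
    0ℤ ∎
  pal : ∀ i → i ≤ d → coeff p i ≡ coeff p (d ∸ i)
  pal i l = begin
    coeff p i ≡⟨ sym (ev-δ p i) ⟩
    ev p (δ i) ≡⟨ rev (δ i) ⟩
    ev p (λ j → δ i (d ∸ j)) ≡⟨ ev-agree p agree ⟩
    ev p (δ (d ∸ i)) ≡⟨ ev-δ p (d ∸ i) ⟩
    coeff p (d ∸ i) ∎
    where
    agree : ∀ j → coeff p j ≡ 0ℤ ⊎ δ i (d ∸ j) ≡ δ (d ∸ i) j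
    agree j with ℕP.≤-<-connex j d
    ... | inj₁ j≤d = inj₂ (δ-flip l j≤d)
    ... | inj₂ d<j = inj₁ (top j d<j)

-- Reflecting both factors reflects the exponent `j + k`. Where the bounds of `∸-+-∸` fail, a
-- coefficient is zero.
palindromic-* : ∀ p q {d e} → Palindromic p d → Palindromic q e → Palindromic (p *P q) (d + e)
palindromic-* p q {d} {e} P Q = reverse⇒palindromic (p *P q) λ g → begin
  ev (p *P q) g ≡⟨ ev-*P p q g ⟩
  ev p (λ j → ev q (λ k → g (j + k))) ≡⟨ palindromic⇒reverse p P _ ⟩
  ev p (λ j → ev q (λ k → g (d ∸ j + k))) ≡⟨ ev-cong p (λ j → palindromic⇒reverse q Q (λ k → g (d ∸ j + k))) ⟩
  ev p (λ j → ev q (λ k → g (d ∸ j + (e ∸ k)))) ≡⟨ ev-agree p (agree g) ⟩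
  ev p (λ j → ev q (λ k → g (d + e ∸ (j + k)))) ≡⟨ sym (ev-*P p q _) ⟩
  ev (p *P q) (λ j → g (d + e ∸ j)) ∎
  where
  open ≡-Reasoning
  ∸-+-∸ : ∀ j k → j ≤ d → k ≤ e → d ∸ j + (e ∸ k) ≡ d + e ∸ (j + k)
  ∸-+-∸ j k j≤d k≤e = begin
    d ∸ j + (e ∸ k) ≡⟨ sym (ℕP.+-∸-assoc (d ∸ j) k≤e) ⟩
    d ∸ j + e ∸ k ≡⟨ cong (_∸ k) (sym (ℕP.+-∸-comm e j≤d)) ⟩
    d + e ∸ j ∸ k ≡⟨ ℕP.∸-+-assoc (d + e) j k ⟩
    d + e ∸ (j + k) ∎
  agree : ∀ g j → coeff p j ≡ 0ℤ ⊎ ev q (λ k → g (d ∸ j + (e ∸ k))) ≡ ev q (λ k → g (d + e ∸ (j + k)))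
  agree g j with ℕP.≤-<-connex j d
  ... | inj₂ d<j = inj₁ (proj₂ P j d<j)
  ... | inj₁ j≤d = inj₂ (ev-agree q agree′)
    where
    agree′ : ∀ k → coeff q k ≡ 0ℤ ⊎ g (d ∸ j + (e ∸ k)) ≡ g (d + e ∸ (j + k))
    agree′ k with ℕP.≤-<-connex k e
    ... | inj₂ e<k = inj₁ (proj₂ Q k e<k)
    ... | inj₁ k≤e = inj₂ (cong g (∸-+-∸ j k j≤d k≤e))

-- (1 + x)^m
binP : ℕ → Poly
binP zero    = oneP
binP (suc m) = binP m +P (0ℤ ∷ binP m)

ev-binP : ∀ m g → ev (binP m) g ≡ Bin m g
ev-binP zero    g = ev-oneP g
ev-binP (suc m) g = trans (ev-+P (binP m) _ g) (cong₂ _+ᶻ_ (ev-binP m g) (trans (ℤP.+-identityˡ _) (ev-binP m (g ∘ suc))))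

binP-palindromic : ∀ m → Palindromic (binP m) m
binP-palindromic m = reverse⇒palindromic (binP m) λ g → trans (ev-binP m g) (trans (Bin-reverse m g) (sym (ev-binP m _)))

Low : Poly → ℕ → Set
Low p d = ∀ i → d ≤ 2 * i → coeff p i ≡ 0ℤ

-- The coefficients of the polynomial p of degree less than d/2 for which p + K is
-- palindromic of degree d, where K is given as a linear functional on the x^i.
half : ℕ → ((ℕ → ℤ) → ℤ) → ℕ → ℤ
half d K i = if d ≤ᵇ 2 * i then 0ℤ else K (δ (d ∸ i)) -ᶻ K (δ i)

-- For `2 * i < d` the coefficient of `p` at `d ∸ i` vanishes, so palindromicity of `y` at `i` reads
-- p_i + K_i = K_(d-i). Only `d` and `K` enter the result: two solutions with the same data agree,
-- whatever matroid or product they come from.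
half-unique : ∀ y p {d} K → Palindromic y d → Low p d → (∀ g → ev y g ≡ ev p g +ᶻ K g) → ∀ i → coeff p i ≡ half d K i
half-unique y p {d} K pal low eq i with d ≤ᵇ 2 * i in le
... | true  = low i (ℕP.≤ᵇ⇒≤ d (2 * i) (subst T (sym le) tt))
... | false = begin
  coeff p i ≡⟨ lem _ (K (δ i)) ⟩
  (coeff p i +ᶻ K (δ i)) -ᶻ K (δ i) ≡⟨ cong (_-ᶻ K (δ i)) (trans (cong (_+ᶻ K (δ i)) (sym (ev-δ p i))) (sym (eq (δ i)))) ⟩
  ev y (δ i) -ᶻ K (δ i) ≡⟨ cong (_-ᶻ K (δ i)) (trans (ev-δ y i) (trans (proj₁ pal i i≤d) (sym (ev-δ y (d ∸ i))))) ⟩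
  ev y (δ (d ∸ i)) -ᶻ K (δ i) ≡⟨ cong (_-ᶻ K (δ i)) (eq (δ (d ∸ i))) ⟩
  (ev p (δ (d ∸ i)) +ᶻ K (δ (d ∸ i))) -ᶻ K (δ i) ≡⟨ cong (λ z → (z +ᶻ K (δ (d ∸ i))) -ᶻ K (δ i)) (trans (ev-δ p (d ∸ i)) (low (d ∸ i) upper)) ⟩
  (0ℤ +ᶻ K (δ (d ∸ i))) -ᶻ K (δ i) ≡⟨ cong (_-ᶻ K (δ i)) (ℤP.+-identityˡ (K (δ (d ∸ i)))) ⟩
  K (δ (d ∸ i)) -ᶻ K (δ i) ∎
  where
  open ≡-Reasoning
  lem : ∀ x k → x ≡ (x +ᶻ k) -ᶻ k
  lem = ℤR.solve-∀
  2i<d : 2 * i < d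
  2i<d = ℕP.≰⇒> (λ l → subst T le (ℕP.≤⇒≤ᵇ l))
  i≤d : i ≤ d
  i≤d = ℕP.≤-trans (ℕP.m≤m+n i (i + 0)) (ℕP.<⇒≤ 2i<d)
  upper : d ≤ 2 * (d ∸ i)
  upper = subst (_≤ 2 * (d ∸ i)) (ℕP.m+[n∸m]≡n i≤d)
    (subst (i + (d ∸ i) ≤_) (cong (λ z → (d ∸ i) + z) (sym (ℕP.+-identityʳ (d ∸ i))))
      (ℕP.+-monoˡ-≤ (d ∸ i) (ℕP.m+n≤o⇒m≤o∸n i (subst (λ z → i + z ≤ d) (ℕP.+-identityʳ i) (ℕP.<⇒≤ 2i<d)))))

-- Flats, closure and contraction

all-tabulate⁺ : ∀ {a} {A : Set a} {n} (p : A → Bool) (f : Fin n → A) → (∀ i → p (f i) ≡ true) → all p (List.tabulate f) ≡ true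
all-tabulate⁺ {n = zero}  p f h = refl
all-tabulate⁺ {n = suc n} p f h = cong₂ _∧_ (h zero) (all-tabulate⁺ p (f ∘ suc) (h ∘ suc))

all-tabulate⁻ : ∀ {a} {A : Set a} {n} (p : A → Bool) (f : Fin n → A) → all p (List.tabulate f) ≡ true → ∀ i → p (f i) ≡ true
all-tabulate⁻ {n = suc n} p f h i with p (f zero) in eq
all-tabulate⁻ {n = suc n} p f h zero    | true = eq
all-tabulate⁻ {n = suc n} p f h (suc i) | true = all-tabulate⁻ p (f ∘ suc) h i

all-tabulate-false : ∀ {a} {A : Set a} {n} (p : A → Bool) (f : Fin n → A) → all p (List.tabulate f) ≡ false → ∃ λ i → p (f i) ≡ false
all-tabulate-false {n = suc n} p f h with p (f zero) in eq
... | false = zero , eq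
... | true with i , e ← all-tabulate-false p (f ∘ suc) h = suc i , e

dec-true⁻ : ∀ {a} {A : Set a} (d : Dec A) → does d ≡ true → A
dec-true⁻ (yes a) _ = a

T⇒≡true : ∀ {b} → T b → b ≡ true
T⇒≡true {true} _ = refl

≡ᵇ-true⁻ : ∀ {m n} → (m ≡ᵇ n) ≡ true → m ≡ n
≡ᵇ-true⁻ {m} {n} e = ℕP.≡ᵇ⇒≡ m n (subst T (sym e) tt)

≡ᵇ-true : ∀ {m n} → m ≡ n → (m ≡ᵇ n) ≡ true
≡ᵇ-true {m} {n} e with m ≡ᵇ n in eq
... | true  = refl
... | false = ⊥-elim (subst T eq (ℕP.≡⇒≡ᵇ m n e))

≡ᵇ-false⁻ : ∀ {m n} → (m ≡ᵇ n) ≡ false → m ≢ n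
≡ᵇ-false⁻ e m≡n with () ← trans (sym e) (≡ᵇ-true m≡n)

≡ᵇ-false : ∀ {m n} → m ≢ n → (m ≡ᵇ n) ≡ false
≡ᵇ-false {m} {n} ne with m ≡ᵇ n in eq
... | false = refl
... | true  = ⊥-elim (ne (≡ᵇ-true⁻ eq))

∧-true⁻ : ∀ {a b} → (a ∧ b) ≡ true → a ≡ true × b ≡ true
∧-true⁻ {true} {true} _ = refl , refl

lookup-∈ : ∀ {n} {e : Fin n} {A} → e ∈ A → lookup A e ≡ true
lookup-∈ here      = refl
lookup-∈ (there m) = lookup-∈ m

∈-lookup : ∀ {n} (A : Subset n) (e : Fin n) → lookup A e ≡ true → e ∈ A
∈-lookup (true ∷ A) zero    refl = here
∈-lookup (x ∷ A)    (suc e) h    = there (∈-lookup A e h)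

lookup-∉ : ∀ {n} {e : Fin n} {A} → e ∉ A → lookup A e ≡ false
lookup-∉ {e = e} {A} n with lookup A e in eq
... | false = refl
... | true  = ⊥-elim (n (∈-lookup A e eq))

∈─⁻ : ∀ {n} {p q : Subset n} {x} → x ∈ p ─ q → x ∈ p × x ∉ q
∈─⁻ {p = inside ∷ p} {outside ∷ q} here = here , λ ()
∈─⁻ {p = _ ∷ p} {outside ∷ q} (there m) with a , b ← ∈─⁻ {p = p} {q} m = there a , λ { (there c) → b c }
∈─⁻ {p = _ ∷ p} {inside ∷ q} (there m) with a , b ← ∈─⁻ {p = p} {q} m = there a , λ { (there c) → b c }

∈─⁺ : ∀ {n} {p q : Subset n} {x} → x ∈ p → x ∉ q → x ∈ p ─ q
∈─⁺ = SubP.x∈p∧x∉q⇒x∈p─q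

∪-⊆ : ∀ {n} {A B C : Subset n} → A ⊆ C → B ⊆ C → A ∪ B ⊆ C
∪-⊆ {A = A} {B} f g x = [ f , g ]′ (SubP.x∈p∪q⁻ A B x)

∪-mono : ∀ {n} {A B C D : Subset n} → A ⊆ C → B ⊆ D → A ∪ B ⊆ C ∪ D
∪-mono {C = C} {D} f g = ∪-⊆ (λ x → SubP.p⊆p∪q D (f x)) (λ x → SubP.q⊆p∪q C D (g x))

⁅⁆-⊆ : ∀ {n} {e : Fin n} {A} → e ∈ A → ⁅ e ⁆ ⊆ A
⁅⁆-⊆ {e = e} m x with refl ← SubP.x∈⁅y⁆⇒x≡y e x = m

⊆-∩ : ∀ {n} {A B C : Subset n} → A ⊆ B → A ⊆ C → A ⊆ B ∩ C
⊆-∩ f g x = SubP.x∈p∩q⁺ (f x , g x)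

─-antitone : ∀ {n} {A B : Subset n} (E : Subset n) → A ⊆ B → E ─ B ⊆ E ─ A
─-antitone {A = A} {B} E s x with a , b ← ∈─⁻ {p = E} {B} x = ∈─⁺ a (b ∘ s)

─-involutive : ∀ {n} {E T : Subset n} → T ⊆ E → E ─ (E ─ T) ≡ T
─-involutive {E = E} {T} s = ⊆-antisym f g
  where
  f : E ─ (E ─ T) ⊆ T
  f {x} m with a , b ← ∈─⁻ {p = E} {E ─ T} m with x ∈? T
  ... | yes t = t
  ... | no  t = ⊥-elim (b (∈─⁺ a t))
  g : T ⊆ E ─ (E ─ T)
  g {x} m = ∈─⁺ (s m) (λ m′ → proj₂ (∈─⁻ {p = E} {T} m′) m)

─-∪ : ∀ {n} {E F : Subset n} → F ⊆ E → (E ─ F) ∪ F ≡ E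
─-∪ {E = E} {F} s = ⊆-antisym (∪-⊆ (SubP.p─q⊆p E F) s) g
  where
  g : E ⊆ (E ─ F) ∪ F
  g {x} m with x ∈? F
  ... | yes t = SubP.q⊆p∪q (E ─ F) F t
  ... | no  t = SubP.p⊆p∪q F (∈─⁺ m t)

─-∪-─ : ∀ {n} {D T E : Subset n} → D ⊆ T → T ⊆ E → (T ─ D) ∪ (E ─ T) ≡ E ─ D
─-∪-─ {D = D} {T} {E} s t = ⊆-antisym
  (∪-⊆ (λ m → let a , b = ∈─⁻ {p = T} {D} m in ∈─⁺ (t a) b) (─-antitone E s)) g
  where
  g : E ─ D ⊆ (T ─ D) ∪ (E ─ T)
  g {x} m with a , b ← ∈─⁻ {p = E} {D} m with x ∈? T
  ... | yes c = SubP.p⊆p∪q (E ─ T) (∈─⁺ c b)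
  ... | no  c = SubP.q⊆p∪q (T ─ D) (E ─ T) (∈─⁺ a c)

─-self : ∀ {n} (E : Subset n) → E ─ E ≡ ⊥
─-self []            = refl
─-self (inside ∷ E)  = cong (outside ∷_) (─-self E)
─-self (outside ∷ E) = cong (outside ∷_) (─-self E)

∣─∣ : ∀ {n} {E T : Subset n} → T ⊆ E → ∣ E ─ T ∣ + ∣ T ∣ ≡ ∣ E ∣
∣─∣ {E = []} {[]} s = refl
∣─∣ {E = outside ∷ E} {outside ∷ T} s = ∣─∣ (SubP.drop-∷-⊆ s)
∣─∣ {E = outside ∷ E} {inside ∷ T} s = ⊥-elim (in⊈out s)
∣─∣ {E = inside ∷ E} {outside ∷ T} s = cong suc (∣─∣ (SubP.drop-∷-⊆ s))
∣─∣ {E = inside ∷ E} {inside ∷ T} s = trans (ℕP.+-suc ∣ E ─ T ∣ ∣ T ∣) (cong suc (∣─∣ (SubP.drop-∷-⊆ s)))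

∣∪⁅⁆∣ : ∀ {n} {A : Subset n} {e} → e ∉ A → ∣ A ∪ ⁅ e ⁆ ∣ ≡ suc ∣ A ∣
∣∪⁅⁆∣ {A = outside ∷ A} {zero} n = cong (λ Z → suc ∣ Z ∣) (SubP.∪-identityʳ A)
∣∪⁅⁆∣ {A = inside ∷ A} {zero} n = ⊥-elim (n here)
∣∪⁅⁆∣ {A = outside ∷ A} {suc e} n = ∣∪⁅⁆∣ {A = A} {e} (n ∘ there)
∣∪⁅⁆∣ {A = inside ∷ A} {suc e} n = cong suc (∣∪⁅⁆∣ {A = A} {e} (n ∘ there))

+-∸-≤ : ∀ {a p q x y} → a ≤ p → a ≤ q → a ≤ x → a ≤ y → p + q ≤ x + y → (p ∸ a) + (q ∸ a) ≤ (x ∸ a) + (y ∸ a)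
+-∸-≤ {zero} _ _ _ _ h = h
+-∸-≤ {suc a} {suc p} {suc q} {suc x} {suc y} (s≤s i) (s≤s j) (s≤s k) (s≤s l) (s≤s h) =
  +-∸-≤ i j k l (ℕP.≤-pred (subst₂′ (ℕP.+-suc p q) (ℕP.+-suc x y) h))
  where
  subst₂′ : ∀ {a b c d} → a ≡ b → c ≡ d → a ≤ c → b ≤ d
  subst₂′ refl refl z = z

Flat : (M : RawMatroid) → Subset (amb M) → Set
Flat M F = F ⊆ ground M × (∀ {e} → e ∈ ground M → e ∉ F → rk M (F ∪ ⁅ e ⁆) ≢ rk M F)

isFlatᵇ⇒Flat : ∀ M F → isFlatᵇ M F ≡ true → Flat M F
isFlatᵇ⇒Flat M F h with a , b ← ∧-true⁻ {F ⊆ᵇ ground M} h = dec-true⁻ (F ⊆? ground M) a , λ {e} e∈E e∉F eq →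
  case trans (sym (all-tabulate⁻ _ id b e)) (cong₂ (λ u v → not u ∨ not v)
    (cong₂ (λ u v → u ∧ not v) (lookup-∈ e∈E) (lookup-∉ e∉F)) (≡ᵇ-true eq)) of λ ()

Flat⇒isFlatᵇ : ∀ M F → Flat M F → isFlatᵇ M F ≡ true
Flat⇒isFlatᵇ M F (s , h) = cong₂ _∧_ (dec-true (F ⊆? ground M) s) (all-tabulate⁺ _ id step)
  where
  step : ∀ e → (not (memᵇ e (ground M) ∧ not (memᵇ e F)) ∨ not (rk M (F ∪ ⁅ e ⁆) ≡ᵇ rk M F)) ≡ true
  step e with memᵇ e (ground M) in p | memᵇ e F in q
  ... | false | _     = refl
  ... | true  | true  = refl
  ... | true  | false = cong not (≡ᵇ-false (h (∈-lookup _ e p) (λ m → case trans (sym q) (lookup-∈ m) of λ ())))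

nonflat : ∀ M {F} → F ⊆ ground M → isFlatᵇ M F ≡ false → ∃ λ e → e ∈ ground M × e ∉ F × rk M (F ∪ ⁅ e ⁆) ≡ rk M F
nonflat M {F} s h rewrite dec-true (F ⊆? ground M) s with e , p ← all-tabulate-false _ id h = e , step p
  where
  step : (not (memᵇ e (ground M) ∧ not (memᵇ e F)) ∨ not (rk M (F ∪ ⁅ e ⁆) ≡ᵇ rk M F)) ≡ false →
         e ∈ ground M × e ∉ F × rk M (F ∪ ⁅ e ⁆) ≡ rk M F
  step z with memᵇ e (ground M) in p | memᵇ e F in q | rk M (F ∪ ⁅ e ⁆) ≡ᵇ rk M F in r
  ... | true | false | true = ∈-lookup _ e p , (λ m → case trans (sym q) (lookup-∈ m) of λ ()) , ≡ᵇ-true⁻ r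
  step () | false | _ | _
  step () | true | true | _
  step () | true | false | false

module MatroidTheory (M : RawMatroid) (isM : IsMatroid M) where

  private
    E = ground M
    r = rk M

  rk≤ : ∀ {A} → A ⊆ E → r A ≤ ∣ A ∣
  rk≤ = proj₁ isM _

  rk-mono : ∀ {A B} → B ⊆ E → A ⊆ B → r A ≤ r B
  rk-mono b s = proj₁ (proj₂ isM) _ _ (b ∘ s) b s

  rk-submod : ∀ {A B} → A ⊆ E → B ⊆ E → r (A ∪ B) + r (A ∩ B) ≤ r A + r B
  rk-submod = proj₂ (proj₂ isM) _ _

  rk-∪-bound : ∀ {A} → A ⊆ E → r E ≤ ∣ A ∣ + r (E ─ A)
  rk-∪-bound {A} A⊆E = begin
    r E ≡⟨ cong r (sym (─-∪ A⊆E)) ⟩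
    r ((E ─ A) ∪ A) ≤⟨ ℕP.m≤m+n _ _ ⟩
    r ((E ─ A) ∪ A) + r ((E ─ A) ∩ A) ≤⟨ rk-submod (SubP.p─q⊆p E A) A⊆E ⟩
    r (E ─ A) + r A ≤⟨ ℕP.+-monoʳ-≤ (r (E ─ A)) (rk≤ A⊆E) ⟩
    r (E ─ A) + ∣ A ∣ ≡⟨ ℕP.+-comm (r (E ─ A)) ∣ A ∣ ⟩
    ∣ A ∣ + r (E ─ A) ∎
    where open ℕP.≤-Reasoning

  rk-⊥ : r ⊥ ≡ 0
  rk-⊥ = ℕP.n≤0⇒n≡0 (subst (r ⊥ ≤_) (SubP.∣⊥∣≡0 (amb M)) (rk≤ (SubP.⊆-min E)))

  -- Submodularity for `B` and `A ∪ ⁅ e ⁆`, whose intersection contains `A`.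
  absorb : ∀ {A B e} → A ⊆ B → B ⊆ E → e ∈ E → r (A ∪ ⁅ e ⁆) ≡ r A → r (B ∪ ⁅ e ⁆) ≡ r B
  absorb {A} {B} {e} A⊆B B⊆E e∈E eq = ℕP.≤-antisym (ℕP.+-cancelʳ-≤ (r A) _ _ le) (rk-mono Be⊆E (SubP.p⊆p∪q _))
    where
    Ae⊆E : A ∪ ⁅ e ⁆ ⊆ E
    Ae⊆E = ∪-⊆ (B⊆E ∘ A⊆B) (⁅⁆-⊆ e∈E)
    Be⊆E : B ∪ ⁅ e ⁆ ⊆ E
    Be⊆E = ∪-⊆ B⊆E (⁅⁆-⊆ e∈E)
    open ℕP.≤-Reasoning
    le : r (B ∪ ⁅ e ⁆) + r A ≤ r B + r A
    le = begin
      r (B ∪ ⁅ e ⁆) + r A ≤⟨ ℕP.+-mono-≤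
         (rk-mono (∪-⊆ B⊆E Ae⊆E) (∪-mono {A = B} {⁅ e ⁆} id (SubP.q⊆p∪q A ⁅ e ⁆)))
         (rk-mono (B⊆E ∘ SubP.p∩q⊆p B _) (⊆-∩ A⊆B (SubP.p⊆p∪q ⁅ e ⁆))) ⟩
      r (B ∪ (A ∪ ⁅ e ⁆)) + r (B ∩ (A ∪ ⁅ e ⁆)) ≤⟨ rk-submod B⊆E Ae⊆E ⟩
      r B + r (A ∪ ⁅ e ⁆) ≡⟨ cong (λ z → r B + z) eq ⟩
      r B + r A ∎

  -- No element of `Z` raises the rank of `A`, hence by `absorb` none raises that of `F`, and a flat
  -- contains all such elements.
  flat-absorbs : ∀ {A F Z} → Flat M F → A ⊆ F → A ⊆ Z → Z ⊆ E → r Z ≡ r A → Z ⊆ F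
  flat-absorbs {A} {F} {Z} (F⊆E , fl) A⊆F A⊆Z Z⊆E eq {x} x∈Z with x ∈? F
  ... | yes m = m
  ... | no  n = ⊥-elim (fl (Z⊆E x∈Z) n (absorb A⊆F F⊆E (Z⊆E x∈Z) (ℕP.≤-antisym
                  (ℕP.≤-trans (rk-mono Z⊆E (∪-⊆ A⊆Z (⁅⁆-⊆ x∈Z))) (ℕP.≤-reflexive eq))
                  (rk-mono (∪-⊆ (Z⊆E ∘ A⊆Z) (⁅⁆-⊆ (Z⊆E x∈Z))) (SubP.p⊆p∪q _)))))

  -- Add elements that keep the rank until none is left; the fuel of `go` bounds the number of
  -- elements outside the current set.
  closure : ∀ {A} → A ⊆ E → ∃ λ Z → A ⊆ Z × Flat M Z × r Z ≡ r A
  closure {A} A⊆E = go ∣ E ∣ A A⊆E (ℕP.m≤m+n _ _)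
    where
    go : ∀ k A → A ⊆ E → ∣ E ∣ ≤ k + ∣ A ∣ → ∃ λ Z → A ⊆ Z × Flat M Z × r Z ≡ r A
    go k A A⊆E l with isFlatᵇ M A in eq
    ... | true = A , id , isFlatᵇ⇒Flat M A eq , refl
    ... | false with e , e∈E , e∉A , re ← nonflat M A⊆E eq = grow k l
      where
      Ae⊆E : A ∪ ⁅ e ⁆ ⊆ E
      Ae⊆E = ∪-⊆ A⊆E (⁅⁆-⊆ e∈E)
      grow : ∀ k → ∣ E ∣ ≤ k + ∣ A ∣ → ∃ λ Z → A ⊆ Z × Flat M Z × r Z ≡ r A
      grow zero    l = ⊥-elim (ℕP.<⇒≱ (subst (_≤ ∣ E ∣) (∣∪⁅⁆∣ e∉A) (SubP.p⊆q⇒∣p∣≤∣q∣ Ae⊆E)) l)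
      grow (suc k) l with Z , s , f , z ← go k (A ∪ ⁅ e ⁆) Ae⊆E (subst (λ w → ∣ E ∣ ≤ k + w) (sym (∣∪⁅⁆∣ e∉A)) (subst (∣ E ∣ ≤_) (sym (ℕP.+-suc k ∣ A ∣)) l)) =
        Z , (λ x → s (SubP.p⊆p∪q ⁅ e ⁆ x)) , f , trans z re

  ground-flat : Flat M E
  ground-flat = id , λ e∈E e∉E _ → e∉E e∈E

  restrict-isMatroid : ∀ {A} → A ⊆ E → IsMatroid (restrict M A)
  restrict-isMatroid s = (λ _ a → rk≤ (s ∘ a)) , (λ _ _ _ b → rk-mono (s ∘ b)) , (λ _ _ a b → rk-submod (s ∘ a) (s ∘ b))

  restrict-loopless : ∀ {A} → A ⊆ E → Loopless M → Loopless (restrict M A)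
  restrict-loopless s ll e (m , z) = ll e (s m , z)

  contract-isMatroid : ∀ {A} → A ⊆ E → IsMatroid (contract M A)
  contract-isMatroid {A} A⊆E = size , mono , submod
    where
    sub : ∀ {X} → X ⊆ E ─ A → X ⊆ E
    sub s x = SubP.p─q⊆p E A (s x)
    sub∪ : ∀ {X} → X ⊆ E ─ A → X ∪ A ⊆ E
    sub∪ s = ∪-⊆ (sub s) A⊆E
    size : ∀ X → X ⊆ E ─ A → r (X ∪ A) ∸ r A ≤ ∣ X ∣
    size X s = ℕP.m≤n+o⇒m∸n≤o (r (X ∪ A)) (r A) (begin
      r (X ∪ A) ≤⟨ ℕP.m≤m+n _ _ ⟩
      r (X ∪ A) + r (X ∩ A) ≤⟨ rk-submod (sub s) A⊆E ⟩
      r X + r A ≤⟨ ℕP.+-monoˡ-≤ (r A) (rk≤ (sub s)) ⟩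
      ∣ X ∣ + r A ≡⟨ ℕP.+-comm ∣ X ∣ (r A) ⟩
      r A + ∣ X ∣ ∎)
      where open ℕP.≤-Reasoning
    mono : ∀ X Y → X ⊆ E ─ A → Y ⊆ E ─ A → X ⊆ Y → r (X ∪ A) ∸ r A ≤ r (Y ∪ A) ∸ r A
    mono X Y _ t s = ℕP.∸-monoˡ-≤ (r A) (rk-mono (sub∪ t) (∪-mono {A = X} {A} s id))
    submod : ∀ X Y → X ⊆ E ─ A → Y ⊆ E ─ A →
      (r ((X ∪ Y) ∪ A) ∸ r A) + (r ((X ∩ Y) ∪ A) ∸ r A) ≤ (r (X ∪ A) ∸ r A) + (r (Y ∪ A) ∸ r A)
    submod X Y s t = +-∸-≤ (low (∪-⊆ s t)) (low (λ m → s (SubP.p∩q⊆p X Y m))) (low s) (low t) (begin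
      r ((X ∪ Y) ∪ A) + r ((X ∩ Y) ∪ A) ≤⟨ ℕP.+-mono-≤
        (rk-mono (∪-⊆ (sub∪ s) (sub∪ t)) (∪-⊆ (∪-mono {A = X} {Y} (SubP.p⊆p∪q A) (SubP.p⊆p∪q A)) (λ m → SubP.p⊆p∪q (Y ∪ A) (SubP.q⊆p∪q X A m))))
        (rk-mono (λ m → sub∪ s (SubP.p∩q⊆p _ (Y ∪ A) m)) (⊆-∩ (∪-mono {A = X ∩ Y} {A} (SubP.p∩q⊆p X Y) id) (∪-mono {A = X ∩ Y} {A} (SubP.p∩q⊆q X Y) id))) ⟩
      r ((X ∪ A) ∪ (Y ∪ A)) + r ((X ∪ A) ∩ (Y ∪ A)) ≤⟨ rk-submod (sub∪ s) (sub∪ t) ⟩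
      r (X ∪ A) + r (Y ∪ A) ∎)
      where
      open ℕP.≤-Reasoning
      low : ∀ {X} → X ⊆ E ─ A → r A ≤ r (X ∪ A)
      low {X} s = rk-mono (sub∪ s) (SubP.q⊆p∪q X A)

  contract-loopless : ∀ {F} → Flat M F → Loopless (contract M F)
  contract-loopless {F} (F⊆E , fl) e (m , z) with e∈E , e∉F ← ∈─⁻ {p = E} {F} m =
    fl e∈E e∉F (trans (cong r (SubP.∪-comm F ⁅ e ⁆)) (ℕP.≤-antisym (ℕP.m∸n≡0⇒m≤n z) (rk-mono (∪-⊆ (⁅⁆-⊆ e∈E) F⊆E) (SubP.q⊆p∪q ⁅ e ⁆ F))))

-- Möbius values and the inverse Z-polynomial as alternating sums

if-true : ∀ {a} {A : Set a} {b} {x y : A} → b ≡ true → (if b then x else y) ≡ x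
if-true refl = refl

if-false : ∀ {a} {A : Set a} {b} {x y : A} → b ≡ false → (if b then x else y) ≡ y
if-false refl = refl

if-cong : ∀ {a} {A : Set a} {b c} {x y : A} → b ≡ c → (if b then x else y) ≡ (if c then x else y)
if-cong refl = refl

≡true⇔ : ∀ {a b} → (a ≡ true → b ≡ true) → (b ≡ true → a ≡ true) → a ≡ b
≡true⇔ {true}  {b}     f g = sym (f refl)
≡true⇔ {false} {true}  f g = g refl
≡true⇔ {false} {false} f g = refl

⊆-card-≡ : ∀ {n} {A B : Subset n} → A ⊆ B → ∣ B ∣ ≤ ∣ A ∣ → A ≡ B
⊆-card-≡ {A = []} {[]} s l = refl
⊆-card-≡ {A = outside ∷ A} {outside ∷ B} s l = cong (outside ∷_) (⊆-card-≡ (SubP.drop-∷-⊆ s) l)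
⊆-card-≡ {A = inside ∷ A} {outside ∷ B} s l = ⊥-elim (in⊈out s)
⊆-card-≡ {A = outside ∷ A} {inside ∷ B} s l = ⊥-elim (ℕP.<⇒≱ l (SubP.p⊆q⇒∣p∣≤∣q∣ (SubP.drop-∷-⊆ s)))
⊆-card-≡ {A = inside ∷ A} {inside ∷ B} s (s≤s l) = cong (inside ∷_) (⊆-card-≡ (SubP.drop-∷-⊆ s) l)

sgn-+ : ∀ m n → sgn (m + n) ≡ sgn m *ᶻ sgn n
sgn-+ zero    n = sym (ℤP.*-identityˡ _)
sgn-+ (suc m) n = trans (cong -_ (sgn-+ m n)) (ℤP.neg-distribˡ-* (sgn m) (sgn n))

sgn² : ∀ m → sgn m *ᶻ sgn m ≡ 1ℤ
sgn² zero    = refl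
sgn² (suc m) = trans (lem (sgn m)) (sgn² m)
  where
  lem : ∀ x → - x *ᶻ - x ≡ x *ᶻ x
  lem = ℤR.solve-∀

lookup-ext : ∀ {n} (A B : Subset n) → (∀ e → lookup A e ≡ lookup B e) → A ≡ B
lookup-ext []      []      h = refl
lookup-ext (a ∷ A) (b ∷ B) h = cong₂ _∷_ (h zero) (lookup-ext A B (h ∘ suc))

loopSet≡⊥ : ∀ M → Loopless M → loopSet M ≡ ⊥
loopSet≡⊥ M ll = lookup-ext (loopSet M) ⊥ λ e → trans (VecP.lookup∘tabulate _ e) (trans (step e) (sym (VecP.lookup-replicate e outside)))
  where
  step : ∀ e → (memᵇ e (ground M) ∧ (rk M ⁅ e ⁆ ≡ᵇ 0)) ≡ false
  step e with memᵇ e (ground M) in p | rk M ⁅ e ⁆ ≡ᵇ 0 in q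
  ... | false | _     = refl
  ... | true  | false = refl
  ... | true  | true  = ⊥-elim (ll e (∈-lookup _ e p , ≡ᵇ-true⁻ q))

-- The alternating sum over the spanning subsets of Y; it is the Möbius value of Y
-- (Whitney's theorem), because each A ⊆ Y spans exactly one flat.
spanSum : (M : RawMatroid) → Subset (amb M) → ℤ
spanSum M Y = Σ⊆ Y (λ A → if rk M A ≡ᵇ rk M Y then sgn ∣ A ∣ else 0ℤ)

module Whitney (M : RawMatroid) (isM : IsMatroid M) (ll : Loopless M) where
  open MatroidTheory M isM
  open ≡-Reasoning

  private
    s : Subset (amb M) → Subset (amb M) → ℤ
    s Z A = if isFlatᵇ M Z ∧ (A ⊆ᵇ Z) ∧ (rk M A ≡ᵇ rk M Z) then sgn ∣ A ∣ else 0ℤ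

  -- Double counting of pairs of a flat and a spanning subset of it. With the sum over flats inside,
  -- only the closure of `A` survives, and (1 - 1)^|Y| remains. The result is the recursion that
  -- defines the Möbius value.
  spanSum-flats : ∀ {Y} → Flat M Y → 0 < ∣ Y ∣ → Σ⊆ Y (λ Z → if isFlatᵇ M Z then spanSum M Z else 0ℤ) ≡ 0ℤ
  spanSum-flats {Y} fl@(Y⊆E , _) pos = begin
    Σ⊆ Y (λ Z → if isFlatᵇ M Z then spanSum M Z else 0ℤ) ≡⟨ Σ⊆-cong Y (λ Z Z⊆Y → expand Z⊆Y) ⟩
    Σ⊆ Y (λ Z → Σ⊆ Y (s Z)) ≡⟨ Σ⊆-swap Y Y s ⟩
    Σ⊆ Y (λ A → Σ⊆ Y (λ Z → s Z A)) ≡⟨ Σ⊆-cong Y (λ A A⊆Y → collapse A⊆Y) ⟩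
    Σ⊆ Y (λ A → sgn ∣ A ∣) ≡⟨ Σ⊆-card Y sgn ⟩
    Bin ∣ Y ∣ sgn ≡⟨ vanish pos ⟩
    0ℤ ∎
    where
    vanish : ∀ {k} → 0 < k → Bin k sgn ≡ 0ℤ
    vanish {suc k} _ = Bin-sgn k
    expand : ∀ {Z} → Z ⊆ Y → (if isFlatᵇ M Z then spanSum M Z else 0ℤ) ≡ Σ⊆ Y (s Z)
    expand {Z} Z⊆Y with isFlatᵇ M Z
    ... | false = sym (Σ⊆-zero Y (λ _ _ → refl))
    ... | true  = sym (trans (Σ⊆-restrict Z⊆Y _ (λ A _ A⊈Z → if-false (cong (_∧ (rk M A ≡ᵇ rk M Z)) (dec-false (A ⊆? Z) A⊈Z))))
                        (Σ⊆-cong Z (λ A A⊆Z → if-cong (cong (_∧ (rk M A ≡ᵇ rk M Z)) (dec-true (A ⊆? Z) A⊆Z)))))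
    collapse : ∀ {A} → A ⊆ Y → Σ⊆ Y (λ Z → s Z A) ≡ sgn ∣ A ∣
    collapse {A} A⊆Y with Z , A⊆Z , flZ , eqZ ← closure (Y⊆E ∘ A⊆Y) =
      trans (Σ⊆-unique (flat-absorbs fl A⊆Y A⊆Z (proj₁ flZ) eqZ) _ off)
        (if-true (cong₂ _∧_ (Flat⇒isFlatᵇ M Z flZ) (cong₂ _∧_ (dec-true (A ⊆? Z) A⊆Z) (≡ᵇ-true (sym eqZ)))))
      where
      off : ∀ Z′ → Z′ ⊆ Y → Z′ ≢ Z → s Z′ A ≡ 0ℤ
      off Z′ Z′⊆Y ne with isFlatᵇ M Z′ in p | A ⊆? Z′ | rk M A ≡ᵇ rk M Z′ in q
      ... | false | _     | _     = refl
      ... | true  | no _  | _     = refl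
      ... | true  | yes _ | false = refl
      ... | true  | yes t | true  = ⊥-elim (ne (⊆-antisym
        (flat-absorbs flZ A⊆Z t (Y⊆E ∘ Z′⊆Y) (sym (≡ᵇ-true⁻ q)))
        (flat-absorbs (isFlatᵇ⇒Flat M Z′ p) t A⊆Z (proj₁ flZ) eqZ)))

  -- Both sides obey the same recursion. A flat strictly below `Y` has fewer elements, so fuel
  -- beyond `∣ Y ∣` never runs out.
  mobius≡spanSum : ∀ k {Y} → Flat M Y → ∣ Y ∣ < k → mobius M k ⊥ Y ≡ spanSum M Y
  mobius≡spanSum (suc k) {Y} fl (s≤s l) with VecP.≡-dec BoolP._≟_ ⊥ Y
  ... | yes refl = sym (trans (Σ⊆-⊥ {amb M} (λ A → if rk M A ≡ᵇ rk M ⊥ then sgn ∣ A ∣ else 0ℤ)) (trans (if-true (≡ᵇ-true {rk M ⊥} refl)) (cong sgn (SubP.∣⊥∣≡0 (amb M)))))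
  ... | no ⊥≢Y = begin
    - ΣL (filterᵇ below (subsets (amb M))) (mobius M k ⊥) ≡⟨ cong -_ (ΣL-filter-subsets Y below _ below⇒⊆) ⟩
    - Σ⊆ Y (λ Z → if below Z then mobius M k ⊥ Z else 0ℤ) ≡⟨ cong -_ (Σ⊆-cong Y (λ Z _ → ih Z)) ⟩
    - Σ⊆ Y f ≡⟨ lem (Σ⊆ Y f) (spanSum M Y) ⟩
    - (Σ⊆ Y f +ᶻ spanSum M Y) +ᶻ spanSum M Y ≡⟨ cong (λ z → - z +ᶻ spanSum M Y) total ⟩
    0ℤ +ᶻ spanSum M Y ≡⟨ ℤP.+-identityˡ _ ⟩
    spanSum M Y ∎
    where
    below : Subset (amb M) → Bool
    below Z = isFlatᵇ M Z ∧ (⊥ ⊆ᵇ Z) ∧ (Z ⊆ᵇ Y) ∧ not (Z ≟ᵇ Y)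
    f g : Subset (amb M) → ℤ
    f Z = if below Z then spanSum M Z else 0ℤ
    g Z = if Z ≟ᵇ Y then spanSum M Z else 0ℤ
    lem : ∀ x y → - x ≡ - (x +ᶻ y) +ᶻ y
    lem = ℤR.solve-∀
    below⇒ : ∀ {Z} → below Z ≡ true → isFlatᵇ M Z ≡ true × Z ⊆ Y × Z ≢ Y
    below⇒ {Z} h with a , h ← ∧-true⁻ {isFlatᵇ M Z} h with _ , h ← ∧-true⁻ {⊥ ⊆ᵇ Z} h with b , h ← ∧-true⁻ {Z ⊆ᵇ Y} h =
      a , dec-true⁻ (Z ⊆? Y) b , λ e → case trans (sym h) (cong not (dec-true (VecP.≡-dec BoolP._≟_ Z Y) e)) of λ ()
    below⇒⊆ : ∀ Z → below Z ≡ true → Z ⊆ Y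
    below⇒⊆ Z h = proj₁ (proj₂ (below⇒ h))
    ih : ∀ Z → (if below Z then mobius M k ⊥ Z else 0ℤ) ≡ f Z
    ih Z with below Z in eq
    ... | false = refl
    ... | true with a , b , c ← below⇒ eq = mobius≡spanSum k (isFlatᵇ⇒Flat M Z a)
                (ℕP.<-≤-trans (ℕP.≰⇒> (λ l′ → c (⊆-card-≡ b l′))) l)
    split : ∀ Z → Z ⊆ Y → (if isFlatᵇ M Z then spanSum M Z else 0ℤ) ≡ f Z +ᶻ g Z
    split Z Z⊆Y rewrite dec-true (⊥ ⊆? Z) (SubP.⊆-min Z) | dec-true (Z ⊆? Y) Z⊆Y with VecP.≡-dec BoolP._≟_ Z Y
    ... | yes refl rewrite Flat⇒isFlatᵇ M Y fl = sym (ℤP.+-identityˡ _)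
    ... | no _ with isFlatᵇ M Z
    ...   | true  = sym (ℤP.+-identityʳ _)
    ...   | false = refl
    total : Σ⊆ Y f +ᶻ spanSum M Y ≡ 0ℤ
    total = begin
      Σ⊆ Y f +ᶻ spanSum M Y ≡⟨ cong (Σ⊆ Y f +ᶻ_) (sym (trans (Σ⊆-unique id g (λ A _ ne → if-false (dec-false (VecP.≡-dec BoolP._≟_ A Y) ne))) (if-true (dec-true (VecP.≡-dec BoolP._≟_ Y Y) refl)))) ⟩
      Σ⊆ Y f +ᶻ Σ⊆ Y g ≡⟨ sym (Σ⊆-+ Y f g) ⟩
      Σ⊆ Y (λ Z → f Z +ᶻ g Z) ≡⟨ Σ⊆-cong Y (λ Z Z⊆Y → sym (split Z Z⊆Y)) ⟩
      Σ⊆ Y (λ Z → if isFlatᵇ M Z then spanSum M Z else 0ℤ) ≡⟨ spanSum-flats fl (ℕP.≰⇒> (λ l′ → ⊥≢Y (⊆-card-≡ (SubP.⊆-min Y) (ℕP.≤-trans l′ z≤n)))) ⟩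
      0ℤ ∎

  μ≡spanSum : μ M ≡ spanSum M (ground M)
  μ≡spanSum = trans (cong (λ X → mobius M (suc (amb M)) X (ground M)) (loopSet≡⊥ M ll))
    (mobius≡spanSum (suc (amb M)) ground-flat (s≤s (SubP.∣p∣≤n (ground M))))

module YFormula (Q : RawMatroid → Poly) (N : RawMatroid) (isN : IsMatroid N) (ll : Loopless N) where
  open MatroidTheory N isN
  open ≡-Reasoning

  private
    E = ground N
    r = rk N

  -- The spanning-set sum of N/F, written with `r` itself so that it makes sense also when `F` is
  -- not a flat.
  coSum : Subset (amb N) → ℤ
  coSum F = Σ⊆ (E ─ F) (λ B → if r (B ∪ F) ≡ᵇ r E then sgn ∣ B ∣ else 0ℤ)

  coSum-flat : ∀ {F} → Flat N F → μ (contract N F) ≡ coSum F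
  coSum-flat {F} fl@(F⊆E , _) = trans (Whitney.μ≡spanSum (contract N F) (contract-isMatroid F⊆E) (contract-loopless fl))
    (Σ⊆-cong (E ─ F) (λ B s → if-cong (≡true⇔
      (λ h → ≡ᵇ-true (trans (ℕP.∸-cancelʳ-≡ (rk-mono (B∪F⊆E s) (SubP.q⊆p∪q B F)) (rk-mono (subst (_⊆ E) (sym (─-∪ F⊆E)) id) (SubP.q⊆p∪q (E ─ F) F)) (≡ᵇ-true⁻ h)) (cong r (─-∪ F⊆E))))
      (λ h → ≡ᵇ-true (cong (_∸ r F) (trans (≡ᵇ-true⁻ h) (cong r (sym (─-∪ F⊆E)))))))))
    where
    B∪F⊆E : ∀ {B} → B ⊆ E ─ F → B ∪ F ⊆ E
    B∪F⊆E s = ∪-⊆ (λ m → SubP.p─q⊆p E F (s m)) F⊆E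

  -- Toggling a loop of N/F changes the sign of every term.
  coSum-nonflat : ∀ {F} → F ⊆ E → isFlatᵇ N F ≡ false → coSum F ≡ 0ℤ
  coSum-nonflat {F} F⊆E h with e , e∈E , e∉F , eq ← nonflat N F⊆E h =
    Σ⊆-alternating (E ─ F) (∈─⁺ e∈E e∉F) _ λ A A⊆ e∉A → trans
      (cong₂ (λ u v → if u ≡ᵇ r E then sgn v else 0ℤ)
        (trans (cong r (swap A e)) (absorb (SubP.q⊆p∪q A F) (∪-⊆ (λ m → SubP.p─q⊆p E F (A⊆ m)) F⊆E) e∈E eq)) (∣∪⁅⁆∣ e∉A))
      (neg-if (r (A ∪ F) ≡ᵇ r E))
    where
    swap : ∀ A e → (A ∪ ⁅ e ⁆) ∪ F ≡ (A ∪ F) ∪ ⁅ e ⁆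
    swap A e = trans (SubP.∪-assoc A ⁅ e ⁆ F) (trans (cong (A ∪_) (SubP.∪-comm ⁅ e ⁆ F)) (sym (SubP.∪-assoc A F ⁅ e ⁆)))
    neg-if : ∀ b {x} → (if b then - x else 0ℤ) ≡ - (if b then x else 0ℤ)
    neg-if true  = refl
    neg-if false = refl

  ev-Yof : ∀ g → ev (Yof Q N) g ≡
    Σ⊆ E (λ F → (sgn (r E ∸ r F) *ᶻ coSum F) *ᶻ ev (Q (restrict N F)) (λ j → g (r E ∸ r F + j)))
  ev-Yof g = trans (ev-sumP (flats N) _ g) (trans (ΣL-filter-subsets E (isFlatᵇ N) _ (λ A h → proj₁ (isFlatᵇ⇒Flat N A h)))
    (Σ⊆-cong E step))
    where
    step : ∀ F → F ⊆ E → (if isFlatᵇ N F then ev (scaleP (sgn (r E ∸ r F) *ᶻ μ (contract N F)) (shiftP (r E ∸ r F) (Q (restrict N F)))) g else 0ℤ)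
      ≡ (sgn (r E ∸ r F) *ᶻ coSum F) *ᶻ ev (Q (restrict N F)) (λ j → g (r E ∸ r F + j))
    step F F⊆E with isFlatᵇ N F in eq
    ... | true  = trans (ev-scale (sgn (r E ∸ r F) *ᶻ μ (contract N F)) (shiftP (r E ∸ r F) (Q (restrict N F))) g) (cong₂ (λ u v → (sgn (r E ∸ r F) *ᶻ u) *ᶻ v)
                    (coSum-flat (isFlatᵇ⇒Flat N F eq)) (ev-shift (r E ∸ r F) (Q (restrict N F)) g))
    ... | false = sym (trans (cong (λ z → (sgn (r E ∸ r F) *ᶻ z) *ᶻ ev (Q (restrict N F)) (λ j → g (r E ∸ r F + j))) (coSum-nonflat F⊆E eq))
                    (trans (cong (_*ᶻ ev (Q (restrict N F)) (λ j → g (r E ∸ r F + j))) (ℤP.*-zeroʳ (sgn (r E ∸ r F)))) (ℤP.*-zeroˡ (ev (Q (restrict N F)) (λ j → g (r E ∸ r F + j))))))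

  -- With T = E ─ F and ρ the dual rank, rk (N/F) = |T| - ρ T, and B ⊆ T spans N/F exactly when
  -- T ─ B is independent in the dual; this turns the coefficient of F into sgn (ρ T) * indSum T.
  module Dual (ρ : Subset (amb N) → ℕ) (dual : ∀ {T} → T ⊆ E → r (E ─ T) + ∣ T ∣ ≡ r E + ρ T) where

    indSum : Subset (amb N) → ℤ
    indSum T = Σ⊆ T (λ D → if ρ D ≡ᵇ ∣ D ∣ then sgn ∣ D ∣ else 0ℤ)

    coSum≡indSum : ∀ {T} → T ⊆ E → coSum (E ─ T) ≡ sgn ∣ T ∣ *ᶻ indSum T
    coSum≡indSum {T} T⊆E = begin
      Σ⊆ (E ─ (E ─ T)) f ≡⟨ cong (λ X → Σ⊆ X f) (─-involutive T⊆E) ⟩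
      Σ⊆ T f ≡⟨ Σ⊆-compl T f ⟩
      Σ⊆ T (λ D → f (T ─ D)) ≡⟨ Σ⊆-cong T (λ D D⊆T → term D⊆T) ⟩
      Σ⊆ T (λ D → sgn ∣ T ∣ *ᶻ (if ρ D ≡ᵇ ∣ D ∣ then sgn ∣ D ∣ else 0ℤ)) ≡⟨ Σ⊆-* T (sgn ∣ T ∣) _ ⟩
      sgn ∣ T ∣ *ᶻ indSum T ∎
      where
      f : Subset (amb N) → ℤ
      f B = if r (B ∪ (E ─ T)) ≡ᵇ r E then sgn ∣ B ∣ else 0ℤ
      spanning : ∀ {D} → D ⊆ T → (r ((T ─ D) ∪ (E ─ T)) ≡ᵇ r E) ≡ (ρ D ≡ᵇ ∣ D ∣)
      spanning {D} D⊆T rewrite ─-∪-─ D⊆T T⊆E = ≡true⇔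
        (λ h → ≡ᵇ-true (sym (ℕP.+-cancelˡ-≡ (r E) _ _ (trans (cong (_+ ∣ D ∣) (sym (≡ᵇ-true⁻ h))) (dual (T⊆E ∘ D⊆T))))))
        (λ h → ≡ᵇ-true (ℕP.+-cancelʳ-≡ ∣ D ∣ _ _ (trans (dual (T⊆E ∘ D⊆T)) (cong (λ z → r E + z) (≡ᵇ-true⁻ h)))))
      -- Signs square to 1, so the exponent |T| - |D| may be replaced by |T| + |D|.
      sign : ∀ {D} → D ⊆ T → sgn ∣ T ─ D ∣ ≡ sgn ∣ T ∣ *ᶻ sgn ∣ D ∣
      sign {D} D⊆T = begin
        sgn ∣ T ─ D ∣ ≡⟨ sym (ℤP.*-identityʳ _) ⟩
        sgn ∣ T ─ D ∣ *ᶻ 1ℤ ≡⟨ cong (sgn ∣ T ─ D ∣ *ᶻ_) (sym (sgn² ∣ D ∣)) ⟩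
        sgn ∣ T ─ D ∣ *ᶻ (sgn ∣ D ∣ *ᶻ sgn ∣ D ∣) ≡⟨ sym (ℤP.*-assoc (sgn ∣ T ─ D ∣) _ _) ⟩
        sgn ∣ T ─ D ∣ *ᶻ sgn ∣ D ∣ *ᶻ sgn ∣ D ∣ ≡⟨ cong (_*ᶻ sgn ∣ D ∣) (sym (sgn-+ ∣ T ─ D ∣ ∣ D ∣)) ⟩
        sgn (∣ T ─ D ∣ + ∣ D ∣) *ᶻ sgn ∣ D ∣ ≡⟨ cong (λ z → sgn z *ᶻ sgn ∣ D ∣) (∣─∣ D⊆T) ⟩
        sgn ∣ T ∣ *ᶻ sgn ∣ D ∣ ∎
      term : ∀ {D} → D ⊆ T → f (T ─ D) ≡ sgn ∣ T ∣ *ᶻ (if ρ D ≡ᵇ ∣ D ∣ then sgn ∣ D ∣ else 0ℤ)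
      term {D} D⊆T rewrite spanning D⊆T with ρ D ≡ᵇ ∣ D ∣
      ... | true  = sign D⊆T
      ... | false = sym (ℤP.*-zeroʳ (sgn ∣ T ∣))

    ρ≤ : ∀ {T} → T ⊆ E → ρ T ≤ ∣ T ∣
    ρ≤ {T} T⊆E = ℕP.+-cancelˡ-≤ (r E) _ _ (subst (_≤ r E + ∣ T ∣) (dual T⊆E) (ℕP.+-monoˡ-≤ ∣ T ∣ (rk-mono id (SubP.p─q⊆p E T))))

    corank : ∀ {T} → T ⊆ E → r E ∸ r (E ─ T) ≡ ∣ T ∣ ∸ ρ T
    corank {T} T⊆E = begin
      r E ∸ r (E ─ T) ≡⟨ sym (ℕP.[m+n]∸[m+o]≡n∸o (ρ T) (r E) (r (E ─ T))) ⟩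
      (ρ T + r E) ∸ (ρ T + r (E ─ T)) ≡⟨ cong₂ _∸_ (trans (ℕP.+-comm (ρ T) (r E)) (sym (dual T⊆E))) (ℕP.+-comm (ρ T) _) ⟩
      (r (E ─ T) + ∣ T ∣) ∸ (r (E ─ T) + ρ T) ≡⟨ ℕP.[m+n]∸[m+o]≡n∸o (r (E ─ T)) ∣ T ∣ (ρ T) ⟩
      ∣ T ∣ ∸ ρ T ∎

    ev-Yof-dual : ∀ g → ev (Yof Q N) g ≡
      Σ⊆ E (λ T → (sgn (ρ T) *ᶻ indSum T) *ᶻ ev (Q (restrict N (E ─ T))) (λ j → g (∣ T ∣ ∸ ρ T + j)))
    ev-Yof-dual g = trans (ev-Yof g) (trans (Σ⊆-compl E _) (Σ⊆-cong E step))
      where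
      cancel : ∀ x y z → x *ᶻ (x *ᶻ y *ᶻ z) ≡ (x *ᶻ x) *ᶻ (y *ᶻ z)
      cancel = ℤR.solve-∀
      step : ∀ T → T ⊆ E → (sgn (r E ∸ r (E ─ T)) *ᶻ coSum (E ─ T)) *ᶻ ev (Q (restrict N (E ─ T))) (λ j → g (r E ∸ r (E ─ T) + j))
        ≡ (sgn (ρ T) *ᶻ indSum T) *ᶻ ev (Q (restrict N (E ─ T))) (λ j → g (∣ T ∣ ∸ ρ T + j))
      step T T⊆E rewrite corank T⊆E = cong (_*ᶻ ev (Q (restrict N (E ─ T))) (λ j → g (∣ T ∣ ∸ ρ T + j))) (begin
        sgn c *ᶻ coSum (E ─ T) ≡⟨ cong (sgn c *ᶻ_) (coSum≡indSum T⊆E) ⟩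
        -- Here |T| = c + ρ T, so the two factors `sgn c` cancel and `sgn (ρ T)` is left.
        sgn c *ᶻ (sgn ∣ T ∣ *ᶻ indSum T) ≡⟨ cong (λ z → sgn c *ᶻ (z *ᶻ indSum T)) (trans (cong sgn (sym (ℕP.m∸n+n≡m (ρ≤ T⊆E)))) (sgn-+ c (ρ T))) ⟩
        sgn c *ᶻ (sgn c *ᶻ sgn (ρ T) *ᶻ indSum T) ≡⟨ cancel (sgn c) (sgn (ρ T)) (indSum T) ⟩
        (sgn c *ᶻ sgn c) *ᶻ (sgn (ρ T) *ᶻ indSum T) ≡⟨ cong (_*ᶻ (sgn (ρ T) *ᶻ indSum T)) (sgn² c) ⟩
        1ℤ *ᶻ (sgn (ρ T) *ᶻ indSum T) ≡⟨ ℤP.*-identityˡ _ ⟩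
        sgn (ρ T) *ᶻ indSum T ∎)
        where
        c : ℕ
        c = ∣ T ∣ ∸ ρ T

-- Corank at most one

Bin-at-0 : ∀ s {f : ℕ → ℤ} → (∀ t → f (suc t) ≡ 0ℤ) → Bin s f ≡ f 0
Bin-at-0 zero    h = refl
Bin-at-0 (suc s) {f} h = trans (cong₂ _+ᶻ_ (Bin-at-0 s h) (Bin-zero s h)) (ℤP.+-identityʳ (f 0))

Low-mono : ∀ {p d d′} → d ≤ d′ → Low p d → Low p d′
Low-mono l low i m = low i (ℕP.≤-trans l m)

∣∪∣+∣∩∣ : ∀ {n} (A B : Subset n) → ∣ A ∪ B ∣ + ∣ A ∩ B ∣ ≡ ∣ A ∣ + ∣ B ∣
∣∪∣+∣∩∣ []            []            = refl
∣∪∣+∣∩∣ (outside ∷ A) (outside ∷ B) = ∣∪∣+∣∩∣ A B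
∣∪∣+∣∩∣ (outside ∷ A) (inside ∷ B)  = trans (cong suc (∣∪∣+∣∩∣ A B)) (sym (ℕP.+-suc ∣ A ∣ ∣ B ∣))
∣∪∣+∣∩∣ (inside ∷ A)  (outside ∷ B) = cong suc (∣∪∣+∣∩∣ A B)
∣∪∣+∣∩∣ (inside ∷ A)  (inside ∷ B)  = cong suc (trans (ℕP.+-suc ∣ A ∪ B ∣ ∣ A ∩ B ∣) (trans (cong suc (∣∪∣+∣∩∣ A B)) (sym (ℕP.+-suc ∣ A ∣ ∣ B ∣))))

∣∪∣-disjoint : ∀ {n} {A B : Subset n} → (∀ {x} → x ∈ A → x ∉ B) → ∣ A ∪ B ∣ ≡ ∣ A ∣ + ∣ B ∣
∣∪∣-disjoint {n} {A} {B} h = trans (sym (ℕP.+-identityʳ _)) (trans (cong (λ z → ∣ A ∪ B ∣ + z) (sym (trans (cong ∣_∣ A∩B≡⊥) (SubP.∣⊥∣≡0 n)))) (∣∪∣+∣∩∣ A B))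
  where
  A∩B≡⊥ : A ∩ B ≡ ⊥
  A∩B≡⊥ = ⊆-antisym (λ m → ⊥-elim (h (SubP.p∩q⊆p A B m) (SubP.p∩q⊆q A B m))) (SubP.⊆-min _)

module _ {k m : ℕ} where

  -- Truncation at `k` is monotone and concave and therefore keeps submodularity; `p` and `q` stand
  -- for union and intersection. Uniform matroids and the three parallel classes both rest on this.
  ⊓-concave : ∀ {p q x y} → q ≤ x → q ≤ y → p + q ≤ x + y → (p ⊓ k) + (q ⊓ k) ≤ (x ⊓ k) + (y ⊓ k)
  ⊓-concave {p} {q} {x} {y} q≤x q≤y eq with ℕP.≤-total x k | ℕP.≤-total y k
  ... | inj₁ a | inj₁ b rewrite ℕP.m≤n⇒m⊓n≡m a | ℕP.m≤n⇒m⊓n≡m b =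
    ℕP.≤-trans (ℕP.+-mono-≤ (ℕP.m⊓n≤m p k) (ℕP.m⊓n≤m q k)) eq
  ... | inj₂ a | _ rewrite ℕP.m≥n⇒m⊓n≡n a = ℕP.+-mono-≤ (ℕP.m⊓n≤n p k) (ℕP.⊓-monoˡ-≤ k q≤y)
  ... | inj₁ a | inj₂ b rewrite ℕP.m≥n⇒m⊓n≡n b | ℕP.+-comm (x ⊓ k) k = ℕP.+-mono-≤ (ℕP.m⊓n≤n p k) (ℕP.⊓-monoˡ-≤ k q≤x)

  Unif-isMatroid : IsMatroid (Unif k m)
  Unif-isMatroid =
    (λ A _ → ℕP.m⊓n≤m ∣ A ∣ k) ,
    (λ A B _ _ s → ℕP.⊓-monoˡ-≤ k (SubP.p⊆q⇒∣p∣≤∣q∣ s)) ,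
    (λ A B _ _ → ⊓-concave (SubP.∣p∩q∣≤∣p∣ A B) (SubP.∣p∩q∣≤∣q∣ A B) (ℕP.≤-reflexive (∣∪∣+∣∩∣ A B)))

  Unif-loopless : 1 ≤ k → Loopless (Unif k m)
  Unif-loopless 1≤k e (_ , z) = case trans (sym z) (trans (cong (_⊓ k) (SubP.∣⁅x⁆∣≡1 e)) (ℕP.m≤n⇒m⊓n≡m 1≤k)) of λ ()

-- The nonempty T in the circuit U_{c-1,c}: for |T| = i the dual rank is 1, the signed count of
-- independent sets is 1 - i, and the restriction is free with Q = 1, which gives (i - 1) x^(i-1).
-- Truncation removes the term of `i = 0`.
KU : ℕ → (ℕ → ℤ) → ℤ
KU c g = Bin c (λ i → + (i ∸ 1) *ᶻ g (i ∸ 1))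

module InverseKL (Q : RawMatroid → Poly) (isQ : IsInverseKL Q) where
  open ≡-Reasoning

  module Top (N : RawMatroid) (isN : IsMatroid N) (ll : Loopless N) (ρ : Subset (amb N) → ℕ)
             (dual : ∀ {T} → T ⊆ ground N → rk N (ground N ─ T) + ∣ T ∣ ≡ rk N (ground N) + ρ T)
             (ρ⊥ : ρ ⊥ ≡ 0) where
    open YFormula Q N isN ll
    open Dual ρ dual public

    term : (ℕ → ℤ) → Subset (amb N) → ℤ
    term g T = (sgn (ρ T) *ᶻ indSum T) *ᶻ ev (Q (restrict N (ground N ─ T))) (λ j → g (∣ T ∣ ∸ ρ T + j))

    term-⊥ : ∀ g → term g ⊥ ≡ ev (Q N) g
    term-⊥ g rewrite ρ⊥ | SubP.∣⊥∣≡0 (amb N) | SubP.p─⊥≡p (ground N) = trans (cong (λ z → (1ℤ *ᶻ z) *ᶻ ev (Q N) g) ind) (ℤP.*-identityˡ _)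
      where
      ind : indSum ⊥ ≡ 1ℤ
      ind = trans (Σ⊆-⊥ {amb N} (λ D → if ρ D ≡ᵇ ∣ D ∣ then sgn ∣ D ∣ else 0ℤ)) (trans (if-true (≡ᵇ-true (trans ρ⊥ (sym (SubP.∣⊥∣≡0 (amb N)))))) (cong sgn (SubP.∣⊥∣≡0 (amb N))))

    ev-Yof-top : ∀ g (h : Subset (amb N) → ℤ) → (∀ T → T ⊆ ground N → 0 < ∣ T ∣ → term g T ≡ h T) →
                 ev (Yof Q N) g ≡ ev (Q N) g +ᶻ (Σ⊆ (ground N) h -ᶻ h ⊥)
    ev-Yof-top g h eq = trans (ev-Yof-dual g) (trans (Σ⊆-nonempty (ground N) (term g) h eq) (cong (_+ᶻ (Σ⊆ (ground N) h -ᶻ h ⊥)) (term-⊥ g)))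

  -- By induction each nonempty T contributes x^|T|, so Y_N - Q_N is (1 + x)^n - 1. The constant 1
  -- solves the same equation with the palindromic (1 + x)^n, and `half-unique` identifies the two
  -- solutions.
  free-Q : ∀ k N → IsMatroid N → Loopless N → ∣ ground N ∣ ≤ k →
           (∀ {A} → A ⊆ ground N → rk N A ≡ ∣ A ∣) → Q N ≈P oneP
  free-Q k N isN ll l fr with ∣ ground N ∣ in size
  ... | zero = proj₁ (isQ N isN ll) (trans (fr id) size)
  free-Q (suc k) N isN ll (s≤s l) fr | suc d = λ i → trans
    (half-unique (Yof Q N) (Q N) K (subst (Palindromic (Yof Q N)) rkN (proj₂ (proj₂ (isQ N isN ll))))
       (λ i l → proj₁ (proj₂ (isQ N isN ll)) (subst (0 <_) (sym rkN) (s≤s z≤n)) i (subst (_≤ 2 * i) (sym rkN) l)) evY i)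
    (sym (half-unique (binP (suc d)) oneP K (binP-palindromic (suc d)) low₁ ev₁ i))
    where
    E = ground N
    K : (ℕ → ℤ) → ℤ
    K g = Bin (suc d) g -ᶻ g 0
    rkN : rk N E ≡ suc d
    rkN = trans (fr id) size
    low₁ : Low oneP (suc d)
    low₁ zero    ()
    low₁ (suc i) _ = refl
    add-sub : ∀ x y → x ≡ y +ᶻ (x -ᶻ y)
    add-sub = ℤR.solve-∀
    ev₁ : ∀ g → ev (binP (suc d)) g ≡ ev oneP g +ᶻ K g
    ev₁ g = trans (ev-binP (suc d) g) (trans (add-sub (Bin (suc d) g) (g 0)) (cong (_+ᶻ K g) (sym (ev-oneP g))))
    open Top N isN ll (λ _ → 0) (λ {T} T⊆E → trans (cong (_+ ∣ T ∣) (fr (SubP.p─q⊆p E T))) (trans (∣─∣ T⊆E) (trans (sym (fr id)) (sym (ℕP.+-identityʳ _))))) refl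
    ind : ∀ T → indSum T ≡ 1ℤ
    ind T = trans (Σ⊆-card T (λ t → if 0 ≡ᵇ t then sgn t else 0ℤ)) (Bin-at-0 ∣ T ∣ (λ _ → refl))
    evY : ∀ g → ev (Yof Q N) g ≡ ev (Q N) g +ᶻ K g
    evY g = trans (ev-Yof-top g (λ T → g ∣ T ∣) step)
      (cong₂ (λ u v → ev (Q N) g +ᶻ (u -ᶻ g v)) (trans (Σ⊆-card E g) (cong (λ z → Bin z g) size)) (SubP.∣⊥∣≡0 (amb N)))
      where
      step : ∀ T → T ⊆ E → 0 < ∣ T ∣ → term g T ≡ g ∣ T ∣
      step T T⊆E pos = trans (cong₂ (λ u v → (1ℤ *ᶻ u) *ᶻ v) (ind T)
        (trans (ev-≈ {Q (restrict N (E ─ T))} {oneP} ih (λ j → g (∣ T ∣ + j))) (trans (ev-oneP (λ j → g (∣ T ∣ + j))) (cong g (ℕP.+-identityʳ ∣ T ∣)))))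
        (ℤP.*-identityˡ _)
        where
        open MatroidTheory N isN
        E─T⊆E : E ─ T ⊆ E
        E─T⊆E = SubP.p─q⊆p E T
        ih : Q (restrict N (E ─ T)) ≈P oneP
        ih = free-Q k (restrict N (E ─ T)) (restrict-isMatroid E─T⊆E) (restrict-loopless E─T⊆E ll)
          (ℕP.≤-pred (ℕP.≤-trans (ℕP.≤-trans (ℕP.≤-reflexive (ℕP.+-comm 1 _)) (ℕP.+-monoʳ-≤ ∣ E ─ T ∣ pos)) (ℕP.≤-trans (ℕP.≤-reflexive (trans (∣─∣ T⊆E) size)) (s≤s l))))
          (λ s → fr (λ m → E─T⊆E (s m)))

  -- The complement of a set `A ⊆ E ─ T` contains `T`, so it has full dual rank, which is to say
  -- that `A` is independent.
  free-Q-restrict : ∀ N (isN : IsMatroid N) → Loopless N → (ρ : Subset (amb N) → ℕ) →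
    (∀ {T} → T ⊆ ground N → rk N (ground N ─ T) + ∣ T ∣ ≡ rk N (ground N) + ρ T) →
    ∀ {T} → T ⊆ ground N → (∀ {U} → U ⊆ ground N → T ⊆ U → ρ U ≡ ρ (ground N)) →
    Q (restrict N (ground N ─ T)) ≈P oneP
  free-Q-restrict N isN ll ρ dual {T} T⊆E top =
    free-Q _ (restrict N (E ─ T)) (restrict-isMatroid E─T⊆E) (restrict-loopless E─T⊆E ll) ℕP.≤-refl λ {A} s →
      ℕP.+-cancelʳ-≡ ∣ E ─ A ∣ _ _ (begin
        rk N A + ∣ E ─ A ∣ ≡⟨ cong (λ X → rk N X + ∣ E ─ A ∣) (sym (─-involutive (E─T⊆E ∘ s))) ⟩
        rk N (E ─ (E ─ A)) + ∣ E ─ A ∣ ≡⟨ dual (SubP.p─q⊆p E A) ⟩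
        rk N E + ρ (E ─ A) ≡⟨ cong (λ z → rk N E + z) (top (SubP.p─q⊆p E A) (λ m → ∈─⁺ (T⊆E m) (λ m′ → proj₂ (∈─⁻ {p = E} {T} (s m′)) m))) ⟩
        rk N E + ρ E ≡⟨ sym (dual id) ⟩
        rk N (E ─ E) + ∣ E ∣ ≡⟨ cong (_+ ∣ E ∣) (trans (cong (rk N) (─-self E)) rk-⊥) ⟩
        ∣ E ∣ ≡⟨ sym (∣─∣ (E─T⊆E ∘ s)) ⟩
        ∣ E ─ A ∣ + ∣ A ∣ ≡⟨ ℕP.+-comm ∣ E ─ A ∣ ∣ A ∣ ⟩
        ∣ A ∣ + ∣ E ─ A ∣ ∎)
    where
    open MatroidTheory N isN
    E = ground N
    E─T⊆E : E ─ T ⊆ E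
    E─T⊆E = SubP.p─q⊆p E T

  qU : ℕ → Poly
  qU c = Q (Unif (c ∸ 1) c)

  module CorankOne (N : RawMatroid) (isN : IsMatroid N) (ll : Loopless N) (C : Subset (amb N)) (C⊆E : C ⊆ ground N)
    (dual : ∀ {T} → T ⊆ ground N → rk N (ground N ─ T) + ∣ T ∣ ≡ rk N (ground N) + (∣ T ∩ C ∣ ⊓ 1)) where

    private
      E = ground N
      c = ∣ C ∣
      e = ∣ E ─ C ∣
    ρ⊥ : ∣ ⊥ {amb N} ∩ C ∣ ⊓ 1 ≡ 0
    ρ⊥ = cong (_⊓ 1) (trans (cong ∣_∣ (SubP.∩-zeroˡ C)) (SubP.∣⊥∣≡0 (amb N)))
    open Top N isN ll (λ T → ∣ T ∩ C ∣ ⊓ 1) dual ρ⊥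

    -- The dual has the single parallel class `C` and loops elsewhere. A `T` that misses `C` deletes
    -- coloops only and leaves Q = `q₀`; a `T` that meets `C` breaks the circuit and leaves a free
    -- matroid. Using `q₀` also at `T = ⊥` makes the sum regular, at the price of the last summand.
    ev-Y₁ : ∀ q₀ → (∀ T → T ⊆ E → 0 < ∣ T ∣ → ∣ T ∩ C ∣ ≡ 0 → Q (restrict N (E ─ T)) ≈P q₀) →
            ∀ g →
            ev (Yof Q N) g ≡ ev (Q N) g +ᶻ (Bin e (λ j → ev q₀ (λ k → g (j + k)) +ᶻ KU c (λ k → g (j + k))) -ᶻ ev q₀ g)
    ev-Y₁ q₀ ih g = trans (ev-Yof-top g (λ T → h ∣ T ∩ C ∣ ∣ T ∣) step)
      (cong (ev (Q N) g +ᶻ_) (cong₂ _-ᶻ_ total bottom))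
      where
      free : ∀ T → T ⊆ E → ∣ T ∩ C ∣ ≢ 0 → Q (restrict N (E ─ T)) ≈P oneP
      free T T⊆E ne = free-Q-restrict N isN ll (λ T → ∣ T ∩ C ∣ ⊓ 1) dual T⊆E λ {U} U⊆E T⊆U →
        trans (full T⊆U) (sym (full T⊆E))
        where
        full : ∀ {U} → T ⊆ U → ∣ U ∩ C ∣ ⊓ 1 ≡ 1
        full {U} s = ℕP.m≥n⇒m⊓n≡n (ℕP.≤-trans (ℕP.n≢0⇒n>0 ne) (SubP.p⊆q⇒∣p∣≤∣q∣ {p = T ∩ C} {U ∩ C} (⊆-∩ (λ m → s (SubP.p∩q⊆p T C m)) (SubP.p∩q⊆q T C))))
      at0 : ℕ → ℤ → ℤ
      at0 zero    x = x
      at0 (suc _) _ = 0ℤ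
      h : ℕ → ℕ → ℤ
      h i t = at0 i (ev q₀ (λ k → g (t + k))) +ᶻ + (i ∸ 1) *ᶻ g (t ∸ 1)
      bottom : h ∣ ⊥ {amb N} ∩ C ∣ ∣ ⊥ {amb N} ∣ ≡ ev q₀ g
      bottom = trans (cong₂ h (trans (cong ∣_∣ (SubP.∩-zeroˡ C)) (SubP.∣⊥∣≡0 (amb N))) (SubP.∣⊥∣≡0 (amb N))) (ℤP.+-identityʳ _)
      shift : ∀ i j → + (i ∸ 1) *ᶻ g (i + j ∸ 1) ≡ + (i ∸ 1) *ᶻ g (j + (i ∸ 1))
      shift zero    j = refl
      shift (suc i) j = cong (λ z → + i *ᶻ g z) (ℕP.+-comm i j)
      total : Σ⊆ E (λ T → h ∣ T ∩ C ∣ ∣ T ∣) ≡ Bin e (λ j → ev q₀ (λ k → g (j + k)) +ᶻ KU c (λ k → g (j + k)))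
      total = begin
        Σ⊆ E (λ T → h ∣ T ∩ C ∣ ∣ T ∣) ≡⟨ Σ⊆-card₂ C⊆E h ⟩
        Bin c (λ i → Bin e (λ j → h i (i + j))) ≡⟨ Bin-swap c e (λ i j → h i (i + j)) ⟩
        Bin e (λ j → Bin c (λ i → h i (i + j))) ≡⟨ Bin-cong e (λ j → trans (Bin-+ c _ _)
            (cong₂ _+ᶻ_ (Bin-at-0 c {λ t → at0 t (ev q₀ (λ k → g (t + j + k)))} (λ _ → refl)) (Bin-cong c (λ i → shift i j)))) ⟩
        Bin e (λ j → ev q₀ (λ k → g (j + k)) +ᶻ KU c (λ k → g (j + k))) ∎
      u : ℕ → ℤ
      u zero          = 1ℤ
      u (suc zero)    = -1ℤ
      u (suc (suc _)) = 0ℤ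
      -- the independent sets of the dual that lie in T are ∅ and the elements of T ∩ C
      ind : ∀ T → indSum T ≡ 1ℤ -ᶻ + ∣ T ∩ C ∣
      ind T = begin
        indSum T ≡⟨ sym (Σ⊆-restrict-∩ T) ⟩
        Σ⊆ (T ∩ C) (λ D → u ∣ D ∣) ≡⟨ Σ⊆-card (T ∩ C) u ⟩
        Bin ∣ T ∩ C ∣ u ≡⟨ Bin-u ∣ T ∩ C ∣ ⟩
        1ℤ -ᶻ + ∣ T ∩ C ∣ ∎
        where
        Bin-u : ∀ s → Bin s u ≡ 1ℤ -ᶻ + s
        Bin-u zero    = refl
        Bin-u (suc s) = trans (cong₂ _+ᶻ_ (Bin-u s) (Bin-at-0 s (λ _ → refl))) (lem s)
          where
          lem′ : ∀ x → (1ℤ -ᶻ x) +ᶻ -1ℤ ≡ 1ℤ -ᶻ (1ℤ +ᶻ x)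
          lem′ = ℤR.solve-∀
          lem : ∀ s → (1ℤ -ᶻ + s) +ᶻ -1ℤ ≡ 1ℤ -ᶻ + suc s
          lem s = trans (lem′ (+ s)) refl
        Σ⊆-restrict-∩ : ∀ T → Σ⊆ (T ∩ C) (λ D → u ∣ D ∣) ≡ indSum T
        Σ⊆-restrict-∩ T = trans (Σ⊆-cong (T ∩ C) (λ D s → on D (λ m → SubP.p∩q⊆q T C (s m)))) (sym (Σ⊆-restrict (SubP.p∩q⊆p T C) _ off))
          where
          f : Subset (amb N) → ℤ
          f D = if ∣ D ∩ C ∣ ⊓ 1 ≡ᵇ ∣ D ∣ then sgn ∣ D ∣ else 0ℤ
          on : ∀ D → D ⊆ C → u ∣ D ∣ ≡ f D
          on D s rewrite ⊆-antisym (SubP.p∩q⊆p D C) (⊆-∩ id s) with ∣ D ∣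
          ... | zero          = refl
          ... | suc zero      = refl
          ... | suc (suc _)   = refl
          off : ∀ D → D ⊆ T → ¬ (D ⊆ T ∩ C) → f D ≡ 0ℤ
          off D s ns = if-false (≡ᵇ-false λ eq → ns (⊆-∩ s (λ m → SubP.p∩q⊆q D C (subst (_ ∈_) (sym (⊆-card-≡ (SubP.p∩q⊆p D C)
            (subst (_≤ ∣ D ∩ C ∣) eq (ℕP.m⊓n≤m _ 1)))) m))))
      step : ∀ T → T ⊆ E → 0 < ∣ T ∣ → term g T ≡ h ∣ T ∩ C ∣ ∣ T ∣
      step T T⊆E pos with ∣ T ∩ C ∣ in tc | ind T
      ... | zero  | i rewrite i = trans (ℤP.*-identityˡ _) (trans (ev-≈ {Q (restrict N (E ─ T))} {q₀} (ih T T⊆E pos tc) _) (sym (ℤP.+-identityʳ _)))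
      ... | suc s | i rewrite i | ℕP.⊓-zeroʳ s = trans (cong₂ _*ᶻ_ (lem′ s) (trans (ev-≈ {Q (restrict N (E ─ T))} {oneP} (free T T⊆E (λ z → case trans (sym tc) z of λ ())) _) (trans (ev-oneP (λ j → g (∣ T ∣ ∸ 1 + j))) (cong g (ℕP.+-identityʳ _)))))
                        (sym (ℤP.+-identityˡ _))
        where
        lem : ∀ x → -1ℤ *ᶻ (1ℤ -ᶻ (1ℤ +ᶻ x)) ≡ x
        lem = ℤR.solve-∀
        lem′ : ∀ s → -1ℤ *ᶻ (1ℤ -ᶻ + suc s) ≡ + s
        lem′ s = lem (+ s)

  -- The dual of U_{k,k+d} is U_{d,k+d}; `a` and `t` are the sizes of complementary sets.
  Unif-dual : ∀ {a t} k d → a + t ≡ k + d → (a ⊓ k) + t ≡ k + (t ⊓ d)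
  Unif-dual {a} {t} k d eq with ℕP.≤-total a k
  ... | inj₁ a≤k rewrite ℕP.m≤n⇒m⊓n≡m a≤k =
    trans eq (cong (λ z → k + z) (sym (ℕP.m≥n⇒m⊓n≡n (ℕP.+-cancelˡ-≤ k _ _ (subst (_≤ k + t) eq (ℕP.+-monoˡ-≤ t a≤k))))))
  ... | inj₂ k≤a rewrite ℕP.m≥n⇒m⊓n≡n k≤a =
    cong (λ z → k + z) (sym (ℕP.m≤n⇒m⊓n≡m (ℕP.+-cancelˡ-≤ k _ _ (subst (k + t ≤_) eq (ℕP.+-monoˡ-≤ t k≤a)))))

  Unif-dual-⊤ : ∀ {n} k d → n ≡ k + d → ∀ {T : Subset n} → T ⊆ ⊤ → (∣ ⊤ ─ T ∣ ⊓ k) + ∣ T ∣ ≡ (∣ ⊤ {n} ∣ ⊓ k) + (∣ T ∣ ⊓ d)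
  Unif-dual-⊤ {n} k d eq {T} s = trans (Unif-dual k d (trans (∣─∣ s) (trans (SubP.∣⊤∣≡n n) eq)))
    (cong (_+ (∣ T ∣ ⊓ d)) (sym (trans (cong (_⊓ k) (SubP.∣⊤∣≡n n)) (ℕP.m≥n⇒m⊓n≡n (subst (k ≤_) (sym eq) (ℕP.m≤m+n k d))))))

  module _ (c : ℕ) where

    private
      U = Unif (suc c) (suc (suc c))
      isU = Unif-isMatroid {suc c} {suc (suc c)}
      llU = Unif-loopless {suc c} {suc (suc c)} (s≤s z≤n)
      rkU : rk U ⊤ ≡ suc c
      rkU = trans (cong (_⊓ suc c) (SubP.∣⊤∣≡n (suc (suc c)))) (ℕP.m≥n⇒m⊓n≡n (ℕP.n≤1+n (suc c)))

    U₁-low : Low (qU (suc (suc c))) (suc c)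
    U₁-low i l = proj₁ (proj₂ (isQ U isU llU)) (subst (0 <_) (sym rkU) (s≤s z≤n)) i (subst (_≤ 2 * i) (sym rkU) l)

    U₁-palindromic : Palindromic (Yof Q U) (suc c)
    U₁-palindromic = subst (Palindromic (Yof Q U)) rkU (proj₂ (proj₂ (isQ U isU llU)))

    -- With `C = ⊤` there are no coloops: the outer sum of `ev-Y₁` collapses to `j = 0`, and its
    -- part with `q₀` cancels.
    ev-Y-U₁ : ∀ g → ev (Yof Q U) g ≡ ev (qU (suc (suc c))) g +ᶻ KU (suc (suc c)) g
    ev-Y-U₁ g = trans (ev-Y₁ (qU (suc (suc c))) (λ T _ pos z → ⊥-elim (ℕP.<⇒≢ pos (sym (trans (cong ∣_∣ (sym (SubP.∩-identityʳ T))) z)))) g)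
      (cong (ev (qU (suc (suc c))) g +ᶻ_) (trans (cong₂ (λ x y → Bin x (λ j → ev (qU (suc (suc c))) (λ k → g (j + k)) +ᶻ KU y (λ k → g (j + k))) -ᶻ ev (qU (suc (suc c))) g)
          (trans (cong ∣_∣ (SubP.p─⊤≡⊥ (⊤ {suc (suc c)}))) (SubP.∣⊥∣≡0 (suc (suc c)))) (SubP.∣⊤∣≡n (suc (suc c))))
        (lem (ev (qU (suc (suc c))) g) (KU (suc (suc c)) g))))
      where
      lem : ∀ x y → (x +ᶻ y) -ᶻ x ≡ y
      lem = ℤR.solve-∀
      open CorankOne U isU llU ⊤ id (λ {T} s → trans (Unif-dual-⊤ (suc c) 1 (ℕP.+-comm 1 (suc c)) s)
        (cong (λ X → (∣ ⊤ {suc (suc c)} ∣ ⊓ suc c) + (∣ X ∣ ⊓ 1)) (sym (SubP.∩-identityʳ T))))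

  -- Coloops do not change Q. The product of (1 + x)^e with the Y of the circuit is palindromic of
  -- degree rk N, and it differs from the Q of the circuit by the functional of `ev-Y₁`; smaller
  -- ground sets supply the value of `q₀`.
  corankOne-Q : ∀ k N → IsMatroid N → Loopless N → (C : Subset (amb N)) → C ⊆ ground N → 2 ≤ ∣ C ∣ → ∣ ground N ∣ ≤ k →
    (∀ {T} → T ⊆ ground N → rk N (ground N ─ T) + ∣ T ∣ ≡ rk N (ground N) + (∣ T ∩ C ∣ ⊓ 1)) →
    Q N ≈P qU ∣ C ∣
  corankOne-Q k N isN ll C C⊆E 2≤c l dual with ∣ C ∣ in sizeC
  corankOne-Q k N isN ll C C⊆E (s≤s ()) l dual | suc zero
  corankOne-Q zero N isN ll C C⊆E 2≤c l dual | suc (suc c) =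
    case ℕP.≤-trans (ℕP.≤-reflexive (sym sizeC)) (ℕP.≤-trans (SubP.p⊆q⇒∣p∣≤∣q∣ C⊆E) l) of λ ()
  corankOne-Q (suc k) N isN ll C C⊆E 2≤c l dual | suc (suc c) = λ i → trans
    (half-unique (Yof Q N) (Q N) K (subst (Palindromic (Yof Q N)) rkN (proj₂ (proj₂ (isQ N isN ll))))
       (λ i l → proj₁ (proj₂ (isQ N isN ll)) (subst (0 <_) (sym rkN) (ℕP.≤-trans (s≤s z≤n) (ℕP.m≤n+m (suc c) e))) i (subst (_≤ 2 * i) (sym rkN) l)) (ev-Y₁ q ih) i)
    (sym (half-unique (binP e *P Yof Q U) q K (palindromic-* (binP e) (Yof Q U) (binP-palindromic e) (U₁-palindromic c))
       (Low-mono {q} (ℕP.m≤n+m (suc c) e) (U₁-low c)) evU i))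
    where
    E = ground N
    e = ∣ E ─ C ∣
    U = Unif (suc c) (suc (suc c))
    q = qU (suc (suc c))
    open CorankOne N isN ll C C⊆E dual
    open MatroidTheory N isN
    K : (ℕ → ℤ) → ℤ
    K g = Bin e (λ j → ev q (λ k → g (j + k)) +ᶻ KU ∣ C ∣ (λ k → g (j + k))) -ᶻ ev q g
    add-sub : ∀ x y → x ≡ y +ᶻ (x -ᶻ y)
    add-sub = ℤR.solve-∀
    evU : ∀ g → ev (binP e *P Yof Q U) g ≡ ev q g +ᶻ K g
    evU g = trans (ev-*P (binP e) (Yof Q U) g) (trans (ev-binP e _)
      (trans (Bin-cong e (λ j → trans (ev-Y-U₁ c (λ k → g (j + k))) (cong (λ z → ev q (λ k → g (j + k)) +ᶻ KU z (λ k → g (j + k))) (sym sizeC))))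
        (add-sub _ (ev q g))))
    rkN : rk N E ≡ e + suc c
    rkN = ℕP.+-cancelʳ-≡ 1 _ _ (begin
      rk N E + 1 ≡⟨ cong (λ z → rk N E + z) (sym (ℕP.m≥n⇒m⊓n≡n {∣ E ∩ C ∣} {1} (subst (1 ≤_) (trans (sym sizeC) (cong ∣_∣ (⊆-antisym (⊆-∩ C⊆E id) (SubP.p∩q⊆q E C)))) (s≤s z≤n)))) ⟩
      rk N E + (∣ E ∩ C ∣ ⊓ 1) ≡⟨ sym (dual id) ⟩
      rk N (E ─ E) + ∣ E ∣ ≡⟨ cong (_+ ∣ E ∣) (trans (cong (rk N) (─-self E)) rk-⊥) ⟩
      ∣ E ∣ ≡⟨ sym (∣─∣ C⊆E) ⟩
      e + ∣ C ∣ ≡⟨ cong (λ z → e + z) (trans sizeC (ℕP.+-comm 1 (suc c))) ⟩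
      e + (suc c + 1) ≡⟨ sym (ℕP.+-assoc e (suc c) 1) ⟩
      e + suc c + 1 ∎)
    ih : ∀ T → T ⊆ E → 0 < ∣ T ∣ → ∣ T ∩ C ∣ ≡ 0 → Q (restrict N (E ─ T)) ≈P q
    ih T T⊆E pos disj = subst (λ z → Q (restrict N (E ─ T)) ≈P qU z) sizeC
      (corankOne-Q k (restrict N (E ─ T)) (restrict-isMatroid E─T⊆E) (restrict-loopless E─T⊆E ll) C C⊆E─T (subst (2 ≤_) (sym sizeC) (s≤s (s≤s z≤n)))
        (ℕP.≤-pred (ℕP.≤-trans (ℕP.≤-trans (ℕP.≤-reflexive (ℕP.+-comm 1 _)) (ℕP.+-monoʳ-≤ ∣ E ─ T ∣ pos)) (ℕP.≤-trans (ℕP.≤-reflexive (∣─∣ T⊆E)) l)))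
        dual′)
      where
      E─T⊆E : E ─ T ⊆ E
      E─T⊆E = SubP.p─q⊆p E T
      T∩C≡⊥ : T ∩ C ≡ ⊥
      T∩C≡⊥ = sym (⊆-card-≡ (SubP.⊆-min _) (subst (_≤ ∣ ⊥ {amb N} ∣) (sym disj) z≤n))
      C⊆E─T : C ⊆ E ─ T
      C⊆E─T m = ∈─⁺ (C⊆E m) (λ m′ → SubP.∉⊥ (subst (_ ∈_) T∩C≡⊥ (SubP.x∈p∩q⁺ (m′ , m))))
      dual′ : ∀ {V} → V ⊆ E ─ T → rk N ((E ─ T) ─ V) + ∣ V ∣ ≡ rk N (E ─ T) + (∣ V ∩ C ∣ ⊓ 1)
      dual′ {V} s = ℕP.+-cancelʳ-≡ ∣ T ∣ _ _ (begin
        rk N ((E ─ T) ─ V) + ∣ V ∣ + ∣ T ∣ ≡⟨ ℕP.+-assoc (rk N ((E ─ T) ─ V)) ∣ V ∣ ∣ T ∣ ⟩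
        rk N ((E ─ T) ─ V) + (∣ V ∣ + ∣ T ∣) ≡⟨ cong₂ _+_ (cong (rk N) (SubP.p─q─r≡p─q∪r E T V)) (trans (ℕP.+-comm ∣ V ∣ ∣ T ∣) (sym (∣∪∣-disjoint (λ t v → proj₂ (∈─⁻ {p = E} {T} (s v)) t)))) ⟩
        rk N (E ─ (T ∪ V)) + ∣ T ∪ V ∣ ≡⟨ dual (∪-⊆ T⊆E (E─T⊆E ∘ s)) ⟩
        rk N E + (∣ (T ∪ V) ∩ C ∣ ⊓ 1) ≡⟨ cong₂ (λ x y → x + (y ⊓ 1)) (sym (trans (dual T⊆E) (trans (cong (λ z → rk N E + (z ⊓ 1)) disj) (ℕP.+-identityʳ _))))
           (cong ∣_∣ (trans (SubP.∩-distribʳ-∪ C T V) (trans (cong (_∪ (V ∩ C)) T∩C≡⊥) (SubP.∪-identityˡ (V ∩ C))))) ⟩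
        rk N (E ─ T) + ∣ T ∣ + (∣ V ∩ C ∣ ⊓ 1) ≡⟨ ℕP.+-assoc (rk N (E ─ T)) ∣ T ∣ _ ⟩
        rk N (E ─ T) + (∣ T ∣ + (∣ V ∩ C ∣ ⊓ 1)) ≡⟨ cong (λ z → rk N (E ─ T) + z) (ℕP.+-comm ∣ T ∣ _) ⟩
        rk N (E ─ T) + ((∣ V ∩ C ∣ ⊓ 1) + ∣ T ∣) ≡⟨ sym (ℕP.+-assoc (rk N (E ─ T)) _ ∣ T ∣) ⟩
        rk N (E ─ T) + (∣ V ∩ C ∣ ⊓ 1) + ∣ T ∣ ∎)

-- Corank two

module _ {a} {A : Set a} (p : A → Bool) (xs : List A) where

  ∈-filterᵇ⁺ : ∀ {x} → x ∈ˡ xs → p x ≡ true → x ∈ˡ filterᵇ p xs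
  ∈-filterᵇ⁺ m h = ∈-filter⁺ (T? ∘ p) m (subst T (sym h) tt)

  ∈-filterᵇ⁻ : ∀ {x} → x ∈ˡ filterᵇ p xs → x ∈ˡ xs × p x ≡ true
  ∈-filterᵇ⁻ {x} m with a , b ← ∈-filter⁻ (T? ∘ p) {xs = xs} m = a , T⇒≡true b

  ΣL-none : length (filterᵇ p xs) ≡ 0 → ∀ (F : A → ℤ) → ΣL xs (λ x → if p x then F x else 0ℤ) ≡ 0ℤ
  ΣL-none h F = trans (sym (ΣL-filter p xs F)) (go (filterᵇ p xs) h)
    where
    go : ∀ ys → length ys ≡ 0 → ΣL ys F ≡ 0ℤ
    go [] _ = refl

  filter-some : 0 < length (filterᵇ p xs) → ∃ λ x → x ∈ˡ xs × p x ≡ true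
  filter-some h with filterᵇ p xs in eq
  ... | y ∷ ys = y , ∈-filterᵇ⁻ (subst (y ∈ˡ_) (sym eq) (here refl))

  ΣL-one : length (filterᵇ p xs) ≡ 1 → ∃ λ x → x ∈ˡ xs × p x ≡ true ×
           (∀ {y} → y ∈ˡ xs → p y ≡ true → y ≡ x) × (∀ (F : A → ℤ) → ΣL xs (λ x → if p x then F x else 0ℤ) ≡ F x)
  ΣL-one h with filterᵇ p xs in eq
  ... | y ∷ [] with a , b ← ∈-filterᵇ⁻ (subst (y ∈ˡ_) (sym eq) (here refl)) =
    y , a , b , (λ m h → single (subst (_ ∈ˡ_) eq (∈-filterᵇ⁺ m h))) ,
    λ F → trans (sym (ΣL-filter p xs F)) (trans (cong (λ ys → ΣL ys F) eq) (ℤP.+-identityʳ (F y)))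
    where
    single : ∀ {z} → z ∈ˡ (y ∷ []) → z ≡ y
    single (here e) = e

  ΣL-count : ∀ c → ΣL xs (λ x → if p x then c else 0ℤ) ≡ + length (filterᵇ p xs) *ᶻ c
  ΣL-count c = trans (sym (ΣL-filter p xs (λ _ → c))) (go (filterᵇ p xs))
    where
    go : ∀ ys → ΣL ys (λ _ → c) ≡ + length ys *ᶻ c
    go []       = sym (ℤP.*-zeroˡ c)
    go (_ ∷ ys) = trans (cong (c +ᶻ_) (go ys)) (sym (ℤP.suc-* (+ length ys) c))

length-pos : ∀ {a} {A : Set a} {xs : List A} {x} → x ∈ˡ xs → 1 ≤ length xs
length-pos (here _)  = s≤s z≤n
length-pos (there _) = s≤s z≤n

filter-length-mono : ∀ {a} {A : Set a} (p q : A → Bool) (xs : List A) → (∀ {x} → p x ≡ true → q x ≡ true) →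
                     length (filterᵇ p xs) ≤ length (filterᵇ q xs)
filter-length-mono p q []       h = z≤n
filter-length-mono p q (x ∷ xs) h with p x in e | q x in e′
... | true  | true  = s≤s (filter-length-mono p q xs h)
... | false | true  = ℕP.m≤n⇒m≤1+n (filter-length-mono p q xs h)
... | false | false = filter-length-mono p q xs h
... | true  | false with () ← trans (sym (h e)) e′

nonempty : ∀ {n} {A : Subset n} → 0 < ∣ A ∣ → ∃ λ e → e ∈ A
nonempty {A = inside ∷ A}  _ = zero , here
nonempty {A = outside ∷ A} h with e , m ← nonempty {A = A} h = suc e , there m

∣∣-pos : ∀ {n} {A : Subset n} {e} → e ∈ A → 0 < ∣ A ∣
∣∣-pos {e = e} m = subst (_≤ _) (SubP.∣⁅x⁆∣≡1 e) (SubP.p⊆q⇒∣p∣≤∣q∣ (⁅⁆-⊆ m))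

-- The binomial coefficient t choose 2, by Pascal's rule.
C₂ : ℕ → ℤ
C₂ zero    = 0ℤ
C₂ (suc t) = + t +ᶻ C₂ t

Σ⊆-∩ : ∀ {n} (T S : Subset n) (f : Subset n → ℤ) → Σ⊆ T (λ D → if D ⊆ᵇ S then f D else 0ℤ) ≡ Σ⊆ (T ∩ S) f
Σ⊆-∩ T S f = trans
  (Σ⊆-restrict (SubP.p∩q⊆p T S) _ (λ D s ns → if-false (dec-false (D ⊆? S) (λ s′ → ns (⊆-∩ s s′)))))
  (Σ⊆-cong (T ∩ S) (λ D s → if-true (dec-true (D ⊆? S) (λ m → SubP.p∩q⊆q T S (s m)))))

-- Corank two in dual terms: ρ is the rank function of the dual, a loopless matroid of
-- rank 2 whose flats of rank 1 are listed in L.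
record IsCorankTwo (N : RawMatroid) (ρ : Subset (amb N) → ℕ) (L : List (Subset (amb N))) : Set where
  field
    dual  : ∀ {T} → T ⊆ ground N → rk N (ground N ─ T) + ∣ T ∣ ≡ rk N (ground N) + ρ T
    size  : ∣ ground N ∣ ≡ rk N (ground N) + 2
    ρ⊥    : ρ ⊥ ≡ 0
    pos   : ∀ {D} → D ⊆ ground N → 0 < ∣ D ∣ → 1 ≤ ρ D
    count : ∀ {D} → D ⊆ ground N → 0 < ∣ D ∣ → length (filterᵇ (D ⊆ᵇ_) L) + ρ D ≡ 2
    line  : ∀ {S} → S ∈ˡ L → S ⊆ ground N × ρ S ≡ 1

module CorankTwoFormula (Q : RawMatroid → Poly) (isQ : IsInverseKL Q) where
  open InverseKL Q isQ
  open ≡-Reasoning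

  -- The A of the overview. If all pairs are independent in the dual, a nonempty T with t elements
  -- has the signed count 1 - t + C(t,2) = C(t-1,2). This is zero for t = 1, so the truncated
  -- exponent does no harm.
  freeTerm : ℕ → (ℕ → ℤ) → ℤ
  freeTerm n g = Bin n (λ t → C₂ (t ∸ 1) *ᶻ g (t ∸ 2))

  -- For a nonempty T inside a line of size s: the term predicted with dual rank 2, (1 - t) x^(t-2),
  -- minus the true one, (t - 1) x^(t-1) Q, where Q belongs to the circuit on the n - s elements off
  -- the line.
  lineWeight : (ℕ → ℤ) → ℕ → ℕ → ℕ → ℤ
  lineWeight g n s t = - (+ (t ∸ 1)) *ᶻ (g (t ∸ 2) +ᶻ ev (qU (n ∸ s)) (λ j → g (t ∸ 1 + j)))

  -- The B of the overview: the pairs within the line that `freeTerm` wrongly takes to be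
  -- independent, and the repair for the T inside the line.
  lineTerm : ℕ → ℕ → (ℕ → ℤ) → ℤ
  lineTerm n s g = Bin s (λ i → Bin (n ∸ s) (λ j → C₂ i *ᶻ g (i + j ∸ 2))) +ᶻ Bin s (lineWeight g n s)

  module CorankTwo (N : RawMatroid) (isN : IsMatroid N) (ll : Loopless N) (ρ : Subset (amb N) → ℕ)
                   (L : List (Subset (amb N))) (two : IsCorankTwo N ρ L) where
    open IsCorankTwo two
    open Top N isN ll ρ dual ρ⊥
    open MatroidTheory N isN

    private
      E = ground N
      n = ∣ E ∣

    #lines : Subset (amb N) → ℕ
    #lines D = length (filterᵇ (D ⊆ᵇ_) L)

    ⊆ᵇ-true : ∀ {A B : Subset (amb N)} → A ⊆ B → (A ⊆ᵇ B) ≡ true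
    ⊆ᵇ-true {A} {B} s = dec-true (A ⊆? B) s

    ⊆ᵇ-true⁻ : ∀ {A B : Subset (amb N)} → (A ⊆ᵇ B) ≡ true → A ⊆ B
    ⊆ᵇ-true⁻ {A} {B} = dec-true⁻ (A ⊆? B)

    #lines-antitone : ∀ {D U} → D ⊆ U → #lines U ≤ #lines D
    #lines-antitone {D} {U} s = filter-length-mono (U ⊆ᵇ_) (D ⊆ᵇ_) L (λ h → ⊆ᵇ-true (⊆ᵇ-true⁻ h ∘ s))

    ρ-mono : ∀ {D U} → U ⊆ E → D ⊆ U → 0 < ∣ D ∣ → ρ D ≤ ρ U
    ρ-mono {D} {U} U⊆E s p = ℕP.+-cancelˡ-≤ (#lines U) _ _ (ℕP.≤-trans (ℕP.+-monoˡ-≤ (ρ D) (#lines-antitone s))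
      (ℕP.≤-reflexive (trans (count (U⊆E ∘ s) p) (sym (count U⊆E (ℕP.≤-trans p (SubP.p⊆q⇒∣p∣≤∣q∣ s)))))))

    -- The one equation `count` packs two facts: a nonempty set of dual rank 1 lies in exactly one
    -- listed line, and one of dual rank 2 lies in none.
    ρ-cases : ∀ {D} → D ⊆ E → 0 < ∣ D ∣ → (#lines D ≡ 0 × ρ D ≡ 2) ⊎ (#lines D ≡ 1 × ρ D ≡ 1)
    ρ-cases {D} D⊆E p = go (#lines D) (ρ D) (pos D⊆E p) (count D⊆E p)
      where
      go : ∀ a b → 1 ≤ b → a + b ≡ 2 → (a ≡ 0 × b ≡ 2) ⊎ (a ≡ 1 × b ≡ 1)
      go zero          b             _ e = inj₁ (refl , e)
      go (suc zero)    (suc zero)    _ e = inj₂ (refl , refl)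
      go (suc (suc a)) (suc b)       _ e = case trans (sym (ℕP.+-suc a b)) (ℕP.suc-injective (ℕP.suc-injective e)) of λ ()
      go (suc zero)    (suc (suc b)) _ ()

    -- `v` is the sign of a set as if all sets with at most two elements were independent; `w`
    -- selects the pairs.
    v w : ℕ → ℤ
    v 0 = 1ℤ
    v 1 = -1ℤ
    v 2 = 1ℤ
    v (suc (suc (suc _))) = 0ℤ
    w 2 = 1ℤ
    w _ = 0ℤ

    Bin-w : ∀ s → Bin s w ≡ C₂ s
    Bin-w zero    = refl
    Bin-w (suc s) = trans (cong₂ _+ᶻ_ (Bin-w s) (Bin-w′ s)) (ℤP.+-comm (C₂ s) (+ s))
      where
      Bin-w′ : ∀ s → Bin s (w ∘ suc) ≡ + s
      Bin-w′ zero    = refl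
      Bin-w′ (suc s) = trans (cong₂ _+ᶻ_ (Bin-w′ s) (Bin-at-0 s (λ _ → refl))) (cong +_ (ℕP.+-comm s 1))

    Bin-v : ∀ t → Bin (suc t) v ≡ C₂ t
    Bin-v zero    = refl
    Bin-v (suc t) = trans (cong₂ _+ᶻ_ (Bin-v t) (Bin-v′ t)) (ℤP.+-comm (C₂ t) (+ t))
      where
      lem : ∀ x → (-1ℤ +ᶻ x) +ᶻ 1ℤ ≡ x
      lem = ℤR.solve-∀
      Bin-v″ : ∀ t → Bin t (v ∘ suc) ≡ -1ℤ +ᶻ + t
      Bin-v″ zero    = refl
      Bin-v″ (suc t) = trans (cong₂ _+ᶻ_ (Bin-v″ t) (Bin-at-0 t (λ { zero → refl ; (suc _) → refl })))
        (trans (lem (+ t)) (lem2 t))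
        where
        lem2 : ∀ t → + t ≡ -1ℤ +ᶻ + suc t
        lem2 t = refl
      Bin-v′ : ∀ t → Bin (suc t) (v ∘ suc) ≡ + t
      Bin-v′ t = trans (Bin-v″ (suc t)) refl

    -- Count all sets with at most two elements and take out the dependent pairs: a pair is
    -- dependent exactly when it lies in a line, and then it lies in one line only.
    indSum-general : ∀ {T} → T ⊆ E → 0 < ∣ T ∣ → indSum T ≡ C₂ (∣ T ∣ ∸ 1) -ᶻ ΣL L (λ S → C₂ ∣ T ∩ S ∣)
    indSum-general {T} T⊆E p = begin
      indSum T ≡⟨ Σ⊆-cong T pointwise ⟩
      Σ⊆ T (λ D → v ∣ D ∣ +ᶻ -1ℤ *ᶻ ΣL L (λ S → if D ⊆ᵇ S then w ∣ D ∣ else 0ℤ)) ≡⟨ Σ⊆-+ T _ _ ⟩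
      Σ⊆ T (λ D → v ∣ D ∣) +ᶻ Σ⊆ T (λ D → -1ℤ *ᶻ ΣL L (λ S → if D ⊆ᵇ S then w ∣ D ∣ else 0ℤ)) ≡⟨ cong₂ _+ᶻ_ (trans (Σ⊆-card T v) (Bin-v-pos p)) (trans (Σ⊆-* T -1ℤ _) (trans (ℤP.-1*i≡-i _) (cong -_ lines))) ⟩
      C₂ (∣ T ∣ ∸ 1) -ᶻ ΣL L (λ S → C₂ ∣ T ∩ S ∣) ∎
      where
      Bin-v-pos : ∀ {t} → 0 < t → Bin t v ≡ C₂ (t ∸ 1)
      Bin-v-pos {suc t} _ = Bin-v t
      lines : Σ⊆ T (λ D → ΣL L (λ S → if D ⊆ᵇ S then w ∣ D ∣ else 0ℤ)) ≡ ΣL L (λ S → C₂ ∣ T ∩ S ∣)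
      lines = trans (ΣL-Σ⊆ L T (λ S D → if D ⊆ᵇ S then w ∣ D ∣ else 0ℤ))
        (ΣL-cong L (λ {S} _ → trans (Σ⊆-∩ T S (λ D → w ∣ D ∣)) (trans (Σ⊆-card (T ∩ S) w) (Bin-w ∣ T ∩ S ∣))))
      numeric : ∀ d a r → (0 < d → (a ≡ 0 × r ≡ 2) ⊎ (a ≡ 1 × r ≡ 1)) → (d ≡ 0 → r ≡ 0) → r ≤ d →
                (if r ≡ᵇ d then sgn d else 0ℤ) ≡ v d +ᶻ -1ℤ *ᶻ (+ a *ᶻ w d)
      numeric 0 a r h z l rewrite z refl | ℤP.*-zeroʳ (+ a) = refl
      numeric (suc d) a r h z l with h (s≤s z≤n)
      numeric 1 a r h z (s≤s ()) | inj₁ (refl , refl)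
      numeric 2 a r h z l | inj₁ (refl , refl) = refl
      numeric (suc (suc (suc d))) a r h z l | inj₁ (refl , refl) = refl
      numeric 1 a r h z l | inj₂ (refl , refl) = refl
      numeric 2 a r h z l | inj₂ (refl , refl) = refl
      numeric (suc (suc (suc d))) a r h z l | inj₂ (refl , refl) = refl
      pointwise : ∀ D → D ⊆ T → (if ρ D ≡ᵇ ∣ D ∣ then sgn ∣ D ∣ else 0ℤ) ≡ v ∣ D ∣ +ᶻ -1ℤ *ᶻ ΣL L (λ S → if D ⊆ᵇ S then w ∣ D ∣ else 0ℤ)
      pointwise D D⊆T = trans (numeric ∣ D ∣ (#lines D) (ρ D) (ρ-cases (T⊆E ∘ D⊆T))
        (λ z → trans (cong ρ (sym (⊆-card-≡ (SubP.⊆-min D) (subst (_≤ ∣ ⊥ {amb N} ∣) (sym z) z≤n)))) ρ⊥) (ρ≤ (T⊆E ∘ D⊆T)))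
        (cong (λ z → v ∣ D ∣ +ᶻ -1ℤ *ᶻ z) (sym (ΣL-count (D ⊆ᵇ_) L (w ∣ D ∣))))

    -- In a set of dual rank 1 only the empty set and the single elements are independent.
    indSum-line : ∀ {T} → T ⊆ E → 0 < ∣ T ∣ → ρ T ≡ 1 → indSum T ≡ - (+ (∣ T ∣ ∸ 1))
    indSum-line {T} T⊆E p ρT = trans (Σ⊆-cong T pointwise) (trans (Σ⊆-card T u) (Bin-u p))
      where
      u : ℕ → ℤ
      u 0 = 1ℤ
      u 1 = -1ℤ
      u (suc (suc _)) = 0ℤ
      Bin-u : ∀ {t} → 0 < t → Bin t u ≡ - (+ (t ∸ 1))
      Bin-u {suc zero}    _ = refl
      Bin-u {suc (suc t)} _ = trans (cong₂ _+ᶻ_ (Bin-u {suc t} (s≤s z≤n)) (Bin-at-0 (suc t) (λ _ → refl))) (lem t)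
        where
        lem′ : ∀ x → - x +ᶻ -1ℤ ≡ - (1ℤ +ᶻ x)
        lem′ = ℤR.solve-∀
        lem : ∀ t → - (+ t) +ᶻ -1ℤ ≡ - (+ suc t)
        lem t = lem′ (+ t)
      pointwise : ∀ D → D ⊆ T → (if ρ D ≡ᵇ ∣ D ∣ then sgn ∣ D ∣ else 0ℤ) ≡ u ∣ D ∣
      pointwise D D⊆T with ∣ D ∣ in d
      ... | zero rewrite sym (⊆-card-≡ (SubP.⊆-min D) (subst (_≤ ∣ ⊥ {amb N} ∣) (sym d) z≤n)) | ρ⊥ = refl
      ... | suc k rewrite ℕP.≤-antisym (ℕP.≤-trans (ρ-mono T⊆E D⊆T (subst (0 <_) (sym d) (s≤s z≤n))) (ℕP.≤-reflexive ρT)) (pos (T⊆E ∘ D⊆T) (subst (0 <_) (sym d) (s≤s z≤n))) with k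
      ...   | zero  = refl
      ...   | suc _ = refl

    -- The complement of a line has one element more than its rank, and this rank is positive
    -- because `N` has no loops.
    co-line : ∀ {S} → S ∈ˡ L → 2 ≤ ∣ E ─ S ∣
    co-line {S} S∈L with S⊆E , ρS ← line S∈L = go (rk N (E ─ S)) refl
      where
      size′ : ∣ E ─ S ∣ ≡ suc (rk N (E ─ S))
      size′ = ℕP.+-cancelʳ-≡ ∣ S ∣ _ _ (begin
        ∣ E ─ S ∣ + ∣ S ∣ ≡⟨ trans (∣─∣ S⊆E) size ⟩
        rk N E + 2 ≡⟨ ℕP.+-suc (rk N E) 1 ⟩
        suc (rk N E + 1) ≡⟨ cong (λ z → suc (rk N E + z)) (sym ρS) ⟩
        suc (rk N E + ρ S) ≡⟨ cong suc (sym (dual S⊆E)) ⟩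
        suc (rk N (E ─ S)) + ∣ S ∣ ∎)
      go : ∀ r → rk N (E ─ S) ≡ r → 2 ≤ ∣ E ─ S ∣
      go (suc r) eq = subst (2 ≤_) (sym (trans size′ (cong suc eq))) (s≤s (s≤s z≤n))
      go zero    eq with e , m ← nonempty {A = E ─ S} (subst (0 <_) (sym size′) (s≤s z≤n)) =
        ⊥-elim (ll e (SubP.p─q⊆p E S m , ℕP.n≤0⇒n≡0 (subst (rk N ⁅ e ⁆ ≤_) eq (rk-mono (SubP.p─q⊆p E S) (⁅⁆-⊆ m)))))

    Q-spanning : ∀ {T} → T ⊆ E → 0 < ∣ T ∣ → ρ T ≡ 2 → Q (restrict N (E ─ T)) ≈P oneP
    Q-spanning {T} T⊆E p ρT = free-Q-restrict N isN ll ρ dual T⊆E (λ U⊆E T⊆U → trans (two′ U⊆E T⊆U) (sym (two′ id T⊆E)))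
      where
      two′ : ∀ {U} → U ⊆ E → T ⊆ U → ρ U ≡ 2
      two′ {U} U⊆E T⊆U = ℕP.≤-antisym (ℕP.m+n≤o⇒n≤o (#lines U) (ℕP.≤-reflexive (count U⊆E (ℕP.≤-trans p (SubP.p⊆q⇒∣p∣≤∣q∣ T⊆U)))))
        (ℕP.≤-trans (ℕP.≤-reflexive (sym ρT)) (ρ-mono U⊆E T⊆U p))

    -- Deleting `T` contracts it in the dual, where rank 1 remains, with loops `S ─ T` and the
    -- parallel class `E ─ S`. So the restriction is the circuit `E ─ S` with coloops, and
    -- `corankOne-Q` applies.
    Q-line : ∀ {S T} → S ∈ˡ L → T ⊆ S → 0 < ∣ T ∣ → #lines T ≡ 1 → ρ T ≡ 1 → Q (restrict N (E ─ T)) ≈P qU ∣ E ─ S ∣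
    Q-line {S} {T} S∈L T⊆S p #T ρT with S⊆E , ρS ← line S∈L = corankOne-Q _ (restrict N (E ─ T)) (restrict-isMatroid E─T⊆E) (restrict-loopless E─T⊆E ll)
        (E ─ S) (─-antitone E T⊆S) (co-line S∈L) ℕP.≤-refl dual′
      where
      E─T⊆E : E ─ T ⊆ E
      E─T⊆E = SubP.p─q⊆p E T
      T⊆E : T ⊆ E
      T⊆E m = S⊆E (T⊆S m)
      ρ-∪ : ∀ {V} → V ⊆ E ─ T → ρ (T ∪ V) ≡ suc (∣ V ∩ (E ─ S) ∣ ⊓ 1)
      ρ-∪ {V} s with V ⊆? S
      ... | yes V⊆S = trans (ℕP.≤-antisym (ℕP.≤-trans (ρ-mono S⊆E (∪-⊆ T⊆S V⊆S) T∪V-pos) (ℕP.≤-reflexive ρS)) (pos T∪V⊆E T∪V-pos))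
                        (cong (λ z → suc (z ⊓ 1)) (sym (trans (cong ∣_∣ disj) (SubP.∣⊥∣≡0 (amb N)))))
        where
        T∪V⊆E : T ∪ V ⊆ E
        T∪V⊆E = ∪-⊆ T⊆E (E─T⊆E ∘ s)
        T∪V-pos : 0 < ∣ T ∪ V ∣
        T∪V-pos = ℕP.≤-trans p (SubP.∣p∣≤∣p∪q∣ T V)
        disj : V ∩ (E ─ S) ≡ ⊥
        disj = ⊆-antisym (λ m → ⊥-elim (proj₂ (∈─⁻ {p = E} {S} (SubP.p∩q⊆q V _ m)) (V⊆S (SubP.p∩q⊆p V _ m)))) (SubP.⊆-min _)
      ... | no V⊈S with ρ-cases {T ∪ V} (∪-⊆ T⊆E (E─T⊆E ∘ s)) (ℕP.≤-trans p (SubP.∣p∣≤∣p∪q∣ T V))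
      ...   | inj₁ (_ , two″) = trans two″ (cong suc (sym (ℕP.m≥n⇒m⊓n≡n {∣ V ∩ (E ─ S) ∣} {1} (ℕP.n≢0⇒n>0 λ z → V⊈S (λ {x} m → out z m)))))
        where
        out : ∣ V ∩ (E ─ S) ∣ ≡ 0 → ∀ {x} → x ∈ V → x ∈ S
        out z {x} m with x ∈? S
        ... | yes y = y
        ... | no  y = ⊥-elim (ℕP.<⇒≢ (∣∣-pos (SubP.x∈p∩q⁺ (m , ∈─⁺ (E─T⊆E (s m)) y))) (sym z))
      -- Rank 1 would put `T ∪ V` into a line; that line contains `T`, hence is `S`, against
      -- `V ⊈ S`.
      ...   | inj₂ (one , _) with S′ , S′∈L , h ← filter-some ((T ∪ V) ⊆ᵇ_) L (subst (0 <_) (sym one) (s≤s z≤n))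
                             with _ , _ , _ , uniq , _ ← ΣL-one (T ⊆ᵇ_) L #T =
        ⊥-elim (V⊈S (λ m → subst (_ ∈_) (trans (uniq S′∈L (⊆ᵇ-true (λ m → ⊆ᵇ-true⁻ {T ∪ V} h (SubP.p⊆p∪q V m)))) (sym (uniq S∈L (⊆ᵇ-true T⊆S))))
          (⊆ᵇ-true⁻ {T ∪ V} h (SubP.q⊆p∪q T V m))))
      dual′ : ∀ {V} → V ⊆ E ─ T → rk N ((E ─ T) ─ V) + ∣ V ∣ ≡ rk N (E ─ T) + (∣ V ∩ (E ─ S) ∣ ⊓ 1)
      dual′ {V} s = ℕP.+-cancelʳ-≡ ∣ T ∣ _ _ (begin
        rk N ((E ─ T) ─ V) + ∣ V ∣ + ∣ T ∣ ≡⟨ ℕP.+-assoc (rk N ((E ─ T) ─ V)) ∣ V ∣ ∣ T ∣ ⟩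
        rk N ((E ─ T) ─ V) + (∣ V ∣ + ∣ T ∣) ≡⟨ cong₂ _+_ (cong (rk N) (SubP.p─q─r≡p─q∪r E T V)) (trans (ℕP.+-comm ∣ V ∣ ∣ T ∣) (sym (∣∪∣-disjoint (λ t v → proj₂ (∈─⁻ {p = E} {T} (s v)) t)))) ⟩
        rk N (E ─ (T ∪ V)) + ∣ T ∪ V ∣ ≡⟨ dual (∪-⊆ T⊆E (E─T⊆E ∘ s)) ⟩
        rk N E + ρ (T ∪ V) ≡⟨ cong (λ z → rk N E + z) (ρ-∪ s) ⟩
        rk N E + suc m ≡⟨ sym (ℕP.+-assoc (rk N E) 1 m) ⟩
        rk N E + 1 + m ≡⟨ cong (λ z → rk N E + z + m) (sym ρT) ⟩
        rk N E + ρ T + m ≡⟨ cong (_+ m) (sym (dual T⊆E)) ⟩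
        rk N (E ─ T) + ∣ T ∣ + m ≡⟨ ℕP.+-assoc (rk N (E ─ T)) ∣ T ∣ m ⟩
        rk N (E ─ T) + (∣ T ∣ + m) ≡⟨ cong (λ z → rk N (E ─ T) + z) (ℕP.+-comm ∣ T ∣ m) ⟩
        rk N (E ─ T) + (m + ∣ T ∣) ≡⟨ sym (ℕP.+-assoc (rk N (E ─ T)) m ∣ T ∣) ⟩
        rk N (E ─ T) + m + ∣ T ∣ ∎)
        where
        m : ℕ
        m = ∣ V ∩ (E ─ S) ∣ ⊓ 1

    module _ (g : ℕ → ℤ) where

      -- One formula for all nonempty T: the prediction for dual rank 2 minus the repair, which
      -- vanishes unless T lies in a line. Its pieces depend on sizes only, so their sums over T are
      -- binomial sums.
      h : Subset (amb N) → ℤ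
      h T = (C₂ (∣ T ∣ ∸ 1) *ᶻ g (∣ T ∣ ∸ 2) +ᶻ -1ℤ *ᶻ ΣL L (λ S → C₂ ∣ T ∩ S ∣ *ᶻ g (∣ T ∣ ∸ 2)))
            +ᶻ -1ℤ *ᶻ ΣL L (λ S → if T ⊆ᵇ S then lineWeight g n ∣ S ∣ ∣ T ∣ else 0ℤ)

      h-indSum : ∀ {T} → T ⊆ E → 0 < ∣ T ∣ →
        h T ≡ indSum T *ᶻ g (∣ T ∣ ∸ 2) +ᶻ -1ℤ *ᶻ ΣL L (λ S → if T ⊆ᵇ S then lineWeight g n ∣ S ∣ ∣ T ∣ else 0ℤ)
      h-indSum {T} T⊆E p = cong (_+ᶻ -1ℤ *ᶻ ΣL L (λ S → if T ⊆ᵇ S then lineWeight g n ∣ S ∣ ∣ T ∣ else 0ℤ)) (begin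
        C₂ (∣ T ∣ ∸ 1) *ᶻ x +ᶻ -1ℤ *ᶻ ΣL L (λ S → C₂ ∣ T ∩ S ∣ *ᶻ x) ≡⟨ cong (λ z → C₂ (∣ T ∣ ∸ 1) *ᶻ x +ᶻ -1ℤ *ᶻ z)
              (trans (ΣL-cong L (λ {S} _ → ℤP.*-comm (C₂ ∣ T ∩ S ∣) x)) (ΣL-* L x _)) ⟩
        C₂ (∣ T ∣ ∸ 1) *ᶻ x +ᶻ -1ℤ *ᶻ (x *ᶻ ΣL L (λ S → C₂ ∣ T ∩ S ∣)) ≡⟨ lem (C₂ (∣ T ∣ ∸ 1)) (ΣL L (λ S → C₂ ∣ T ∩ S ∣)) x ⟩
        (C₂ (∣ T ∣ ∸ 1) -ᶻ ΣL L (λ S → C₂ ∣ T ∩ S ∣)) *ᶻ x ≡⟨ cong (_*ᶻ x) (sym (indSum-general T⊆E p)) ⟩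
        indSum T *ᶻ x ∎)
        where
        x = g (∣ T ∣ ∸ 2)
        lem : ∀ a b x → a *ᶻ x +ᶻ -1ℤ *ᶻ (x *ᶻ b) ≡ (a -ᶻ b) *ᶻ x
        lem = ℤR.solve-∀

      step : ∀ T → T ⊆ E → 0 < ∣ T ∣ → term g T ≡ h T
      step T T⊆E p with ρ-cases T⊆E p
      ... | inj₁ (#T , ρT) rewrite ρT = begin
        (1ℤ *ᶻ indSum T) *ᶻ ev (Q (restrict N (E ─ T))) (λ j → g (∣ T ∣ ∸ 2 + j)) ≡⟨ cong₂ _*ᶻ_ (ℤP.*-identityˡ (indSum T))
              (trans (ev-≈ {Q (restrict N (E ─ T))} {oneP} (Q-spanning T⊆E p ρT) (λ j → g (∣ T ∣ ∸ 2 + j))) (trans (ev-oneP (λ j → g (∣ T ∣ ∸ 2 + j))) (cong g (ℕP.+-identityʳ (∣ T ∣ ∸ 2))))) ⟩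
        indSum T *ᶻ g (∣ T ∣ ∸ 2) ≡⟨ sym (ℤP.+-identityʳ _) ⟩
        indSum T *ᶻ g (∣ T ∣ ∸ 2) +ᶻ -1ℤ *ᶻ 0ℤ ≡⟨ cong (λ z → indSum T *ᶻ g (∣ T ∣ ∸ 2) +ᶻ -1ℤ *ᶻ z) (sym (ΣL-none (T ⊆ᵇ_) L #T _)) ⟩
        _ ≡⟨ sym (h-indSum T⊆E p) ⟩
        h T ∎
      ... | inj₂ (#T , ρT) with S , S∈L , T⊆S , _ , single ← ΣL-one (T ⊆ᵇ_) L #T = begin
        (sgn (ρ T) *ᶻ indSum T) *ᶻ ev (Q (restrict N (E ─ T))) (λ j → g (∣ T ∣ ∸ ρ T + j)) ≡⟨ cong (λ z → (sgn z *ᶻ indSum T) *ᶻ ev (Q (restrict N (E ─ T))) (λ j → g (∣ T ∣ ∸ z + j))) ρT ⟩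
        (-1ℤ *ᶻ indSum T) *ᶻ ev (Q (restrict N (E ─ T))) (λ j → g (∣ T ∣ ∸ 1 + j)) ≡⟨ cong₂ (λ x y → (-1ℤ *ᶻ x) *ᶻ y) iT
              (trans (ev-≈ {Q (restrict N (E ─ T))} {qU ∣ E ─ S ∣} (Q-line S∈L (⊆ᵇ-true⁻ T⊆S) p #T ρT) _) (cong (λ z → ev (qU z) (λ j → g (∣ T ∣ ∸ 1 + j))) ∣E─S∣)) ⟩
        (-1ℤ *ᶻ - m) *ᶻ y ≡⟨ lem m x y ⟩
        - m *ᶻ x +ᶻ -1ℤ *ᶻ lineWeight g n ∣ S ∣ ∣ T ∣ ≡⟨ cong₂ (λ a b → a *ᶻ x +ᶻ -1ℤ *ᶻ b) (sym iT) (sym (single (λ S → lineWeight g n ∣ S ∣ ∣ T ∣))) ⟩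
        _ ≡⟨ sym (h-indSum T⊆E p) ⟩
        h T ∎
        where
        m = + (∣ T ∣ ∸ 1)
        x = g (∣ T ∣ ∸ 2)
        y = ev (qU (n ∸ ∣ S ∣)) (λ j → g (∣ T ∣ ∸ 1 + j))
        iT : indSum T ≡ - m
        iT = indSum-line T⊆E p ρT
        ∣E─S∣ : ∣ E ─ S ∣ ≡ n ∸ ∣ S ∣
        ∣E─S∣ = trans (sym (ℕP.m+n∸n≡m ∣ E ─ S ∣ ∣ S ∣)) (cong (_∸ ∣ S ∣) (∣─∣ (proj₁ (line S∈L))))
        lem : ∀ m x y → (-1ℤ *ᶻ - m) *ᶻ y ≡ - m *ᶻ x +ᶻ -1ℤ *ᶻ (- m *ᶻ (x +ᶻ y))
        lem = ℤR.solve-∀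

      h-⊥ : h ⊥ ≡ 0ℤ
      h-⊥ = begin
        h ⊥ ≡⟨ cong₂ (λ x y → (C₂ (∣ ⊥ {amb N} ∣ ∸ 1) *ᶻ g (∣ ⊥ {amb N} ∣ ∸ 2) +ᶻ -1ℤ *ᶻ x) +ᶻ -1ℤ *ᶻ y)
              (ΣL-zero L (λ {S} _ → cong (λ X → C₂ X *ᶻ g (∣ ⊥ {amb N} ∣ ∸ 2)) (trans (cong ∣_∣ (SubP.∩-zeroˡ S)) (SubP.∣⊥∣≡0 (amb N)))))
              (ΣL-zero L (λ {S} _ → trans (cong (λ z → if ⊥ ⊆ᵇ S then lineWeight g n ∣ S ∣ z else 0ℤ) (SubP.∣⊥∣≡0 (amb N))) (if-same (⊥ ⊆ᵇ S)))) ⟩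
        (C₂ (∣ ⊥ {amb N} ∣ ∸ 1) *ᶻ g (∣ ⊥ {amb N} ∣ ∸ 2) +ᶻ 0ℤ) +ᶻ 0ℤ ≡⟨ cong (λ z → (C₂ (z ∸ 1) *ᶻ g (z ∸ 2) +ᶻ 0ℤ) +ᶻ 0ℤ) (SubP.∣⊥∣≡0 (amb N)) ⟩
        0ℤ ∎
        where
        if-same : ∀ b → (if b then 0ℤ else 0ℤ) ≡ 0ℤ
        if-same true  = refl
        if-same false = refl

      sum-h : Σ⊆ E h ≡ freeTerm n g -ᶻ ΣL L (λ S → lineTerm n ∣ S ∣ g)
      sum-h = begin
        Σ⊆ E h ≡⟨ trans (Σ⊆-+ E _ _) (cong₂ _+ᶻ_ (Σ⊆-+ E _ _) refl) ⟩
        (Σ⊆ E (λ T → C₂ (∣ T ∣ ∸ 1) *ᶻ g (∣ T ∣ ∸ 2)) +ᶻ Σ⊆ E (λ T → -1ℤ *ᶻ ΣL L (λ S → C₂ ∣ T ∩ S ∣ *ᶻ g (∣ T ∣ ∸ 2))))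
          +ᶻ Σ⊆ E (λ T → -1ℤ *ᶻ ΣL L (λ S → if T ⊆ᵇ S then lineWeight g n ∣ S ∣ ∣ T ∣ else 0ℤ))
            ≡⟨ cong₂ _+ᶻ_ (cong₂ _+ᶻ_ (Σ⊆-card E _)
                 (trans (Σ⊆-* E -1ℤ _) (cong (-1ℤ *ᶻ_) (trans (ΣL-Σ⊆ L E (λ S T → C₂ ∣ T ∩ S ∣ *ᶻ g (∣ T ∣ ∸ 2))) (ΣL-cong L pairs)))))
                 (trans (Σ⊆-* E -1ℤ _) (cong (-1ℤ *ᶻ_) (trans (ΣL-Σ⊆ L E (λ S T → if T ⊆ᵇ S then lineWeight g n ∣ S ∣ ∣ T ∣ else 0ℤ)) (ΣL-cong L inner)))) ⟩
        (freeTerm n g +ᶻ -1ℤ *ᶻ ΣL L (λ S → P ∣ S ∣)) +ᶻ -1ℤ *ᶻ ΣL L (λ S → W ∣ S ∣) ≡⟨ lem (freeTerm n g) _ _ ⟩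
        freeTerm n g -ᶻ (ΣL L (λ S → P ∣ S ∣) +ᶻ ΣL L (λ S → W ∣ S ∣)) ≡⟨ cong (freeTerm n g -ᶻ_) (sym (ΣL-+ L _ _)) ⟩
        freeTerm n g -ᶻ ΣL L (λ S → lineTerm n ∣ S ∣ g) ∎
        where
        P W : ℕ → ℤ
        P s = Bin s (λ i → Bin (n ∸ s) (λ j → C₂ i *ᶻ g (i + j ∸ 2)))
        W s = Bin s (lineWeight g n s)
        lem : ∀ a x y → (a +ᶻ -1ℤ *ᶻ x) +ᶻ -1ℤ *ᶻ y ≡ a -ᶻ (x +ᶻ y)
        lem = ℤR.solve-∀
        pairs : ∀ {S} → S ∈ˡ L → Σ⊆ E (λ T → C₂ ∣ T ∩ S ∣ *ᶻ g (∣ T ∣ ∸ 2)) ≡ P ∣ S ∣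
        pairs {S} S∈L = trans (Σ⊆-card₂ (proj₁ (line S∈L)) (λ i t → C₂ i *ᶻ g (t ∸ 2)))
          (cong (λ z → Bin ∣ S ∣ (λ i → Bin z (λ j → C₂ i *ᶻ g (i + j ∸ 2)))) (trans (sym (ℕP.m+n∸n≡m ∣ E ─ S ∣ ∣ S ∣)) (cong (_∸ ∣ S ∣) (∣─∣ (proj₁ (line S∈L))))))
        inner : ∀ {S} → S ∈ˡ L → Σ⊆ E (λ T → if T ⊆ᵇ S then lineWeight g n ∣ S ∣ ∣ T ∣ else 0ℤ) ≡ W ∣ S ∣
        inner {S} S∈L = trans (Σ⊆-∩ E S _) (trans (cong (λ X → Σ⊆ X (λ T → lineWeight g n ∣ S ∣ ∣ T ∣)) (⊆-antisym (SubP.p∩q⊆q E S) (⊆-∩ (proj₁ (line S∈L)) id)))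
          (Σ⊆-card S (lineWeight g n ∣ S ∣)))

      ev-Y₂ : ev (Yof Q N) g ≡ ev (Q N) g +ᶻ (freeTerm n g -ᶻ ΣL L (λ S → lineTerm n ∣ S ∣ g))
      ev-Y₂ = trans (ev-Yof-top g h step) (cong (ev (Q N) g +ᶻ_) (trans (cong₂ _-ᶻ_ sum-h h-⊥) (ℤP.+-identityʳ _)))

-- F(N) = α - Σ β over the lines of the dual: what the polynomials Q and Y of a matroid
-- of corank two have in common.
record LineExpansion (F : RawMatroid → Poly) : Set where
  field
    α : ℕ → ℕ → ℤ
    β : ℕ → ℕ → ℕ → ℤ
    expand : ∀ N → IsMatroid N → Loopless N → ∀ ρ L → IsCorankTwo N ρ L → ∀ i →
             coeff (F N) i ≡ α ∣ ground N ∣ i -ᶻ ΣL L (λ S → β ∣ ground N ∣ ∣ S ∣ i)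
    point : ∀ n i → β n 1 i ≡ 0ℤ
    product : ∀ a c i → let a⁺ = suc (suc a) ; c⁺ = suc (suc c) in
              coeff (F (Unif (a⁺ ∸ 1) a⁺) *P F (Unif (c⁺ ∸ 1) c⁺)) i ≡
              α (a⁺ + c⁺) i -ᶻ (β (a⁺ + c⁺) a⁺ i +ᶻ β (a⁺ + c⁺) c⁺ i)

half-zero : ∀ d {K : (ℕ → ℤ) → ℤ} i → (∀ g → K g ≡ 0ℤ) → half d K i ≡ 0ℤ
half-zero d i h with d ≤ᵇ 2 * i
... | true  = refl
... | false = ℤP.i≡j⇒i-j≡0 (trans (h _) (sym (h _)))

half-sub : ∀ d {K A B : (ℕ → ℤ) → ℤ} i → (∀ g → K g ≡ A g -ᶻ B g) → half d K i ≡ half d A i -ᶻ half d B i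
half-sub d {K} {A} {B} i h with d ≤ᵇ 2 * i
... | true  = refl
... | false = trans (cong₂ _-ᶻ_ (h (δ (d ∸ i))) (h (δ i))) (lem (A (δ (d ∸ i))) (B (δ (d ∸ i))) (A (δ i)) (B (δ i)))
  where
  lem : ∀ a b c e → (a -ᶻ b) -ᶻ (c -ᶻ e) ≡ (a -ᶻ c) -ᶻ (b -ᶻ e)
  lem = ℤR.solve-∀

half-ΣL : ∀ d {a} {A : Set a} (xs : List A) (B : A → (ℕ → ℤ) → ℤ) i →
          half d (λ g → ΣL xs (λ x → B x g)) i ≡ ΣL xs (λ x → half d (B x) i)
half-ΣL d xs B i with d ≤ᵇ 2 * i
... | true  = sym (ΣL-zero xs (λ _ → refl))
... | false = trans (lem (ΣL xs (λ x → B x (δ (d ∸ i)))) (ΣL xs (λ x → B x (δ i))))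
  (trans (cong (ΣL xs (λ x → B x (δ (d ∸ i))) +ᶻ_) (sym (ΣL-* xs -1ℤ _))) (trans (sym (ΣL-+ xs _ _))
    (ΣL-cong xs (λ {x} _ → sym (lem (B x (δ (d ∸ i))) (B x (δ i)))))))
  where
  lem : ∀ a b → a -ᶻ b ≡ a +ᶻ -1ℤ *ᶻ b
  lem = ℤR.solve-∀

-- A pair lies in the first part, in the second, or has one element in each.
C₂-+ : ∀ i j → C₂ (i + j) ≡ (C₂ i +ᶻ C₂ j) +ᶻ + i *ᶻ + j
C₂-+ zero    j = lem (C₂ j) (+ j)
  where
  lem : ∀ x y → x ≡ (0ℤ +ᶻ x) +ᶻ 0ℤ *ᶻ y
  lem = ℤR.solve-∀
C₂-+ (suc i) j = trans (cong (+ (i + j) +ᶻ_) (C₂-+ i j)) (lem (+ i) (+ j) (C₂ i) (C₂ j))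
  where
  lem : ∀ i j x y → (i +ᶻ j) +ᶻ ((x +ᶻ y) +ᶻ i *ᶻ j) ≡ ((i +ᶻ x) +ᶻ y) +ᶻ (1ℤ +ᶻ i) *ᶻ j
  lem = ℤR.solve-∀

module Expansions (Q : RawMatroid → Poly) (isQ : IsInverseKL Q) where
  open InverseKL Q isQ
  open CorankTwoFormula Q isQ
  open ≡-Reasoning

  αQ : ℕ → ℕ → ℤ
  αQ n = half (n ∸ 2) (freeTerm n)

  βQ : ℕ → ℕ → ℕ → ℤ
  βQ n s = half (n ∸ 2) (lineTerm n s)

  -- A point contains no pair, and the factor `t ∸ 1` is zero for `t ≤ 1`.
  lineTerm-point : ∀ n g → lineTerm n 1 g ≡ 0ℤ
  lineTerm-point n g = cong₂ _+ᶻ_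
    (cong₂ _+ᶻ_ (Bin-zero (n ∸ 1) {λ j → 0ℤ *ᶻ g (0 + j ∸ 2)} (λ j → ℤP.*-zeroˡ (g (0 + j ∸ 2))))
                (Bin-zero (n ∸ 1) {λ j → 0ℤ *ᶻ g (1 + j ∸ 2)} (λ j → ℤP.*-zeroˡ (g (1 + j ∸ 2)))))
    (cong₂ _+ᶻ_ (ℤP.*-zeroˡ (g 0 +ᶻ ev (qU (n ∸ 1)) (λ j → g (0 + j)))) (ℤP.*-zeroˡ (g 0 +ᶻ ev (qU (n ∸ 1)) (λ j → g (0 + j)))))

  module Expand (N : RawMatroid) (isN : IsMatroid N) (ll : Loopless N) (ρ : Subset (amb N) → ℕ)
                (L : List (Subset (amb N))) (two : IsCorankTwo N ρ L) where
    open IsCorankTwo two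
    open MatroidTheory N isN
    open CorankTwo N isN ll ρ L two
    private
      E = ground N
      n = ∣ E ∣

    rkE : rk N E ≡ n ∸ 2
    rkE = sym (trans (cong (_∸ 2) size) (ℕP.m+n∸n≡m (rk N E) 2))

    rkE-pos : 0 < rk N E
    rkE-pos with rk N E in eq
    ... | suc r = s≤s z≤n
    ... | zero with e , m ← nonempty {A = E} (subst (0 <_) (sym (trans size (cong (_+ 2) eq))) (s≤s z≤n)) =
      ⊥-elim (ll e (m , ℕP.n≤0⇒n≡0 (subst (rk N ⁅ e ⁆ ≤_) eq (rk-mono id (⁅⁆-⊆ m)))))

    expandQ : ∀ i → coeff (Q N) i ≡ αQ n i -ᶻ ΣL L (λ S → βQ n ∣ S ∣ i)
    expandQ i = begin
      coeff (Q N) i ≡⟨ half-unique (Yof Q N) (Q N) _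
          (subst (Palindromic (Yof Q N)) rkE (proj₂ (proj₂ (isQ N isN ll))))
          (λ i l → proj₁ (proj₂ (isQ N isN ll)) rkE-pos i (subst (_≤ 2 * i) (sym rkE) l)) ev-Y₂ i ⟩
      half (n ∸ 2) (λ g → freeTerm n g -ᶻ ΣL L (λ S → lineTerm n ∣ S ∣ g)) i ≡⟨ half-sub (n ∸ 2) {A = freeTerm n} {B = λ g → ΣL L (λ S → lineTerm n ∣ S ∣ g)} i (λ _ → refl) ⟩
      αQ n i -ᶻ half (n ∸ 2) (λ g → ΣL L (λ S → lineTerm n ∣ S ∣ g)) i ≡⟨ cong (αQ n i -ᶻ_) (half-ΣL (n ∸ 2) L (λ S → lineTerm n ∣ S ∣) i) ⟩
      αQ n i -ᶻ ΣL L (λ S → βQ n ∣ S ∣ i) ∎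

    -- Y is Q plus the functional of `ev-Y₂`, so its α and β are those of Q with `freeTerm` and
    -- `lineTerm` added.
    expandY : ∀ i → coeff (Yof Q N) i ≡ (αQ n i +ᶻ freeTerm n (δ i)) -ᶻ ΣL L (λ S → (βQ n ∣ S ∣ i) +ᶻ lineTerm n ∣ S ∣ (δ i))
    expandY i = begin
      coeff (Yof Q N) i ≡⟨ sym (ev-δ (Yof Q N) i) ⟩
      ev (Yof Q N) (δ i) ≡⟨ ev-Y₂ (δ i) ⟩
      ev (Q N) (δ i) +ᶻ (freeTerm n (δ i) -ᶻ ΣL L (λ S → lineTerm n ∣ S ∣ (δ i))) ≡⟨ cong (_+ᶻ (freeTerm n (δ i) -ᶻ ΣL L (λ S → lineTerm n ∣ S ∣ (δ i)))) (trans (ev-δ (Q N) i) (expandQ i)) ⟩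
      (αQ n i -ᶻ ΣL L (λ S → βQ n ∣ S ∣ i)) +ᶻ (freeTerm n (δ i) -ᶻ ΣL L (λ S → lineTerm n ∣ S ∣ (δ i))) ≡⟨ lem (αQ n i) _ (freeTerm n (δ i)) _ ⟩
      (αQ n i +ᶻ freeTerm n (δ i)) -ᶻ (ΣL L (λ S → βQ n ∣ S ∣ i) +ᶻ ΣL L (λ S → lineTerm n ∣ S ∣ (δ i))) ≡⟨ cong ((αQ n i +ᶻ freeTerm n (δ i)) -ᶻ_) (sym (ΣL-+ L _ _)) ⟩
      (αQ n i +ᶻ freeTerm n (δ i)) -ᶻ ΣL L (λ S → (βQ n ∣ S ∣ i) +ᶻ lineTerm n ∣ S ∣ (δ i)) ∎
      where
      lem : ∀ a b c e → (a -ᶻ b) +ᶻ (c -ᶻ e) ≡ (a +ᶻ c) -ᶻ (b +ᶻ e)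
      lem = ℤR.solve-∀

  -- The direct sum of the circuits U_{a-1,a} and U_{c-1,c} has corank two, and the lines of
  -- its dual are the two circuits.
  module Product (a c da dc : ℕ) (degree : da + dc ≡ a + c ∸ 2) (Ya Yc : Poly)
                 (palA : Palindromic Ya da) (palC : Palindromic Yc dc) (lowA : Low (qU a) da) (lowC : Low (qU c) dc)
                 (evA : ∀ g → ev Ya g ≡ ev (qU a) g +ᶻ KU a g) (evC : ∀ g → ev Yc g ≡ ev (qU c) g +ᶻ KU c g) where
    private
      qa = qU a
      qc = qU c

    K : (ℕ → ℤ) → ℤ
    K g = freeTerm (a + c) g -ᶻ (lineTerm (a + c) a g +ᶻ lineTerm (a + c) c g)

    module _ (g : ℕ → ℤ) where

      -- The `at0` corrections of `pairs` add up to `G a` and `G c`, and so do, up to sign, the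
      -- first halves of the two line weights; they cancel in `ev-YaYc`.
      G : ℕ → ℤ
      G s = Bin s (λ t → + (t ∸ 1) *ᶻ g (t ∸ 2))

      P₁ P₂ R : ℤ
      P₁ = Bin a (λ i → Bin c (λ j → C₂ i *ᶻ g (i + j ∸ 2)))
      P₂ = Bin a (λ i → Bin c (λ j → C₂ j *ᶻ g (i + j ∸ 2)))
      R  = Bin a (λ i → Bin c (λ j → + (i ∸ 1) *ᶻ (+ (j ∸ 1) *ᶻ g ((i ∸ 1) + (j ∸ 1)))))

      at0 : ℕ → ℤ → ℤ
      at0 zero    x = x
      at0 (suc _) _ = 0ℤ

      -- The identity C(i+j-1,2) = C(i,2) + C(j,2) + (i-1)(j-1). For i = 0 or j = 0 the truncated
      -- product is wrong, and the `at0` terms make up for it.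
      pairs : ∀ i j → C₂ (i + j ∸ 1) *ᶻ g (i + j ∸ 2) +ᶻ (at0 j (+ (i ∸ 1) *ᶻ g (i ∸ 2)) +ᶻ at0 i (+ (j ∸ 1) *ᶻ g (j ∸ 2)))
        ≡ (C₂ i *ᶻ g (i + j ∸ 2) +ᶻ C₂ j *ᶻ g (i + j ∸ 2)) +ᶻ + (i ∸ 1) *ᶻ (+ (j ∸ 1) *ᶻ g ((i ∸ 1) + (j ∸ 1)))
      pairs zero    zero    = refl
      pairs zero    (suc j) = lem (C₂ j) (+ j) (g (j ∸ 1)) (g j)
        where
        lem : ∀ x j y z → x *ᶻ y +ᶻ (0ℤ +ᶻ j *ᶻ y) ≡ (0ℤ *ᶻ y +ᶻ (j +ᶻ x) *ᶻ y) +ᶻ 0ℤ *ᶻ (j *ᶻ z)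
        lem = ℤR.solve-∀
      pairs (suc i) zero rewrite ℕP.+-identityʳ i = lem (C₂ i) (+ i) (g (i ∸ 1)) (g i)
        where
        lem : ∀ x i y z → x *ᶻ y +ᶻ (i *ᶻ y +ᶻ 0ℤ) ≡ ((i +ᶻ x) *ᶻ y +ᶻ 0ℤ *ᶻ y) +ᶻ i *ᶻ (0ℤ *ᶻ z)
        lem = ℤR.solve-∀
      pairs (suc i) (suc j) rewrite ℕP.+-suc i j | C₂-+ i j = lem (C₂ i) (C₂ j) (+ i) (+ j) (g (i + j))
        where
        lem : ∀ x y i j z → ((i +ᶻ j) +ᶻ ((x +ᶻ y) +ᶻ i *ᶻ j)) *ᶻ z +ᶻ (0ℤ +ᶻ 0ℤ) ≡
              ((i +ᶻ x) *ᶻ z +ᶻ (j +ᶻ y) *ᶻ z) +ᶻ i *ᶻ (j *ᶻ z)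
        lem = ℤR.solve-∀

      free≡ : freeTerm (a + c) g +ᶻ (G a +ᶻ G c) ≡ (P₁ +ᶻ P₂) +ᶻ R
      free≡ = begin
        freeTerm (a + c) g +ᶻ (G a +ᶻ G c)
          ≡⟨ cong₂ _+ᶻ_ (Bin-Bin a c (λ t → C₂ (t ∸ 1) *ᶻ g (t ∸ 2))) (cong₂ _+ᶻ_
               (Bin-cong a (λ i → sym (Bin-at-0 c {λ j → at0 j (+ (i ∸ 1) *ᶻ g (i ∸ 2))} (λ _ → refl))))
               (sym (trans (Bin-swap a c (λ i j → at0 i (+ (j ∸ 1) *ᶻ g (j ∸ 2)))) (Bin-cong c (λ j → Bin-at-0 a {λ i → at0 i (+ (j ∸ 1) *ᶻ g (j ∸ 2))} (λ _ → refl)))))) ⟩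
        B (λ i j → C₂ (i + j ∸ 1) *ᶻ g (i + j ∸ 2)) +ᶻ (B (λ i j → at0 j (+ (i ∸ 1) *ᶻ g (i ∸ 2))) +ᶻ B (λ i j → at0 i (+ (j ∸ 1) *ᶻ g (j ∸ 2))))
          ≡⟨ sym (trans (B-+ _ _) (cong (B (λ i j → C₂ (i + j ∸ 1) *ᶻ g (i + j ∸ 2)) +ᶻ_) (B-+ _ _))) ⟩
        B (λ i j → C₂ (i + j ∸ 1) *ᶻ g (i + j ∸ 2) +ᶻ (at0 j (+ (i ∸ 1) *ᶻ g (i ∸ 2)) +ᶻ at0 i (+ (j ∸ 1) *ᶻ g (j ∸ 2))))
          ≡⟨ Bin-cong a (λ i → Bin-cong c (pairs i)) ⟩
        B (λ i j → (C₂ i *ᶻ g (i + j ∸ 2) +ᶻ C₂ j *ᶻ g (i + j ∸ 2)) +ᶻ + (i ∸ 1) *ᶻ (+ (j ∸ 1) *ᶻ g ((i ∸ 1) + (j ∸ 1))))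
          ≡⟨ trans (B-+ _ _) (cong (_+ᶻ R) (B-+ _ _)) ⟩
        (P₁ +ᶻ P₂) +ᶻ R ∎
        where
        B : (ℕ → ℕ → ℤ) → ℤ
        B f = Bin a (λ i → Bin c (f i))
        B-+ : ∀ f h → B (λ i j → f i j +ᶻ h i j) ≡ B f +ᶻ B h
        B-+ f h = trans (Bin-cong a (λ i → Bin-+ c (f i) (h i))) (Bin-+ a _ _)

      weights : ∀ n s q → qU (n ∸ s) ≡ q → Bin s (lineWeight g n s) ≡ - (G s +ᶻ KU s (λ j → ev q (λ k → g (j + k))))
      weights n s q refl = begin
        Bin s (lineWeight g n s) ≡⟨ Bin-cong s (λ t → lem (+ (t ∸ 1)) (g (t ∸ 2)) (ev q (λ j → g (t ∸ 1 + j)))) ⟩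
        Bin s (λ t → -1ℤ *ᶻ (+ (t ∸ 1) *ᶻ g (t ∸ 2) +ᶻ + (t ∸ 1) *ᶻ ev q (λ j → g (t ∸ 1 + j)))) ≡⟨ trans (Bin-* s -1ℤ _) (cong (-1ℤ *ᶻ_) (Bin-+ s _ _)) ⟩
        -1ℤ *ᶻ (G s +ᶻ KU s (λ j → ev q (λ k → g (j + k)))) ≡⟨ ℤP.-1*i≡-i _ ⟩
        - (G s +ᶻ KU s (λ j → ev q (λ k → g (j + k)))) ∎
        where
        lem : ∀ m x y → - m *ᶻ (x +ᶻ y) ≡ -1ℤ *ᶻ (m *ᶻ x +ᶻ m *ᶻ y)
        lem = ℤR.solve-∀

      line-a : lineTerm (a + c) a g ≡ P₁ +ᶻ - (G a +ᶻ KU a (λ j → ev qc (λ k → g (j + k))))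
      line-a = cong₂ _+ᶻ_ (cong (λ z → Bin a (λ i → Bin z (λ j → C₂ i *ᶻ g (i + j ∸ 2)))) (ℕP.m+n∸m≡n a c))
        (weights (a + c) a qc (cong qU (ℕP.m+n∸m≡n a c)))

      line-c : lineTerm (a + c) c g ≡ P₂ +ᶻ - (G c +ᶻ KU c (λ j → ev qa (λ k → g (j + k))))
      line-c = cong₂ _+ᶻ_ (trans (cong (λ z → Bin c (λ i → Bin z (λ j → C₂ i *ᶻ g (i + j ∸ 2)))) (ℕP.m+n∸n≡m a c))
                 (trans (Bin-swap c a _) (Bin-cong a (λ i → Bin-cong c (λ j → cong (λ z → C₂ j *ᶻ g (z ∸ 2)) (ℕP.+-comm j i))))))
        (weights (a + c) c qa (cong qU (ℕP.m+n∸n≡m a c)))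

      -- Expand (Qa + Ka)(Qc + Kc). The mixed products are the second halves of the weights of the
      -- two lines, and Ka Kc is `R`, which `free≡` expresses through `freeTerm`, the pairs within
      -- the lines and `G`.
      ev-YaYc : ev (Ya *P Yc) g ≡ ev (qa *P qc) g +ᶻ K g
      ev-YaYc = begin
        ev (Ya *P Yc) g ≡⟨ ev-*P Ya Yc g ⟩
        ev Ya (λ j → ev Yc (λ k → g (j + k))) ≡⟨ ev-cong Ya (λ j → evC (λ k → g (j + k))) ⟩
        ev Ya (λ j → φ j +ᶻ ψ j) ≡⟨ evA (λ j → φ j +ᶻ ψ j) ⟩
        ev qa (λ j → φ j +ᶻ ψ j) +ᶻ KU a (λ j → φ j +ᶻ ψ j) ≡⟨ cong₂ _+ᶻ_ (ev-+ qa φ ψ)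
              (trans (Bin-cong a (λ i → ℤP.*-distribˡ-+ (+ (i ∸ 1)) (φ (i ∸ 1)) (ψ (i ∸ 1)))) (Bin-+ a _ _)) ⟩
        (ev qa φ +ᶻ ev qa ψ) +ᶻ (KU a φ +ᶻ KU a ψ) ≡⟨ cong₂ (λ x y → (ev qa φ +ᶻ x) +ᶻ (KU a φ +ᶻ y)) swap
              (Bin-cong a (λ i → sym (Bin-* c (+ (i ∸ 1)) _))) ⟩
        (ev qa φ +ᶻ KU c φ′) +ᶻ (KU a φ +ᶻ R) ≡⟨ lem (ev qa φ) (KU c φ′) (KU a φ) (freeTerm (a + c) g) (G a) (G c) P₁ P₂ R free≡ ⟩
        ev qa φ +ᶻ (freeTerm (a + c) g -ᶻ ((P₁ +ᶻ - (G a +ᶻ KU a φ)) +ᶻ (P₂ +ᶻ - (G c +ᶻ KU c φ′))))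
                                                              ≡⟨ cong₂ _+ᶻ_ (sym (ev-*P qa qc g)) (cong (freeTerm (a + c) g -ᶻ_) (sym (cong₂ _+ᶻ_ line-a line-c))) ⟩
        ev (qa *P qc) g +ᶻ K g ∎
        where
        φ ψ φ′ : ℕ → ℤ
        φ j = ev qc (λ k → g (j + k))
        ψ j = KU c (λ k → g (j + k))
        φ′ k = ev qa (λ j → g (k + j))
        swap : ev qa ψ ≡ KU c φ′
        swap = trans (ev-Bin qa c (λ j i → + (i ∸ 1) *ᶻ g (j + (i ∸ 1)))) (Bin-cong c (λ i → trans (ev-* qa (+ (i ∸ 1)) _)
          (cong (+ (i ∸ 1) *ᶻ_) (ev-cong qa (λ j → cong g (ℕP.+-comm j (i ∸ 1)))))))
        lem : ∀ e x y f u v p q r → f +ᶻ (u +ᶻ v) ≡ (p +ᶻ q) +ᶻ r →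
              (e +ᶻ x) +ᶻ (y +ᶻ r) ≡ e +ᶻ (f -ᶻ ((p +ᶻ - (u +ᶻ y)) +ᶻ (q +ᶻ - (v +ᶻ x))))
        lem e x y f u v p q r h = trans (l₁ e x y p q r) (trans (cong (λ z → ((e +ᶻ x) +ᶻ y) +ᶻ (z -ᶻ (p +ᶻ q))) (sym h)) (l₂ e x y f u v p q))
          where
          l₁ : ∀ e x y p q r → (e +ᶻ x) +ᶻ (y +ᶻ r) ≡ ((e +ᶻ x) +ᶻ y) +ᶻ (((p +ᶻ q) +ᶻ r) -ᶻ (p +ᶻ q))
          l₁ = ℤR.solve-∀
          l₂ : ∀ e x y f u v p q → ((e +ᶻ x) +ᶻ y) +ᶻ ((f +ᶻ (u +ᶻ v)) -ᶻ (p +ᶻ q)) ≡ e +ᶻ (f -ᶻ ((p +ᶻ - (u +ᶻ y)) +ᶻ (q +ᶻ - (v +ᶻ x))))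
          l₂ = ℤR.solve-∀

    -- If 2j < da and 2k < dc, then 2(j + k) < da + dc, so no product of nonzero coefficients
    -- reaches `i`.
    low : Low (qa *P qc) (da + dc)
    low i l = trans (sym (ev-δ (qa *P qc) i)) (trans (ev-*P qa qc (δ i)) (trans (ev-agree qa left) (ev-zero qa)))
      where
      left : ∀ j → coeff qa j ≡ 0ℤ ⊎ ev qc (λ k → δ i (j + k)) ≡ 0ℤ
      left j with ℕP.≤-<-connex da (2 * j)
      ... | inj₁ l′ = inj₁ (lowA j l′)
      ... | inj₂ l′ = inj₂ (trans (ev-agree qc right) (ev-zero qc))
        where
        right : ∀ k → coeff qc k ≡ 0ℤ ⊎ δ i (j + k) ≡ 0ℤ
        right k with ℕP.≤-<-connex dc (2 * k)
        ... | inj₁ l″ = inj₁ (lowC k l″)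
        ... | inj₂ l″ = inj₂ (δ-≢ {i} {j + k} λ eq → ℕP.<⇒≱ (ℕP.+-mono-< l′ l″)
              (ℕP.≤-trans l (ℕP.≤-reflexive (trans (cong (2 *_) eq) (ℕP.*-distribˡ-+ 2 j k)))))

    productQ : ∀ i → coeff (qa *P qc) i ≡ αQ (a + c) i -ᶻ (βQ (a + c) a i +ᶻ βQ (a + c) c i)
    productQ i = begin
      coeff (qa *P qc) i ≡⟨ half-unique (Ya *P Yc) (qa *P qc) K (palindromic-* Ya Yc palA palC) low ev-YaYc i ⟩
      half (da + dc) K i ≡⟨ cong (λ d → half d K i) degree ⟩
      half (a + c ∸ 2) K i ≡⟨ half-sub (a + c ∸ 2) {A = λ g → freeTerm (a + c) g -ᶻ lineTerm (a + c) a g} {B = lineTerm (a + c) c} i (λ g → lem (freeTerm (a + c) g) (lineTerm (a + c) a g) (lineTerm (a + c) c g)) ⟩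
      half (a + c ∸ 2) (λ g → freeTerm (a + c) g -ᶻ lineTerm (a + c) a g) i -ᶻ βQ (a + c) c i ≡⟨ cong (_-ᶻ βQ (a + c) c i) (half-sub (a + c ∸ 2) {A = freeTerm (a + c)} {B = lineTerm (a + c) a} i (λ _ → refl)) ⟩
      (αQ (a + c) i -ᶻ βQ (a + c) a i) -ᶻ βQ (a + c) c i ≡⟨ sym (lem (αQ (a + c) i) (βQ (a + c) a i) (βQ (a + c) c i)) ⟩
      αQ (a + c) i -ᶻ (βQ (a + c) a i +ᶻ βQ (a + c) c i) ∎
      where
      lem : ∀ x y z → x -ᶻ (y +ᶻ z) ≡ (x -ᶻ y) -ᶻ z
      lem = ℤR.solve-∀

    productY : ∀ i → coeff (Ya *P Yc) i ≡ (αQ (a + c) i +ᶻ freeTerm (a + c) (δ i)) -ᶻ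
      ((βQ (a + c) a i +ᶻ lineTerm (a + c) a (δ i)) +ᶻ (βQ (a + c) c i +ᶻ lineTerm (a + c) c (δ i)))
    productY i = begin
      coeff (Ya *P Yc) i ≡⟨ sym (ev-δ (Ya *P Yc) i) ⟩
      ev (Ya *P Yc) (δ i) ≡⟨ ev-YaYc (δ i) ⟩
      ev (qa *P qc) (δ i) +ᶻ K (δ i) ≡⟨ cong (_+ᶻ K (δ i)) (trans (ev-δ (qa *P qc) i) (productQ i)) ⟩
      (αQ (a + c) i -ᶻ (βQ (a + c) a i +ᶻ βQ (a + c) c i)) +ᶻ K (δ i) ≡⟨ lem (αQ (a + c) i) (βQ (a + c) a i) (βQ (a + c) c i) (freeTerm (a + c) (δ i)) (lineTerm (a + c) a (δ i)) (lineTerm (a + c) c (δ i)) ⟩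
      _ ∎
      where
      lem : ∀ x y z u v w → (x -ᶻ (y +ᶻ z)) +ᶻ (u -ᶻ (v +ᶻ w)) ≡ (x +ᶻ u) -ᶻ ((y +ᶻ v) +ᶻ (z +ᶻ w))
      lem = ℤR.solve-∀

  module UnifProduct (a c : ℕ) = Product (suc (suc a)) (suc (suc c)) (suc a) (suc c) (sym (cong (λ z → z ∸ 1) (ℕP.+-suc (suc a) (suc c))))
    (Yof Q (Unif (suc a) (suc (suc a)))) (Yof Q (Unif (suc c) (suc (suc c))))
    (U₁-palindromic a) (U₁-palindromic c) (U₁-low a) (U₁-low c) (ev-Y-U₁ a) (ev-Y-U₁ c)

  expansionQ : LineExpansion Q
  expansionQ = record
    { α = αQ ; β = βQ
    ; expand = λ N isN ll ρ L two → Expand.expandQ N isN ll ρ L two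
    ; point = λ n i → half-zero (n ∸ 2) i (lineTerm-point n)
    ; product = λ a c → UnifProduct.productQ a c }

  expansionY : LineExpansion (Yof Q)
  expansionY = record
    { α = λ n i → αQ n i +ᶻ freeTerm n (δ i)
    ; β = λ n s i → βQ n s i +ᶻ lineTerm n s (δ i)
    ; expand = λ N isN ll ρ L two → Expand.expandY N isN ll ρ L two
    ; point = λ n i → cong₂ _+ᶻ_ (half-zero (n ∸ 2) i (lineTerm-point n)) (lineTerm-point n (δ i))
    ; product = λ a c → UnifProduct.productY a c }

-- Dual rank functions

-- s is the rank function of the dual of (E, r), written without subtraction.
DualRanks : ∀ {n} → Subset n → (r s : Subset n → ℕ) → Set
DualRanks E r s = ∀ {A} → A ⊆ E → r A + s E ≡ ∣ A ∣ + s (E ─ A)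

module _ {n} {E : Subset n} {r s : Subset n → ℕ} where

  -- Adding `s E` to both sides of an axiom for `r`, twice for submodularity, turns it by `key` into
  -- a statement about `s` on complements.
  dual-isMatroid : IsMatroid (mkRaw n E s) → DualRanks E r s → IsMatroid (mkRaw n E r)
  dual-isMatroid isS key = size , mono , submod
    where
    open MatroidTheory (mkRaw n E s) isS
    size : ∀ A → A ⊆ E → r A ≤ ∣ A ∣
    size A A⊆E = ℕP.+-cancelʳ-≤ (s E) _ _ (ℕP.≤-trans (ℕP.≤-reflexive (key A⊆E)) (ℕP.+-monoʳ-≤ ∣ A ∣ (rk-mono id (SubP.p─q⊆p E A))))
    mono : ∀ A B → A ⊆ E → B ⊆ E → A ⊆ B → r A ≤ r B
    mono A B A⊆E B⊆E A⊆B = ℕP.+-cancelʳ-≤ (s E) _ _ (begin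
      r A + s E ≡⟨ key A⊆E ⟩
      ∣ A ∣ + s (E ─ A) ≡⟨ cong (λ X → ∣ A ∣ + s X) (sym (─-∪-─ A⊆B B⊆E)) ⟩
      ∣ A ∣ + s ((B ─ A) ∪ (E ─ B)) ≤⟨ ℕP.+-monoʳ-≤ ∣ A ∣ (ℕP.≤-trans (ℕP.m≤m+n _ _) (rk-submod B─A⊆E (SubP.p─q⊆p E B))) ⟩
      ∣ A ∣ + (s (B ─ A) + s (E ─ B)) ≤⟨ ℕP.+-monoʳ-≤ ∣ A ∣ (ℕP.+-monoˡ-≤ (s (E ─ B)) (rk≤ B─A⊆E)) ⟩
      ∣ A ∣ + (∣ B ─ A ∣ + s (E ─ B)) ≡⟨ sym (ℕP.+-assoc ∣ A ∣ _ _) ⟩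
      ∣ A ∣ + ∣ B ─ A ∣ + s (E ─ B) ≡⟨ cong (_+ s (E ─ B)) (trans (ℕP.+-comm ∣ A ∣ _) (∣─∣ A⊆B)) ⟩
      ∣ B ∣ + s (E ─ B) ≡⟨ sym (key B⊆E) ⟩
      r B + s E ∎)
      where
      open ℕP.≤-Reasoning
      B─A⊆E : B ─ A ⊆ E
      B─A⊆E m = B⊆E (SubP.p─q⊆p B A m)
    submod : ∀ A B → A ⊆ E → B ⊆ E → r (A ∪ B) + r (A ∩ B) ≤ r A + r B
    submod A B A⊆E B⊆E = ℕP.+-cancelʳ-≤ (s E + s E) _ _ (begin
      (r (A ∪ B) + r (A ∩ B)) + (s E + s E) ≡⟨ ℕ-interchange (r (A ∪ B)) (r (A ∩ B)) (s E) (s E) ⟩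
      (r (A ∪ B) + s E) + (r (A ∩ B) + s E) ≡⟨ cong₂ _+_ (key (∪-⊆ A⊆E B⊆E)) (key (λ m → A⊆E (SubP.p∩q⊆p A B m))) ⟩
      (∣ A ∪ B ∣ + s (E ─ (A ∪ B))) + (∣ A ∩ B ∣ + s (E ─ (A ∩ B))) ≡⟨ ℕ-interchange (∣ A ∪ B ∣) _ _ _ ⟩
      (∣ A ∪ B ∣ + ∣ A ∩ B ∣) + (s (E ─ (A ∪ B)) + s (E ─ (A ∩ B))) ≤⟨ ℕP.+-mono-≤ (ℕP.≤-reflexive (∣∪∣+∣∩∣ A B)) le ⟩
      (∣ A ∣ + ∣ B ∣) + (s (E ─ A) + s (E ─ B)) ≡⟨ ℕ-interchange (∣ A ∣) _ _ _ ⟩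
      (∣ A ∣ + s (E ─ A)) + (∣ B ∣ + s (E ─ B)) ≡⟨ cong₂ _+_ (sym (key A⊆E)) (sym (key B⊆E)) ⟩
      (r A + s E) + (r B + s E) ≡⟨ ℕ-interchange (r A) _ _ _ ⟩
      (r A + r B) + (s E + s E) ∎)
      where
      open ℕP.≤-Reasoning
      ℕ-interchange : ∀ a b c d → (a + b) + (c + d) ≡ (a + c) + (b + d)
      ℕ-interchange = ℕR.solve-∀
      le : s (E ─ (A ∪ B)) + s (E ─ (A ∩ B)) ≤ s (E ─ A) + s (E ─ B)
      le = begin
        s (E ─ (A ∪ B)) + s (E ─ (A ∩ B)) ≤⟨ ℕP.+-mono-≤
           (rk-mono (λ m → SubP.p─q⊆p E A (SubP.p∩q⊆p _ (E ─ B) m)) (⊆-∩ (─-antitone E (SubP.p⊆p∪q B)) (─-antitone E (SubP.q⊆p∪q A B))))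
           (rk-mono (∪-⊆ (SubP.p─q⊆p E A) (SubP.p─q⊆p E B)) sub) ⟩
        s ((E ─ A) ∩ (E ─ B)) + s ((E ─ A) ∪ (E ─ B)) ≡⟨ ℕP.+-comm (s ((E ─ A) ∩ (E ─ B))) _ ⟩
        s ((E ─ A) ∪ (E ─ B)) + s ((E ─ A) ∩ (E ─ B)) ≤⟨ rk-submod (SubP.p─q⊆p E A) (SubP.p─q⊆p E B) ⟩
        s (E ─ A) + s (E ─ B) ∎
        where
        sub : E ─ (A ∩ B) ⊆ (E ─ A) ∪ (E ─ B)
        sub {x} m with e , x∉ ← ∈─⁻ {p = E} {A ∩ B} m with x ∈? A
        ... | no  x∉A = SubP.p⊆p∪q (E ─ B) (∈─⁺ e x∉A)
        ... | yes x∈A = SubP.q⊆p∪q (E ─ A) (E ─ B) (∈─⁺ e (λ x∈B → x∉ (SubP.x∈p∩q⁺ (x∈A , x∈B))))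

  dual-complement : s ⊥ ≡ 0 → DualRanks E r s → ∀ {T} → T ⊆ E → r (E ─ T) + ∣ T ∣ ≡ r E + s T
  dual-complement s⊥ key {T} T⊆E = ℕP.+-cancelʳ-≡ (s E) _ _ (begin
    r (E ─ T) + ∣ T ∣ + s E ≡⟨ swap (r (E ─ T)) (∣ T ∣) (s E) ⟩
    r (E ─ T) + s E + ∣ T ∣ ≡⟨ cong (_+ ∣ T ∣) (key (SubP.p─q⊆p E T)) ⟩
    ∣ E ─ T ∣ + s (E ─ (E ─ T)) + ∣ T ∣ ≡⟨ cong (λ X → ∣ E ─ T ∣ + s X + ∣ T ∣) (─-involutive T⊆E) ⟩
    ∣ E ─ T ∣ + s T + ∣ T ∣ ≡⟨ swap (∣ E ─ T ∣) (s T) (∣ T ∣) ⟩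
    ∣ E ─ T ∣ + ∣ T ∣ + s T ≡⟨ cong (_+ s T) (∣─∣ T⊆E) ⟩
    ∣ E ∣ + s T ≡⟨ cong (_+ s T) (sym total) ⟩
    r E + s E + s T ≡⟨ swap (r E) (s E) (s T) ⟩
    r E + s T + s E ∎)
    where
    open ≡-Reasoning
    swap : ∀ a b c → a + b + c ≡ a + c + b
    swap = ℕR.solve-∀
    total : r E + s E ≡ ∣ E ∣
    total = trans (key id) (trans (cong (λ z → ∣ E ∣ + z) (trans (cong s (─-self E)) s⊥)) (ℕP.+-identityʳ _))

  dual-sym : r ⊥ ≡ 0 → DualRanks E s r → DualRanks E r s
  dual-sym r⊥ key {A} A⊆E = ℕP.+-cancelʳ-≡ (r E) _ _ (begin
    r A + s E + r E ≡⟨ ℕP.+-assoc (r A) (s E) (r E) ⟩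
    r A + (s E + r E) ≡⟨ cong (λ z → r A + z) total ⟩
    r A + ∣ E ∣ ≡⟨ cong (λ z → r A + z) (sym (∣─∣ A⊆E)) ⟩
    r A + (∣ E ─ A ∣ + ∣ A ∣) ≡⟨ rotate (r A) (∣ E ─ A ∣) (∣ A ∣) ⟩
    ∣ A ∣ + (∣ E ─ A ∣ + r A) ≡⟨ cong (λ X → ∣ A ∣ + (∣ E ─ A ∣ + r X)) (sym (─-involutive A⊆E)) ⟩
    ∣ A ∣ + (∣ E ─ A ∣ + r (E ─ (E ─ A))) ≡⟨ cong (λ z → ∣ A ∣ + z) (sym (key (SubP.p─q⊆p E A))) ⟩
    ∣ A ∣ + (s (E ─ A) + r E) ≡⟨ sym (ℕP.+-assoc ∣ A ∣ _ _) ⟩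
    ∣ A ∣ + s (E ─ A) + r E ∎)
    where
    open ≡-Reasoning
    rotate : ∀ a b c → a + (b + c) ≡ c + (b + a)
    rotate = ℕR.solve-∀
    total : s E + r E ≡ ∣ E ∣
    total = trans (key id) (trans (cong (λ z → ∣ E ∣ + z) (trans (cong r (─-self E)) r⊥)) (ℕP.+-identityʳ _))

-- Lines of a matroid of rank two

subsets-complete : ∀ {m} (A : Subset m) → A ∈ˡ subsets m
subsets-complete []            = here refl
subsets-complete (outside ∷ A) = ∈-++⁺ˡ (∈-map⁺ (outside ∷_) (subsets-complete A))
subsets-complete {suc m} (inside ∷ A)  = ∈-++⁺ʳ (map (outside ∷_) (subsets m)) (∈-map⁺ (inside ∷_) (subsets-complete A))

module RankTwo {n} {E : Subset n} {s : Subset n → ℕ} (isS : IsMatroid (mkRaw n E s)) (ll : Loopless (mkRaw n E s)) (sE : s E ≡ 2) where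
  open MatroidTheory (mkRaw n E s) isS

  rank-pos : ∀ {D} → D ⊆ E → 0 < ∣ D ∣ → 1 ≤ s D
  rank-pos {D} D⊆E p with e , m ← nonempty {A = D} p = ℕP.≤-trans (ℕP.n≢0⇒n>0 (λ z → ll e (D⊆E m , z))) (rk-mono D⊆E (⁅⁆-⊆ m))

  rank-cases : ∀ {D} → D ⊆ E → 0 < ∣ D ∣ → s D ≡ 1 ⊎ s D ≡ 2
  rank-cases {D} D⊆E p = go (s D) (rank-pos D⊆E p) (subst (s D ≤_) sE (rk-mono id D⊆E))
    where
    go : ∀ k → 1 ≤ k → k ≤ 2 → k ≡ 1 ⊎ k ≡ 2
    go 1 _ _ = inj₁ refl
    go 2 _ _ = inj₂ refl
    go (suc (suc (suc k))) _ (s≤s (s≤s ()))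

  -- `D` has rank 1 as well, so each of the two flats is its closure.
  line-unique : ∀ {D S S′} → 0 < ∣ D ∣ → D ⊆ S → D ⊆ S′ → Flat (mkRaw n E s) S → s S ≡ 1 → Flat (mkRaw n E s) S′ → s S′ ≡ 1 → S ≡ S′
  line-unique {D} p D⊆S D⊆S′ fl e fl′ e′ = ⊆-antisym
    (flat-absorbs fl′ D⊆S′ D⊆S (proj₁ fl) (trans e (sym (rank-D D⊆S fl e))))
    (flat-absorbs fl D⊆S D⊆S′ (proj₁ fl′) (trans e′ (sym (rank-D D⊆S fl e))))
    where
    rank-D : ∀ {S} → D ⊆ S → Flat (mkRaw n E s) S → s S ≡ 1 → s D ≡ 1
    rank-D D⊆S fl e = ℕP.≤-antisym (subst (s D ≤_) e (rk-mono (proj₁ fl) D⊆S)) (rank-pos (proj₁ fl ∘ D⊆S) p)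

  module _ {r : Subset n → ℕ} (key : DualRanks E r s) (L : List (Subset n))
           (lines⁻ : ∀ {S} → S ∈ˡ L → Flat (mkRaw n E s) S × s S ≡ 1)
           (lines⁺ : ∀ {S} → Flat (mkRaw n E s) S → s S ≡ 1 → S ∈ˡ L)
           (atMostOne : ∀ {D} → D ⊆ E → 0 < ∣ D ∣ → length (filterᵇ (D ⊆ᵇ_) L) ≤ 1) where

    -- A set of rank 1 lies in a listed line because its closure is one; `atMostOne` also ensures
    -- that the list does not repeat that line.
    isCorankTwo : IsCorankTwo (mkRaw n E r) s L
    isCorankTwo = record
      { dual = dual-complement {E = E} {r} {s} rk-⊥ key
      ; size = sym (trans (cong (λ z → r E + z) (sym sE)) (trans (key id) (trans (cong (λ z → ∣ E ∣ + z) (trans (cong s (─-self E)) rk-⊥)) (ℕP.+-identityʳ _))))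
      ; ρ⊥ = rk-⊥
      ; pos = rank-pos
      ; count = count
      ; line = λ m → proj₁ (proj₁ (lines⁻ m)) , proj₂ (lines⁻ m) }
      where
      count : ∀ {D} → D ⊆ E → 0 < ∣ D ∣ → length (filterᵇ (D ⊆ᵇ_) L) + s D ≡ 2
      count {D} D⊆E p with rank-cases D⊆E p
      ... | inj₁ one with Z , D⊆Z , fl , eq ← closure D⊆E = cong₂ _+_
              (ℕP.≤-antisym (atMostOne D⊆E p) (length-pos (∈-filterᵇ⁺ (D ⊆ᵇ_) L (lines⁺ fl (trans eq one)) (dec-true (D ⊆? Z) D⊆Z)))) one
      ... | inj₂ two = trans (cong (_+ s D) (length-0 (filterᵇ (D ⊆ᵇ_) L) none)) two
        where
        length-0 : ∀ (xs : List (Subset n)) → (∀ {x} → ¬ (x ∈ˡ xs)) → length xs ≡ 0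
        length-0 []       h = refl
        length-0 (x ∷ xs) h = ⊥-elim (h (here refl))
        none : ∀ {S} → ¬ (S ∈ˡ filterᵇ (D ⊆ᵇ_) L)
        none {S} m with S∈L , h ← ∈-filterᵇ⁻ (D ⊆ᵇ_) L m with (S⊆E , _) , sS ← lines⁻ S∈L =
          ℕP.<⇒≱ (s≤s (s≤s z≤n)) (subst (_≤ 1) two (subst (s D ≤_) sS (rk-mono S⊆E (dec-true⁻ (D ⊆? S) h))))

  flatLines : List (Subset n)
  flatLines = filterᵇ (λ S → isFlatᵇ (mkRaw n E s) S ∧ (s S ≡ᵇ 1)) (subsets n)

  -- Each subset is listed once: the halves without and with the first element cannot both
  -- contribute.
  filter-subsets≤1 : ∀ {m} (p : Subset m → Bool) → (∀ {A B} → p A ≡ true → p B ≡ true → A ≡ B) → length (filterᵇ p (subsets m)) ≤ 1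
  filter-subsets≤1 {zero} p h with p []
  ... | true  = s≤s z≤n
  ... | false = z≤n
  filter-subsets≤1 {suc m} p h = subst (_≤ 1) (sym (trans (cong length (ListP.filter-++ (T? ∘ p) (map (outside ∷_) (subsets m)) _)) (trans (ListP.length-++ (filterᵇ p (map (outside ∷_) (subsets m)))) (cong₂ _+_ (filter-map (subsets m)) (filter-map (subsets m))))))
      (go (filterᵇ p₀ (subsets m)) (filterᵇ p₁ (subsets m)) (filter-subsets≤1 p₀ (λ a b → VecP.∷-injectiveʳ (h a b))) (filter-subsets≤1 p₁ (λ a b → VecP.∷-injectiveʳ (h a b)))
        (λ a b → case VecP.∷-injectiveˡ (h (proj₂ (∈-filterᵇ⁻ p₀ (subsets m) a)) (proj₂ (∈-filterᵇ⁻ p₁ (subsets m) b))) of λ ()))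
    where
    p₀ p₁ : Subset m → Bool
    p₀ = p ∘ (outside ∷_)
    p₁ = p ∘ (inside ∷_)
    filter-map : ∀ {b} xs → length (filterᵇ p (map (b ∷_) xs)) ≡ length (filterᵇ (p ∘ (b ∷_)) xs)
    filter-map []       = refl
    filter-map {b} (x ∷ xs) with p (b ∷ x)
    ... | true  = cong suc (filter-map xs)
    ... | false = filter-map xs
    go : ∀ (xs ys : List (Subset m)) → length xs ≤ 1 → length ys ≤ 1 → (∀ {x y} → x ∈ˡ xs → y ∈ˡ ys → Data.Empty.⊥) → length xs + length ys ≤ 1
    go []       ys       _ l _ = l
    go (x ∷ xs) []       l _ _ = ℕP.≤-trans (ℕP.≤-reflexive (ℕP.+-identityʳ _)) l
    go (x ∷ xs) (y ∷ ys) _ _ d = ⊥-elim (d (here refl) (here refl))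

  filter-filter : ∀ {a} {A : Set a} (p q : A → Bool) xs → filterᵇ q (filterᵇ p xs) ≡ filterᵇ (λ x → p x ∧ q x) xs
  filter-filter p q []       = refl
  filter-filter p q (x ∷ xs) with p x
  ... | false = filter-filter p q xs
  ... | true with q x
  ...   | true  = cong (x ∷_) (filter-filter p q xs)
  ...   | false = filter-filter p q xs

  flatLines⁻ : ∀ {S} → S ∈ˡ flatLines → Flat (mkRaw n E s) S × s S ≡ 1
  flatLines⁻ {S} m with a , b ← ∧-true⁻ {isFlatᵇ (mkRaw n E s) S} (proj₂ (∈-filterᵇ⁻ _ (subsets n) m)) = isFlatᵇ⇒Flat (mkRaw n E s) S a , ≡ᵇ-true⁻ b

  flatLines-isCorankTwo : ∀ {r} → DualRanks E r s → IsCorankTwo (mkRaw n E r) s flatLines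
  flatLines-isCorankTwo key = isCorankTwo key flatLines flatLines⁻
    (λ {S} fl e → ∈-filterᵇ⁺ _ (subsets n) (subsets-complete S) (cong₂ _∧_ (Flat⇒isFlatᵇ (mkRaw n E s) S fl) (≡ᵇ-true e)))
    (λ {D} D⊆E p → subst (λ xs → length xs ≤ 1) (sym (filter-filter _ (D ⊆ᵇ_) (subsets n)))
      (filter-subsets≤1 _ (λ {A} {B} a b →
        let a₁ , a₂ = ∧-true⁻ {isFlatᵇ (mkRaw n E s) A ∧ (s A ≡ᵇ 1)} a ; b₁ , b₂ = ∧-true⁻ {isFlatᵇ (mkRaw n E s) B ∧ (s B ≡ᵇ 1)} b
            a₃ , a₄ = ∧-true⁻ {isFlatᵇ (mkRaw n E s) A} a₁ ; b₃ , b₄ = ∧-true⁻ {isFlatᵇ (mkRaw n E s) B} b₁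
        in line-unique p (dec-true⁻ (D ⊆? A) a₂) (dec-true⁻ (D ⊆? B) b₂) (isFlatᵇ⇒Flat (mkRaw n E s) A a₃) (≡ᵇ-true⁻ a₄) (isFlatᵇ⇒Flat (mkRaw n E s) B b₃) (≡ᵇ-true⁻ b₄))))

module UnifCorankTwo {F : RawMatroid → Poly} (X : LineExpansion F) where
  open LineExpansion X

  -- The dual is U_{2,n}, whose lines are single points, and there β vanishes.
  coeff-Unif : ∀ k i → coeff (F (Unif (suc k) (suc (suc (suc k))))) i ≡ α (suc (suc (suc k))) i
  coeff-Unif k i = trans (expand (Unif (suc k) n) (Unif-isMatroid {suc k} {n}) (Unif-loopless {suc k} {n} (s≤s z≤n)) (λ A → ∣ A ∣ ⊓ 2) flatLines (flatLines-isCorankTwo (λ {A} → key {A})) i)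
    (trans (cong₂ _-ᶻ_ (cong (λ z → α z i) (SubP.∣⊤∣≡n n)) (ΣL-zero flatLines zeroLine)) (ℤP.+-identityʳ _))
    where
    n = suc (suc (suc k))
    open RankTwo {n} {⊤} {λ A → ∣ A ∣ ⊓ 2} (Unif-isMatroid {2} {n}) (Unif-loopless {2} {n} (s≤s z≤n)) (cong (_⊓ 2) (SubP.∣⊤∣≡n n))
    key : DualRanks (⊤ {n}) (λ A → ∣ A ∣ ⊓ suc k) (λ A → ∣ A ∣ ⊓ 2)
    key {A} s = trans (cong₂ _+_ (ℕP.⊓-comm ∣ A ∣ (suc k)) refl) (trans (lemma ∣ A ∣ ∣ ⊤ {n} ─ A ∣ (trans (ℕP.+-comm ∣ A ∣ _) (trans (∣─∣ s) (SubP.∣⊤∣≡n n)))) refl)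
      where
      lemma : ∀ a t → a + t ≡ n → (suc k ⊓ a) + (∣ ⊤ {n} ∣ ⊓ 2) ≡ a + (t ⊓ 2)
      lemma a t eq with ℕP.≤-total a (suc k)
      ... | inj₁ l rewrite ℕP.m≥n⇒m⊓n≡n l = cong (λ z → a + z) (sym (ℕP.m≥n⇒m⊓n≡n {t} {2} (ℕP.+-cancelˡ-≤ (suc k) 2 t (ℕP.≤-trans (ℕP.≤-reflexive (trans (ℕP.+-comm (suc k) 2) (sym eq))) (ℕP.+-monoˡ-≤ t l)))))
      ... | inj₂ l rewrite ℕP.m≤n⇒m⊓n≡m l = trans (trans (ℕP.+-comm (suc k) 2) (sym eq)) (cong (λ z → a + z) (sym (ℕP.m≤n⇒m⊓n≡m {t} {2} (ℕP.+-cancelˡ-≤ (suc k) t 2 (ℕP.≤-trans (ℕP.+-monoˡ-≤ t l) (ℕP.≤-reflexive (trans eq (ℕP.+-comm 2 (suc k)))))))))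
    zeroLine : ∀ {S} → S ∈ˡ flatLines → β (∣ ⊤ {n} ∣) ∣ S ∣ i ≡ 0ℤ
    zeroLine {S} m = trans (cong (λ z → β (∣ ⊤ {n} ∣) z i) (one ∣ S ∣ (proj₂ (flatLines⁻ m)))) (point _ i)
      where
      one : ∀ k → k ⊓ 2 ≡ 1 → k ≡ 1
      one 1 _ = refl
      one (suc (suc k)) e = case trans (sym (cong (λ z → suc z) (ℕP.⊓-comm (suc k) 1))) e of λ ()

-- Counting by position

ι : Bool → ℕ
ι b = if b then 1 else 0

cnt : ℕ → (ℕ → Bool) → ℕ
cnt zero    p = 0
cnt (suc n) p = ι (p 0) + cnt n (p ∘ suc)

cnt-cong : ∀ n {p q : ℕ → Bool} → (∀ i → i < n → p i ≡ q i) → cnt n p ≡ cnt n q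
cnt-cong zero    h = refl
cnt-cong (suc n) h = cong₂ _+_ (cong ι (h 0 (s≤s z≤n))) (cnt-cong n (λ i l → h (suc i) (s≤s l)))

cnt-++ : ∀ m n p → cnt (m + n) p ≡ cnt m p + cnt n (λ i → p (m + i))
cnt-++ zero    n p = refl
cnt-++ (suc m) n p = trans (cong (λ z → ι (p 0) + z) (cnt-++ m n (p ∘ suc))) (sym (ℕP.+-assoc (ι (p 0)) _ _))

cnt-true : ∀ n {p} → (∀ i → i < n → p i ≡ true) → cnt n p ≡ n
cnt-true zero    h = refl
cnt-true (suc n) h = cong₂ _+_ (cong ι (h 0 (s≤s z≤n))) (cnt-true n (λ i l → h (suc i) (s≤s l)))

cnt-false : ∀ n {p} → (∀ i → i < n → p i ≡ false) → cnt n p ≡ 0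
cnt-false zero    h = refl
cnt-false (suc n) h = cong₂ _+_ (cong ι (h 0 (s≤s z≤n))) (cnt-false n (λ i l → h (suc i) (s≤s l)))

cnt-not : ∀ n p → cnt n p + cnt n (not ∘ p) ≡ n
cnt-not zero    p = refl
cnt-not (suc n) p with p 0
... | true  = cong suc (cnt-not n (p ∘ suc))
... | false = trans (ℕP.+-suc (cnt n (p ∘ suc)) _) (cong suc (cnt-not n (p ∘ suc)))

length-filter-upTo : ∀ n p → length (filterᵇ p (upTo n)) ≡ cnt n p
length-filter-upTo n p = go n id
  where
  go : ∀ n (f : ℕ → ℕ) → length (filterᵇ p (applyUpTo f n)) ≡ cnt n (p ∘ f)
  go zero    f = refl
  go (suc n) f with p (f 0)
  ... | true  = cong suc (go n (f ∘ suc))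
  ... | false = go n (f ∘ suc)

-- Indexed by natural numbers because the edges of the graph are numbered arithmetically; positions
-- beyond the length read as absent.
bit : ∀ {n} → Subset n → ℕ → Bool
bit []      _       = false
bit (x ∷ A) zero    = x
bit (x ∷ A) (suc i) = bit A i

bit-lookup : ∀ {n} (A : Subset n) e → bit A (toℕ e) ≡ lookup A e
bit-lookup (x ∷ A) zero    = refl
bit-lookup (x ∷ A) (suc e) = bit-lookup A e

bit-∩ : ∀ {n} (A B : Subset n) i → bit (A ∩ B) i ≡ bit A i ∧ bit B i
bit-∩ []      []      i       = refl
bit-∩ (x ∷ A) (y ∷ B) zero    = refl
bit-∩ (x ∷ A) (y ∷ B) (suc i) = bit-∩ A B i

bit-⊤─ : ∀ {n} (A : Subset n) i → i < n → bit (⊤ ─ A) i ≡ not (bit A i)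
bit-⊤─ (true ∷ A)  zero    _       = refl
bit-⊤─ (false ∷ A) zero    _       = refl
bit-⊤─ (true ∷ A)  (suc i) (s≤s l) = bit-⊤─ A i l
bit-⊤─ (false ∷ A) (suc i) (s≤s l) = bit-⊤─ A i l

bit-tabulate : ∀ n (f : ℕ → Bool) i → i < n → bit (Vec.tabulate {n = n} (f ∘ toℕ)) i ≡ f i
bit-tabulate (suc n) f zero    _       = refl
bit-tabulate (suc n) f (suc i) (s≤s l) = bit-tabulate n (f ∘ suc) i l

∣∣-cnt : ∀ {n} (A : Subset n) → ∣ A ∣ ≡ cnt n (bit A)
∣∣-cnt []          = refl
∣∣-cnt (true ∷ A)  = cong suc (∣∣-cnt A)
∣∣-cnt (false ∷ A) = ∣∣-cnt A

-- The rank function of three parallel classes: the dual of a theta graph.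
module ThreeClasses (n : ℕ) (col : ℕ → ℕ) (col≤2 : ∀ i → col i ≤ 2) where

  P : ℕ → Subset n
  P c = Vec.tabulate (λ e → col (toℕ e) ≡ᵇ c)

  ∈P⁺ : ∀ {e c} → col (toℕ e) ≡ c → e ∈ P c
  ∈P⁺ {e} h = ∈-lookup _ e (trans (VecP.lookup∘tabulate _ e) (≡ᵇ-true h))

  ∈P⁻ : ∀ {e c} → e ∈ P c → col (toℕ e) ≡ c
  ∈P⁻ {e} m = ≡ᵇ-true⁻ (trans (sym (VecP.lookup∘tabulate _ e)) (lookup-∈ m))

  f : ℕ → Subset n → ℕ
  f c D = ∣ D ∩ P c ∣ ⊓ 1

  ρ : Subset n → ℕ
  ρ D = (f 0 D + f 1 D + f 2 D) ⊓ 2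

  f-mono : ∀ c {A B} → A ⊆ B → f c A ≤ f c B
  f-mono c {A} {B} s = ℕP.⊓-monoˡ-≤ 1 (SubP.p⊆q⇒∣p∣≤∣q∣ (⊆-∩ (λ m → s (SubP.p∩q⊆p A (P c) m)) (SubP.p∩q⊆q A (P c))))

  f-submod : ∀ c A B → f c (A ∪ B) + f c (A ∩ B) ≤ f c A + f c B
  f-submod c A B = ⊓-concave {1} {0} {∣ (A ∪ B) ∩ P c ∣} {∣ (A ∩ B) ∩ P c ∣} (mono (SubP.p∩q⊆p A B)) (mono (SubP.p∩q⊆q A B))
    (ℕP.≤-reflexive (trans (cong₂ (λ X Y → ∣ X ∣ + ∣ Y ∣) (SubP.∩-distribʳ-∪ (P c) A B) inter) (∣∪∣+∣∩∣ (A ∩ P c) (B ∩ P c))))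
    where
    mono : ∀ {X Y} → X ⊆ Y → ∣ X ∩ P c ∣ ≤ ∣ Y ∩ P c ∣
    mono {X} s = SubP.p⊆q⇒∣p∣≤∣q∣ (⊆-∩ (λ m → s (SubP.p∩q⊆p X (P c) m)) (SubP.p∩q⊆q X (P c)))
    inter : (A ∩ B) ∩ P c ≡ (A ∩ P c) ∩ (B ∩ P c)
    inter = ⊆-antisym
      (⊆-∩ (⊆-∩ (λ m → SubP.p∩q⊆p A B (SubP.p∩q⊆p (A ∩ B) (P c) m)) (SubP.p∩q⊆q (A ∩ B) (P c))) (⊆-∩ (λ m → SubP.p∩q⊆q A B (SubP.p∩q⊆p (A ∩ B) (P c) m)) (SubP.p∩q⊆q (A ∩ B) (P c))))
      (⊆-∩ (⊆-∩ (λ m → SubP.p∩q⊆p A (P c) (SubP.p∩q⊆p (A ∩ P c) (B ∩ P c) m)) (λ m → SubP.p∩q⊆p B (P c) (SubP.p∩q⊆q (A ∩ P c) (B ∩ P c) m))) (λ m → SubP.p∩q⊆q A (P c) (SubP.p∩q⊆p (A ∩ P c) (B ∩ P c) m)))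

  ∣∩P∣ : ∀ c D → ∣ D ∩ P c ∣ ≡ cnt n (λ i → bit D i ∧ (col i ≡ᵇ c))
  ∣∩P∣ c D = trans (∣∣-cnt (D ∩ P c)) (cnt-cong n (λ i l → trans (bit-∩ D (P c) i) (cong (bit D i ∧_) (bit-tabulate n (λ i → col i ≡ᵇ c) i l))))

  f-size : ∀ A → f 0 A + f 1 A + f 2 A ≤ ∣ A ∣
  f-size A = ℕP.≤-trans (ℕP.+-mono-≤ (ℕP.+-mono-≤ (ℕP.m⊓n≤m ∣ A ∩ P 0 ∣ 1) (ℕP.m⊓n≤m ∣ A ∩ P 1 ∣ 1)) (ℕP.m⊓n≤m ∣ A ∩ P 2 ∣ 1))
    (ℕP.≤-reflexive (trans (cong₂ _+_ (cong₂ _+_ (∣∩P∣ 0 A) (∣∩P∣ 1 A)) (∣∩P∣ 2 A)) (trans (go n (bit A) col col≤2) (sym (∣∣-cnt A)))))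
    where
    ℕ-interchange₃ : ∀ a b c x y z → ((a + x) + (b + y)) + (c + z) ≡ (a + b + c) + (x + y + z)
    ℕ-interchange₃ = ℕR.solve-∀
    go : ∀ n (p : ℕ → Bool) (col : ℕ → ℕ) → (∀ i → col i ≤ 2) →
         cnt n (λ i → p i ∧ (col i ≡ᵇ 0)) + cnt n (λ i → p i ∧ (col i ≡ᵇ 1)) + cnt n (λ i → p i ∧ (col i ≡ᵇ 2)) ≡ cnt n p
    go zero    p col h = refl
    go (suc n) p col h = trans (ℕ-interchange₃ (ι (p 0 ∧ (col 0 ≡ᵇ 0))) _ _ _ _ _) (cong₂ _+_ (one (p 0) (col 0) (h 0)) (go n (p ∘ suc) (col ∘ suc) (h ∘ suc)))
      where
      one : ∀ b c → c ≤ 2 → ι (b ∧ (c ≡ᵇ 0)) + ι (b ∧ (c ≡ᵇ 1)) + ι (b ∧ (c ≡ᵇ 2)) ≡ ι b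
      one false c _ = refl
      one true  0 _ = refl
      one true  1 _ = refl
      one true  2 _ = refl
      one true  (suc (suc (suc c))) (s≤s (s≤s ()))

  -- Each `f c` is monotone and submodular, hence so is their sum, and truncation at 2 preserves
  -- this by `⊓-concave`.
  ρ-isMatroid : IsMatroid (mkRaw n ⊤ ρ)
  ρ-isMatroid =
    (λ A _ → ℕP.≤-trans (ℕP.m⊓n≤m _ 2) (f-size A)) ,
    (λ A B _ _ s → ℕP.⊓-monoˡ-≤ 2 (mono s)) ,
    (λ A B _ _ → ⊓-concave {2} {0} {f 0 (A ∪ B) + f 1 (A ∪ B) + f 2 (A ∪ B)} (mono (SubP.p∩q⊆p A B)) (mono (SubP.p∩q⊆q A B)) (begin
      (f 0 (A ∪ B) + f 1 (A ∪ B) + f 2 (A ∪ B)) + (f 0 (A ∩ B) + f 1 (A ∩ B) + f 2 (A ∩ B)) ≡⟨ rearrange (f 0 (A ∪ B)) (f 1 (A ∪ B)) (f 2 (A ∪ B)) (f 0 (A ∩ B)) (f 1 (A ∩ B)) (f 2 (A ∩ B)) ⟩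
      (f 0 (A ∪ B) + f 0 (A ∩ B)) + (f 1 (A ∪ B) + f 1 (A ∩ B)) + (f 2 (A ∪ B) + f 2 (A ∩ B)) ≤⟨ ℕP.+-mono-≤ (ℕP.+-mono-≤ (f-submod 0 A B) (f-submod 1 A B)) (f-submod 2 A B) ⟩
      (f 0 A + f 0 B) + (f 1 A + f 1 B) + (f 2 A + f 2 B) ≡⟨ sym (rearrange (f 0 A) (f 1 A) (f 2 A) (f 0 B) (f 1 B) (f 2 B)) ⟩
      (f 0 A + f 1 A + f 2 A) + (f 0 B + f 1 B + f 2 B) ∎))
    where
    open ℕP.≤-Reasoning
    mono : ∀ {A B} → A ⊆ B → f 0 A + f 1 A + f 2 A ≤ f 0 B + f 1 B + f 2 B
    mono s = ℕP.+-mono-≤ (ℕP.+-mono-≤ (f-mono 0 s) (f-mono 1 s)) (f-mono 2 s)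
    rearrange : ∀ a b c x y z → (a + b + c) + (x + y + z) ≡ (a + x) + (b + y) + (c + z)
    rearrange = ℕR.solve-∀

  L : List (Subset n)
  L = P 0 ∷ P 1 ∷ P 2 ∷ []

  class : ∀ e → ∃ λ c → c ≤ 2 × e ∈ P c
  class e = col (toℕ e) , col≤2 _ , ∈P⁺ refl

  hits : ∀ {D e c} → e ∈ D → e ∈ P c → 0 < ∣ D ∩ P c ∣
  hits m m′ = ∣∣-pos (SubP.x∈p∩q⁺ (m , m′))

  within : ∀ {D} c → (∀ c′ → c′ ≤ 2 → c′ ≢ c → ∣ D ∩ P c′ ∣ ≡ 0) → D ⊆ P c
  within {D} c h {e} m with c′ , l , m′ ← class e with c′ ℕP.≟ c
  ... | yes refl = m′
  ... | no  ne   = ⊥-elim (ℕP.<⇒≢ (hits m m′) (sym (h c′ l ne)))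

  not-within : ∀ {D k} c c′ → c ≢ c′ → ∣ D ∩ P c′ ∣ ≡ suc k → ¬ (D ⊆ P c)
  not-within {D} c c′ ne h s with e , m ← nonempty {A = D ∩ P c′} (subst (0 <_) (sym h) (s≤s z≤n)) =
    ne (trans (sym (∈P⁻ (s (SubP.p∩q⊆p D (P c′) m)))) (∈P⁻ (SubP.p∩q⊆q D (P c′) m)))

  ρ-pos : ∀ {D} → 0 < ∣ D ∣ → 1 ≤ ρ D
  ρ-pos {D} p with e , m ← nonempty {A = D} p with c , l , m′ ← class e = ℕP.⊓-glb (go c l (ℕP.⊓-glb (hits m m′) ℕP.≤-refl)) (s≤s z≤n)
    where
    go : ∀ c → c ≤ 2 → 1 ≤ f c D → 1 ≤ f 0 D + f 1 D + f 2 D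
    go 0 _ h = ℕP.≤-trans h (ℕP.≤-trans (ℕP.m≤m+n _ (f 1 D)) (ℕP.m≤m+n _ (f 2 D)))
    go 1 _ h = ℕP.≤-trans h (ℕP.≤-trans (ℕP.m≤n+m _ (f 0 D)) (ℕP.m≤m+n _ (f 2 D)))
    go 2 _ h = ℕP.≤-trans h (ℕP.m≤n+m _ (f 0 D + f 1 D))
    go (suc (suc (suc c))) (s≤s (s≤s ()))

  private
    others : ∀ {D} c → (x : ∀ c′ → c′ ≢ c → c′ ≤ 2 → ∣ D ∩ P c′ ∣ ≡ 0) → D ⊆ P c
    others c x = within c (λ c′ l ne → x c′ ne l)

    length-filter₃ : ∀ (p : Subset n → Bool) x y z {a b c} → p x ≡ a → p y ≡ b → p z ≡ c →
                     length (filterᵇ p (x ∷ y ∷ z ∷ [])) ≡ ι a + (ι b + (ι c + 0))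
    length-filter₃ p x y z refl refl refl = trans (step x (y ∷ z ∷ [])) (cong (λ k → ι (p x) + k) (trans (step y (z ∷ [])) (cong (λ k → ι (p y) + k) (step z []))))
      where
      step : ∀ x xs → length (filterᵇ p (x ∷ xs)) ≡ ι (p x) + length (filterᵇ p xs)
      step x xs with p x
      ... | true  = refl
      ... | false = refl

    ⊓1 : ∀ j → suc j ⊓ 1 ≡ 1
    ⊓1 j = cong suc (ℕP.⊓-zeroʳ j)

  -- Split by the classes that `D` meets: if there is only one, it is the only class containing `D`;
  -- if there are more, no class contains `D` and the rank is 2.
  count : ∀ {D} → 0 < ∣ D ∣ → length (filterᵇ (D ⊆ᵇ_) L) + ρ D ≡ 2
  count {D} p with ∣ D ∩ P 0 ∣ in e₀ | ∣ D ∩ P 1 ∣ in e₁ | ∣ D ∩ P 2 ∣ in e₂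
  ... | zero | zero | zero = ⊥-elim (case nonempty {A = D} p of λ { (e , m) → absurd (class e) m })
    where
    absurd : ∀ {e} → (∃ λ c → c ≤ 2 × e ∈ P c) → e ∈ D → Data.Empty.⊥
    absurd (0 , _ , m′) m = ℕP.<⇒≢ (hits m m′) (sym e₀)
    absurd (1 , _ , m′) m = ℕP.<⇒≢ (hits m m′) (sym e₁)
    absurd (2 , _ , m′) m = ℕP.<⇒≢ (hits m m′) (sym e₂)
    absurd (suc (suc (suc c)) , s≤s (s≤s ()) , _) m
  ... | suc j | zero | zero = cong₂ _+_
    (length-filter₃ (D ⊆ᵇ_) (P 0) (P 1) (P 2)
      (dec-true (D ⊆? P 0) (others 0 λ { 0 ne _ → ⊥-elim (ne refl) ; 1 _ _ → e₁ ; 2 _ _ → e₂ ; (suc (suc (suc _))) _ (s≤s (s≤s ())) }))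
      (dec-false (D ⊆? P 1) (not-within 1 0 (λ ()) e₀)) (dec-false (D ⊆? P 2) (not-within 2 0 (λ ()) e₀)))
    (cong (λ x → (x + 0 + 0) ⊓ 2) (⊓1 j))
  ... | zero | suc j | zero = cong₂ _+_
    (length-filter₃ (D ⊆ᵇ_) (P 0) (P 1) (P 2) (dec-false (D ⊆? P 0) (not-within 0 1 (λ ()) e₁))
      (dec-true (D ⊆? P 1) (others 1 λ { 1 ne _ → ⊥-elim (ne refl) ; 0 _ _ → e₀ ; 2 _ _ → e₂ ; (suc (suc (suc _))) _ (s≤s (s≤s ())) }))
      (dec-false (D ⊆? P 2) (not-within 2 1 (λ ()) e₁)))
    (cong (λ x → (x + 0) ⊓ 2) (⊓1 j))
  ... | zero | zero | suc j = cong₂ _+_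
    (length-filter₃ (D ⊆ᵇ_) (P 0) (P 1) (P 2) (dec-false (D ⊆? P 0) (not-within 0 2 (λ ()) e₂)) (dec-false (D ⊆? P 1) (not-within 1 2 (λ ()) e₂))
      (dec-true (D ⊆? P 2) (others 2 λ { 2 ne _ → ⊥-elim (ne refl) ; 0 _ _ → e₀ ; 1 _ _ → e₁ ; (suc (suc (suc _))) _ (s≤s (s≤s ())) })))
    (cong (λ x → x ⊓ 2) (⊓1 j))
  ... | suc j | suc k | zero = cong₂ _+_
    (length-filter₃ (D ⊆ᵇ_) (P 0) (P 1) (P 2) (dec-false (D ⊆? P 0) (not-within 0 1 (λ ()) e₁)) (dec-false (D ⊆? P 1) (not-within 1 0 (λ ()) e₀)) (dec-false (D ⊆? P 2) (not-within 2 0 (λ ()) e₀)))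
    (cong₂ (λ x y → (x + y + 0) ⊓ 2) (⊓1 j) (⊓1 k))
  ... | suc j | zero | suc k = cong₂ _+_
    (length-filter₃ (D ⊆ᵇ_) (P 0) (P 1) (P 2) (dec-false (D ⊆? P 0) (not-within 0 2 (λ ()) e₂)) (dec-false (D ⊆? P 1) (not-within 1 0 (λ ()) e₀)) (dec-false (D ⊆? P 2) (not-within 2 0 (λ ()) e₀)))
    (cong₂ (λ x y → (x + 0 + y) ⊓ 2) (⊓1 j) (⊓1 k))
  ... | zero | suc j | suc k = cong₂ _+_
    (length-filter₃ (D ⊆ᵇ_) (P 0) (P 1) (P 2) (dec-false (D ⊆? P 0) (not-within 0 1 (λ ()) e₁)) (dec-false (D ⊆? P 1) (not-within 1 2 (λ ()) e₂)) (dec-false (D ⊆? P 2) (not-within 2 1 (λ ()) e₁)))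
    (cong₂ (λ x y → (x + y) ⊓ 2) (⊓1 j) (⊓1 k))
  ... | suc j | suc k | suc l = cong₂ _+_
    (length-filter₃ (D ⊆ᵇ_) (P 0) (P 1) (P 2) (dec-false (D ⊆? P 0) (not-within 0 1 (λ ()) e₁)) (dec-false (D ⊆? P 1) (not-within 1 2 (λ ()) e₂)) (dec-false (D ⊆? P 2) (not-within 2 1 (λ ()) e₁)))
    (trans (cong₂ (λ x y → (x + y + suc l ⊓ 1) ⊓ 2) (⊓1 j) (⊓1 k)) refl)

-- The theta graph of C a b

∨-true⁻ : ∀ {a b} → (a ∨ b) ≡ true → a ≡ true ⊎ b ≡ true
∨-true⁻ {true}  h = inj₁ refl
∨-true⁻ {false} h = inj₂ h

∨-trueˡ : ∀ {a b} → a ≡ true → (a ∨ b) ≡ true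
∨-trueˡ refl = refl

∨-trueʳ : ∀ {a b} → b ≡ true → (a ∨ b) ≡ true
∨-trueʳ {true}  _ = refl
∨-trueʳ {false} h = h

any-tabulate⁺ : ∀ {a} {A : Set a} {n} (p : A → Bool) (f : Fin n → A) i → p (f i) ≡ true → any p (List.tabulate f) ≡ true
any-tabulate⁺ p f zero    h = ∨-trueˡ h
any-tabulate⁺ p f (suc i) h = ∨-trueʳ {p (f zero)} (any-tabulate⁺ p (f ∘ suc) i h)

any-tabulate⁻ : ∀ {a} {A : Set a} {n} (p : A → Bool) (f : Fin n → A) → any p (List.tabulate f) ≡ true → ∃ λ i → p (f i) ≡ true
any-tabulate⁻ {n = suc n} p f h with ∨-true⁻ {p (f zero)} h
... | inj₁ e = zero , e
... | inj₂ e with i , q ← any-tabulate⁻ p (f ∘ suc) e = suc i , q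

any-applyUpTo⁺ : ∀ (p : ℕ → Bool) f n {i} → i < n → p (f i) ≡ true → any p (applyUpTo f n) ≡ true
any-applyUpTo⁺ p f (suc n) {zero}  _       h = ∨-trueˡ h
any-applyUpTo⁺ p f (suc n) {suc i} (s≤s l) h = ∨-trueʳ {p (f 0)} (any-applyUpTo⁺ p (f ∘ suc) n l h)

any-applyUpTo⁻ : ∀ (p : ℕ → Bool) f n → any p (applyUpTo f n) ≡ true → ∃ λ i → i < n × p (f i) ≡ true
any-applyUpTo⁻ p f (suc n) h with ∨-true⁻ {p (f 0)} h
... | inj₁ e = 0 , s≤s z≤n , e
... | inj₂ e with i , l , q ← any-applyUpTo⁻ p (f ∘ suc) n e = suc i , s≤s l , q

-- A labelling that is constant along edges and sends every vertex other than the least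
-- one of its component to a smaller vertex certifies the number of components.
module Labelling (V m : ℕ) (ends : Fin m → ℕ × ℕ) (A : Subset m) where
  open Graphic V m ends A

  reach-step : ∀ {k u v w} e → reach k u v ≡ true → lookup A e ≡ true → ends e ≡ (v , w) → reach (suc k) u w ≡ true
  reach-step {k} {u} {v} {w} e h m eq = ∨-trueʳ {reach k u w} (any-tabulate⁺ _ id e (cong₂ _∧_ m (∨-trueˡ (cong₂ _∧_
    (subst (λ x → reach k u (proj₁ x) ≡ true) (sym eq) h) (≡ᵇ-true (cong proj₂ eq))))))

  reach-step⁻ : ∀ {k u v w} e → reach k u v ≡ true → lookup A e ≡ true → ends e ≡ (w , v) → reach (suc k) u w ≡ true
  reach-step⁻ {k} {u} {v} {w} e h m eq = ∨-trueʳ {reach k u w} (any-tabulate⁺ _ id e (cong₂ _∧_ m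
    (∨-trueʳ {reach k u (proj₁ (ends e)) ∧ (proj₂ (ends e) ≡ᵇ w)} (cong₂ _∧_
      (subst (λ x → reach k u (proj₂ x) ≡ true) (sym eq) h) (≡ᵇ-true (cong proj₁ eq))))))

  reach-mono : ∀ {j k u v} → j ≤ k → reach j u v ≡ true → reach k u v ≡ true
  reach-mono {j} {k} {u} {v} l h = subst (λ z → reach z u v ≡ true) (ℕP.m∸n+n≡m l) (go (k ∸ j))
    where
    go : ∀ d → reach (d + j) u v ≡ true
    go zero    = h
    go (suc d) = ∨-trueˡ (go d)

  module _ (lab : ℕ → ℕ) (lab≤ : ∀ v → v < V → lab v ≤ v)
           (lab-edge : ∀ e → lookup A e ≡ true → lab (proj₁ (ends e)) ≡ lab (proj₂ (ends e)))
           (lab-reach : ∀ v → v < V → lab v ≢ v → ∃ λ u → u < v × reach V u v ≡ true) where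

    reach-lab : ∀ k {u v} → reach k u v ≡ true → lab u ≡ lab v
    reach-lab zero    h = cong lab (≡ᵇ-true⁻ h)
    reach-lab (suc k) {u} {v} h with ∨-true⁻ {reach k u v} h
    ... | inj₁ h′ = reach-lab k h′
    ... | inj₂ h′ with e , q ← any-tabulate⁻ _ id h′ with me , q ← ∧-true⁻ {memᵇ e A} q with ∨-true⁻ {reach k u (proj₁ (ends e)) ∧ (proj₂ (ends e) ≡ᵇ v)} q
    ...   | inj₁ q₁ with r , w ← ∧-true⁻ {reach k u (proj₁ (ends e))} q₁ = trans (reach-lab k r) (trans (lab-edge e me) (cong lab (≡ᵇ-true⁻ w)))
    ...   | inj₂ q₂ with r , w ← ∧-true⁻ {reach k u (proj₂ (ends e))} q₂ = trans (reach-lab k r) (trans (sym (lab-edge e me)) (cong lab (≡ᵇ-true⁻ w)))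

    -- A smaller `u` that reaches `v` has the same label, so `lab v ≤ u < v`; conversely `lab-reach`
    -- yields such a `u` whenever `lab v` differs from `v`. The least vertices of the components are
    -- thus the fixed points of `lab`.
    components≡ : components ≡ cnt V (λ v → lab v ≡ᵇ v)
    components≡ = trans (length-filter-upTo V _) (cnt-cong V root)
      where
      root : ∀ v → v < V → not (any (λ u → reach V u v) (upTo v)) ≡ (lab v ≡ᵇ v)
      root v v<V with any (λ u → reach V u v) (upTo v) in eq
      ... | true with u , u<v , r ← any-applyUpTo⁻ (λ u → reach V u v) id v eq =
            sym (≡ᵇ-false λ e → ℕP.<⇒≱ u<v (subst (_≤ u) (trans (reach-lab V r) e) (lab≤ u (ℕP.<-trans u<v v<V))))
      ... | false with lab v ≡ᵇ v in eq′
      ...   | true  = refl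
      ...   | false with u , u<v , r ← lab-reach v v<V (≡ᵇ-false⁻ eq′) =
              sym (trans (sym eq) (any-applyUpTo⁺ (λ u → reach V u v) id v u<v r))

path : ℕ → ℕ → ℕ → ℕ
path base ℓ zero    = 1
path base ℓ (suc t) = if suc t ≡ᵇ ℓ then 0 else base + t

path-inner : ∀ base ℓ {t} → suc t < ℓ → path base ℓ (suc t) ≡ base + t
path-inner base ℓ l = if-false (≡ᵇ-false (ℕP.<⇒≢ l))

path-end : ∀ base r → path base (suc r) (suc r) ≡ 0
path-end base r = if-true (≡ᵇ-true {suc r} refl)

-- A path 1 = p₀, p₁, …, p_ℓ = 0 with ℓ = r + 1 edges, whose inner vertices are
-- base, base + 1, …; y tells which edges are present, and L₁ is the label of 1.
module PathLabels (base r : ℕ) (2≤base : 2 ≤ base) (y : ℕ → Bool) where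

  fullFrom : ℕ → ℕ → Bool
  fullFrom zero    k = true
  fullFrom (suc j) k = y k ∧ fullFrom j (suc k)

  missing : ℕ → ℕ → ℕ
  missing zero    k = 0
  missing (suc j) k = ι (not (y k)) + missing j (suc k)

  full⇔missing : ∀ j k → fullFrom j k ≡ (missing j k ≡ᵇ 0)
  full⇔missing zero    k = refl
  full⇔missing (suc j) k with y k
  ... | true  = full⇔missing j (suc k)
  ... | false = refl

  missing-cnt : ∀ j k → missing j k ≡ cnt j (λ i → not (y (k + i)))
  missing-cnt zero    k = refl
  missing-cnt (suc j) k = cong₂ _+_ (cong (λ z → ι (not (y z))) (sym (ℕP.+-identityʳ k)))
    (trans (missing-cnt j (suc k)) (cnt-cong j (λ i _ → cong (λ z → not (y z)) (sym (ℕP.+-suc k i)))))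

  -- An inner vertex is the least of its component when the edge before it is absent and the rest of
  -- the path does not lead to 0. This counts every absent edge but the last.
  roots : ℕ → ℕ → ℕ
  roots zero    k = 0
  roots (suc j) k = ι (not (fullFrom j (suc k)) ∧ not (y k)) + roots j (suc k)

  roots≡ : ∀ j k → roots j k ≡ missing j k ∸ 1
  roots≡ zero    k = refl
  roots≡ (suc j) k rewrite full⇔missing j (suc k) | roots≡ j (suc k) with missing j (suc k)
  ... | suc c = sym (ℕP.+-∸-assoc (ι (not (y k))) (s≤s z≤n))
  ... | zero with y k
  ...   | true  = refl
  ...   | false = refl

  -- The extra summand of `roots (suc j)` is zero: nothing is left after the last edge, so the path
  -- from there is complete.
  roots-cnt : ∀ j k → cnt j (λ t → not (fullFrom (j ∸ t) (suc (k + t))) ∧ not (y (k + t))) ≡ roots (suc j) k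
  roots-cnt zero    k = refl
  roots-cnt (suc j) k = cong₂ _+_ (cong (λ z → ι (not (fullFrom (suc j) (suc z)) ∧ not (y z))) (ℕP.+-identityʳ k))
    (trans (cnt-cong j (λ t _ → cong (λ z → not (fullFrom (j ∸ t) (suc z)) ∧ not (y z)) (ℕP.+-suc k t))) (roots-cnt j (suc k)))

  module _ (L₁ : ℕ) (L₁≤1 : L₁ ≤ 1) (L₁-full : fullFrom (suc r) 0 ≡ true → L₁ ≡ 0) where

    -- Meant as the least vertex in the component of p_k. The rest of the path is tested before the
    -- preceding edge because it leads to 0, the smallest vertex; `r ∸ k` edges follow p_(k+1).
    lbl : ℕ → ℕ
    lbl zero    = L₁
    lbl (suc k) = if fullFrom (r ∸ k) (suc k) then 0 else if y k then lbl k else base + k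

    full-suc : ∀ {k} → k < suc r → fullFrom (suc r ∸ k) k ≡ (y k ∧ fullFrom (r ∸ k) (suc k))
    full-suc {k} (s≤s l) = cong (λ z → fullFrom z k) (ℕP.+-∸-assoc 1 l)

    lbl-full : ∀ k → fullFrom (suc r ∸ k) k ≡ true → lbl k ≡ 0
    lbl-full zero    h = L₁-full h
    lbl-full (suc k) h = if-true h

    lbl-edge : ∀ {k} → k < suc r → y k ≡ true → lbl k ≡ lbl (suc k)
    lbl-edge {k} l h with fullFrom (r ∸ k) (suc k) in eq
    ... | true  = lbl-full k (trans (full-suc l) (cong₂ _∧_ h eq))
    ... | false = sym (if-true h)

    lbl< : ∀ k → lbl k < base + k
    lbl< zero = ℕP.≤-trans (s≤s L₁≤1) (ℕP.≤-trans 2≤base (ℕP.m≤m+n base 0))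
    lbl< (suc k) with fullFrom (r ∸ k) (suc k) | y k
    ... | true  | _     = ℕP.≤-trans (s≤s z≤n) (ℕP.≤-trans 2≤base (ℕP.m≤m+n base (suc k)))
    ... | false | true  = ℕP.<-trans (lbl< k) (ℕP.+-monoʳ-< base (ℕP.n<1+n k))
    ... | false | false = ℕP.+-monoʳ-< base (ℕP.n<1+n k)

    lbl-root : ∀ k → (lbl (suc k) ≡ᵇ base + k) ≡ (not (fullFrom (r ∸ k) (suc k)) ∧ not (y k))
    lbl-root k with fullFrom (r ∸ k) (suc k) | y k
    ... | true  | _     = ≡ᵇ-false {0} (ℕP.<⇒≢ (ℕP.≤-trans (s≤s z≤n) (ℕP.≤-trans 2≤base (ℕP.m≤m+n base k))))
    ... | false | true  = ≡ᵇ-false (ℕP.<⇒≢ (lbl< k))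
    ... | false | false = ≡ᵇ-true {base + k} refl

    inner-roots : cnt r (λ t → lbl (suc t) ≡ᵇ base + t) ≡ missing (suc r) 0 ∸ 1
    inner-roots = trans (cnt-cong r (λ t _ → lbl-root t)) (trans (roots-cnt r 0) (roots≡ (suc r) 0))

    module Reach (V m : ℕ) (ends : Fin m → ℕ × ℕ) (A : Subset m) (r<V : r < V)
      (edges : ∀ t → t < suc r → ∃ λ e → lookup A e ≡ y t × ends e ≡ (path base (suc r) t , path base (suc r) (suc t))) where
      open Graphic V m ends A using (reach)
      open Labelling V m ends A

      reach-full : ∀ j k → k + j ≡ suc r → fullFrom j k ≡ true → reach j 0 (path base (suc r) k) ≡ true
      reach-full zero    k eq h = ≡ᵇ-true {0} (trans (sym (path-end base r)) (cong (path base (suc r)) (trans (sym eq) (ℕP.+-identityʳ k))))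
      reach-full (suc j) k eq h with a , b ← ∧-true⁻ {y k} h with e , me , en ← edges k (subst (suc k ≤_) eq (ℕP.≤-trans (ℕP.≤-reflexive (ℕP.+-comm 1 k)) (ℕP.+-monoʳ-≤ k (s≤s z≤n)))) =
        reach-step⁻ {j} {0} e (reach-full j (suc k) (trans (sym (ℕP.+-suc k j)) eq) b) (trans me a) en

      -- The smaller vertex is 0, joined by the rest of the path, or the predecessor on the path,
      -- one step away.
      lbl-reach : ∀ t → t < r → lbl (suc t) ≢ base + t → ∃ λ u → u < base + t × reach V u (base + t) ≡ true
      lbl-reach t t<r ne with fullFrom (r ∸ t) (suc t) in f | y t in yt
      ... | true  | _ = 0 , ℕP.≤-trans (s≤s z≤n) (ℕP.≤-trans 2≤base (ℕP.m≤m+n base t)) ,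
        subst (λ z → reach V 0 z ≡ true) (path-inner base (suc r) (s≤s t<r))
          (reach-mono {r ∸ t} (ℕP.≤-trans (ℕP.m∸n≤m r t) (ℕP.<⇒≤ r<V)) (reach-full (r ∸ t) (suc t) (cong suc (ℕP.m+[n∸m]≡n (ℕP.<⇒≤ t<r))) f))
      ... | false | false = ⊥-elim (ne refl)
      ... | false | true with e , me , en ← edges t (ℕP.<-trans t<r (ℕP.n<1+n r)) = path base (suc r) t , below t t<r ,
        reach-mono {1} (ℕP.≤-trans (s≤s z≤n) r<V) (reach-step {0} {path base (suc r) t} e (≡ᵇ-true {path base (suc r) t} refl) (trans me yt)
          (trans en (cong (path base (suc r) t ,_) (path-inner base (suc r) (s≤s t<r)))))
        where
        below : ∀ t → t < r → path base (suc r) t < base + t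
        below zero    _ = ℕP.≤-trans 2≤base (ℕP.m≤m+n base 0)
        below (suc t) l = subst (_< base + suc t) (sym (path-inner base (suc r) (ℕP.<-trans l (ℕP.n<1+n r)))) (ℕP.+-monoʳ-< base (ℕP.n<1+n t))

≤ᵇ-true : ∀ {i j} → i ≤ j → (i ≤ᵇ j) ≡ true
≤ᵇ-true {i} {j} l with i ≤ᵇ j in eq
... | true  = refl
... | false = ⊥-elim (subst T eq (ℕP.≤⇒≤ᵇ l))

≤ᵇ-false : ∀ {i j} → j < i → (i ≤ᵇ j) ≡ false
≤ᵇ-false {i} {j} l with i ≤ᵇ j in eq
... | false = refl
... | true  = ⊥-elim (ℕP.<⇒≱ l (ℕP.≤ᵇ⇒≤ i j (subst T (sym eq) tt)))

module Theta (a₀ b₀ : ℕ) where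
  a b ℓ₁ ℓ₂ m V : ℕ
  a  = suc (suc a₀)
  b  = suc (suc b₀)
  ℓ₁ = suc a₀
  ℓ₂ = suc b₀
  m  = a + b ∸ 1
  V  = a + b ∸ 2

  m≡ : m ≡ suc (ℓ₁ + ℓ₂)
  m≡ = cong suc (ℕP.+-suc a₀ ℓ₂)

  V≡ : V ≡ suc (suc (a₀ + b₀))
  V≡ = trans (ℕP.+-suc a₀ (suc b₀)) (cong suc (ℕP.+-suc a₀ b₀))

  ends-0 : ∀ e → toℕ e ≡ 0 → cEnds a b e ≡ (0 , 1)
  ends-0 e h rewrite h = refl

  ends-1 : ∀ e t → toℕ e ≡ suc t → t < ℓ₁ → cEnds a b e ≡ (path 2 ℓ₁ t , path 2 ℓ₁ (suc t))
  ends-1 e zero    h l rewrite h = refl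
  ends-1 e (suc t) h l rewrite h = if-true (≤ᵇ-true l)

  ends-2 : ∀ e s → toℕ e ≡ suc (ℓ₁ + s) → cEnds a b e ≡ (path a ℓ₂ s , path a ℓ₂ (suc s))
  ends-2 e zero h rewrite h | ℕP.m+n∸m≡n a₀ zero | trans (ℕP.+-∸-assoc 1 (ℕP.m≤m+n a₀ zero)) (cong suc (ℕP.m+n∸m≡n a₀ zero)) =
    if-false (≤ᵇ-false (s≤s (ℕP.m≤m+n (suc a₀) zero)))
  ends-2 e (suc s) h rewrite h | ℕP.m+n∸m≡n a₀ (suc s) | trans (ℕP.+-∸-assoc 1 (ℕP.m≤m+n a₀ (suc s))) (cong suc (ℕP.m+n∸m≡n a₀ (suc s))) =
    if-false (≤ᵇ-false (s≤s (ℕP.m≤m+n (suc a₀) (suc s))))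

  module Rank (A : Subset m) where
    open Graphic V m (cEnds a b) A using (components; reach)
    open Labelling V m (cEnds a b) A

    y₁ y₂ : ℕ → Bool
    y₁ t = bit A (suc t)
    y₂ s = bit A (suc (ℓ₁ + s))

    module P₁ = PathLabels 2 a₀ (s≤s (s≤s z≤n)) y₁
    module P₂ = PathLabels a b₀ (s≤s (s≤s z≤n)) y₂

    -- Vertex 1 belongs to the component of 0 exactly when one of the three arcs of the theta graph
    -- is complete.
    joined : Bool
    joined = bit A 0 ∨ P₁.fullFrom ℓ₁ 0 ∨ P₂.fullFrom ℓ₂ 0

    L₁ : ℕ
    L₁ = if joined then 0 else 1

    L₁≤1 : L₁ ≤ 1
    L₁≤1 with joined
    ... | true  = z≤n
    ... | false = s≤s z≤n

    full₁ : P₁.fullFrom ℓ₁ 0 ≡ true → L₁ ≡ 0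
    full₁ h = if-true (∨-trueʳ {bit A 0} (∨-trueˡ h))

    full₂ : P₂.fullFrom ℓ₂ 0 ≡ true → L₁ ≡ 0
    full₂ h = if-true (∨-trueʳ {bit A 0} (∨-trueʳ {P₁.fullFrom ℓ₁ 0} h))

    lbl₁ lbl₂ : ℕ → ℕ
    lbl₁ = P₁.lbl L₁ L₁≤1 full₁
    lbl₂ = P₂.lbl L₁ L₁≤1 full₂

    lab : ℕ → ℕ
    lab 0             = 0
    lab 1             = L₁
    lab (suc (suc t)) = if suc t ≤ᵇ a₀ then lbl₁ (suc t) else lbl₂ (suc (t ∸ a₀))

    lab-1 : ∀ {t} → t < a₀ → lab (2 + t) ≡ lbl₁ (suc t)
    lab-1 l = if-true (≤ᵇ-true l)

    lab-2 : ∀ s → lab (a + s) ≡ lbl₂ (suc s)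
    lab-2 s = trans (if-false (≤ᵇ-false (s≤s (ℕP.m≤m+n a₀ s)))) (cong (λ z → lbl₂ (suc z)) (ℕP.m+n∸m≡n a₀ s))

    lab-path₁ : ∀ k → k ≤ ℓ₁ → lab (path 2 ℓ₁ k) ≡ lbl₁ k
    lab-path₁ zero    _ = refl
    lab-path₁ (suc t) (s≤s l) with ℕP.m≤n⇒m<n∨m≡n l
    ... | inj₁ t<a₀ = trans (cong lab (path-inner 2 ℓ₁ (s≤s t<a₀))) (lab-1 t<a₀)
    ... | inj₂ refl = trans (cong lab (path-end 2 t)) (sym (P₁.lbl-full L₁ L₁≤1 full₁ (suc t) (cong (λ z → P₁.fullFrom z (suc t)) (ℕP.n∸n≡0 t))))

    lab-path₂ : ∀ k → k ≤ ℓ₂ → lab (path a ℓ₂ k) ≡ lbl₂ k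
    lab-path₂ zero    _ = refl
    lab-path₂ (suc s) (s≤s l) with ℕP.m≤n⇒m<n∨m≡n l
    ... | inj₁ s<b₀ = trans (cong lab (path-inner a ℓ₂ (s≤s s<b₀))) (lab-2 s)
    ... | inj₂ refl = trans (cong lab (path-end a s)) (sym (P₂.lbl-full L₁ L₁≤1 full₂ (suc s) (cong (λ z → P₂.fullFrom z (suc s)) (ℕP.n∸n≡0 s))))

    edge-cases : ∀ e → toℕ e ≡ 0 ⊎ (∃ λ t → toℕ e ≡ suc t × t < ℓ₁) ⊎ (∃ λ s → toℕ e ≡ suc (ℓ₁ + s) × s < ℓ₂)
    edge-cases e = go (toℕ e) (subst (toℕ e <_) m≡ (FinP.toℕ<n e))
      where
      go : ∀ i → i < suc (ℓ₁ + ℓ₂) → i ≡ 0 ⊎ (∃ λ t → i ≡ suc t × t < ℓ₁) ⊎ (∃ λ s → i ≡ suc (ℓ₁ + s) × s < ℓ₂)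
      go zero    _ = inj₁ refl
      go (suc i) (s≤s l) with ℕP.≤-<-connex ℓ₁ i
      ... | inj₂ i<ℓ₁ = inj₂ (inj₁ (i , refl , i<ℓ₁))
      ... | inj₁ ℓ₁≤i = inj₂ (inj₂ (i ∸ ℓ₁ , cong suc (sym (ℕP.m+[n∸m]≡n ℓ₁≤i)) ,
              ℕP.+-cancelˡ-< ℓ₁ _ _ (subst (_< ℓ₁ + ℓ₂) (sym (ℕP.m+[n∸m]≡n ℓ₁≤i)) l)))

    lab-edge : ∀ e → lookup A e ≡ true → lab (proj₁ (cEnds a b e)) ≡ lab (proj₂ (cEnds a b e))
    lab-edge e h with edge-cases e
    ... | inj₁ z = trans (cong (lab ∘ proj₁) (ends-0 e z)) (sym (trans (cong (lab ∘ proj₂) (ends-0 e z)) (if-true (∨-trueˡ (trans (cong (bit A) (sym z)) (trans (bit-lookup A e) h))))))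
    ... | inj₂ (inj₁ (t , z , l)) = trans (cong (lab ∘ proj₁) (ends-1 e t z l)) (trans (lab-path₁ t (ℕP.<⇒≤ l))
            (trans (P₁.lbl-edge L₁ L₁≤1 full₁ l (trans (cong (bit A) (sym z)) (trans (bit-lookup A e) h)))
              (sym (trans (cong (lab ∘ proj₂) (ends-1 e t z l)) (lab-path₁ (suc t) l)))))
    ... | inj₂ (inj₂ (s , z , l)) = trans (cong (lab ∘ proj₁) (ends-2 e s z)) (trans (lab-path₂ s (ℕP.<⇒≤ l))
            (trans (P₂.lbl-edge L₁ L₁≤1 full₂ l (trans (cong (bit A) (sym z)) (trans (bit-lookup A e) h)))
              (sym (trans (cong (lab ∘ proj₂) (ends-2 e s z)) (lab-path₂ (suc s) l)))))

    edge-at : ∀ i → i < m → ∃ λ e → toℕ e ≡ i × lookup A e ≡ bit A i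
    edge-at i l = fromℕ< l , FinP.toℕ-fromℕ< l , trans (sym (bit-lookup A (fromℕ< l))) (cong (bit A) (FinP.toℕ-fromℕ< l))

    edges₁ : ∀ t → t < ℓ₁ → ∃ λ e → lookup A e ≡ y₁ t × cEnds a b e ≡ (path 2 ℓ₁ t , path 2 ℓ₁ (suc t))
    edges₁ t l with e , i , h ← edge-at (suc t) (subst (suc t <_) (sym m≡) (s≤s (ℕP.≤-trans l (ℕP.m≤m+n ℓ₁ ℓ₂)))) = e , h , ends-1 e t i l

    edges₂ : ∀ s → s < ℓ₂ → ∃ λ e → lookup A e ≡ y₂ s × cEnds a b e ≡ (path a ℓ₂ s , path a ℓ₂ (suc s))
    edges₂ s l with e , i , h ← edge-at (suc (ℓ₁ + s)) (subst (suc (ℓ₁ + s) <_) (sym m≡) (s≤s (ℕP.+-monoʳ-< ℓ₁ l))) = e , h , ends-2 e s i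

    a₀<V : a₀ < V
    a₀<V = subst (a₀ <_) (sym V≡) (s≤s (ℕP.m≤n⇒m≤1+n (ℕP.m≤m+n a₀ b₀)))

    b₀<V : b₀ < V
    b₀<V = subst (b₀ <_) (sym V≡) (s≤s (ℕP.m≤n⇒m≤1+n (ℕP.m≤n+m b₀ a₀)))

    module R₁ = P₁.Reach L₁ L₁≤1 full₁ V m (cEnds a b) A a₀<V edges₁
    module R₂ = P₂.Reach L₁ L₁≤1 full₂ V m (cEnds a b) A b₀<V edges₂

    vertex-cases : ∀ v → v < V → v ≡ 0 ⊎ v ≡ 1 ⊎ (∃ λ t → v ≡ 2 + t × t < a₀) ⊎ (∃ λ s → v ≡ a + s × s < b₀)
    vertex-cases v l = go v (subst (v <_) V≡ l)
      where
      go : ∀ v → v < suc (suc (a₀ + b₀)) → v ≡ 0 ⊎ v ≡ 1 ⊎ (∃ λ t → v ≡ 2 + t × t < a₀) ⊎ (∃ λ s → v ≡ a + s × s < b₀)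
      go 0 _ = inj₁ refl
      go 1 _ = inj₂ (inj₁ refl)
      go (suc (suc t)) (s≤s (s≤s l)) with ℕP.≤-<-connex a₀ t
      ... | inj₂ t<a₀ = inj₂ (inj₂ (inj₁ (t , refl , t<a₀)))
      ... | inj₁ a₀≤t = inj₂ (inj₂ (inj₂ (t ∸ a₀ , cong (λ z → suc (suc z)) (sym (ℕP.m+[n∸m]≡n a₀≤t)) ,
              ℕP.+-cancelˡ-< a₀ _ _ (subst (_< a₀ + b₀) (sym (ℕP.m+[n∸m]≡n a₀≤t)) l))))

    lab≤ : ∀ v → v < V → lab v ≤ v
    lab≤ v l with vertex-cases v l
    ... | inj₁ refl = z≤n
    ... | inj₂ (inj₁ refl) = L₁≤1
    ... | inj₂ (inj₂ (inj₁ (t , refl , t<a₀))) = subst (_≤ 2 + t) (sym (lab-1 t<a₀)) (ℕP.≤-pred (subst (lbl₁ (suc t) <_) (ℕP.+-suc 2 t) (P₁.lbl< L₁ L₁≤1 full₁ (suc t))))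
    ... | inj₂ (inj₂ (inj₂ (s , refl , _))) = subst (_≤ a + s) (sym (lab-2 s)) (ℕP.≤-pred (subst (lbl₂ (suc s) <_) (ℕP.+-suc a s) (P₂.lbl< L₁ L₁≤1 full₂ (suc s))))

    lab-reach : ∀ v → v < V → lab v ≢ v → ∃ λ u → u < v × reach V u v ≡ true
    lab-reach v l ne with vertex-cases v l
    ... | inj₁ refl = ⊥-elim (ne refl)
    ... | inj₂ (inj₂ (inj₁ (t , refl , t<a₀))) = R₁.lbl-reach t t<a₀ (λ h → ne (trans (lab-1 t<a₀) h))
    ... | inj₂ (inj₂ (inj₂ (s , refl , s<b₀))) = R₂.lbl-reach s s<b₀ (λ h → ne (trans (lab-2 s) h))
    ... | inj₂ (inj₁ refl) = 0 , s≤s z≤n , reach-1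
      where
      joined-true : joined ≡ true
      joined-true with joined
      ... | true  = refl
      ... | false = ⊥-elim (ne refl)
      reach-1 : reach V 0 1 ≡ true
      reach-1 with ∨-true⁻ {bit A 0} joined-true
      ... | inj₁ h with e , i , h′ ← edge-at 0 (subst (0 <_) (sym m≡) (s≤s z≤n)) =
            reach-mono {1} (ℕP.≤-trans (s≤s z≤n) a₀<V) (reach-step {0} {0} e refl (trans h′ h) (ends-0 e i))
      ... | inj₂ h with ∨-true⁻ {P₁.fullFrom ℓ₁ 0} h
      ...   | inj₁ h₁ = reach-mono {ℓ₁} a₀<V (R₁.reach-full ℓ₁ 0 refl h₁)
      ...   | inj₂ h₂ = reach-mono {ℓ₂} b₀<V (R₂.reach-full ℓ₂ 0 refl h₂)

    d₀ d₁ d₂ : ℕ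
    d₀ = ι (not (bit A 0))
    d₁ = P₁.missing ℓ₁ 0
    d₂ = P₂.missing ℓ₂ 0

    -- Vertex 0 is always a root, vertex 1 is one unless `joined` holds, and each path has an inner
    -- root for every absent edge but the last.
    components-count : components ≡ suc (ι (L₁ ≡ᵇ 1) + ((d₁ ∸ 1) + (d₂ ∸ 1)))
    components-count = begin
      components ≡⟨ components≡ lab lab≤ lab-edge lab-reach ⟩
      cnt V (λ v → lab v ≡ᵇ v) ≡⟨ cong (λ z → cnt z (λ v → lab v ≡ᵇ v)) V≡ ⟩
      suc (ι (L₁ ≡ᵇ 1) + cnt (a₀ + b₀) (λ t → lab (2 + t) ≡ᵇ 2 + t)) ≡⟨ cong (λ z → suc (ι (L₁ ≡ᵇ 1) + z)) (trans (cnt-++ a₀ b₀ _) (cong₂ _+_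
          (trans (cnt-cong a₀ (λ t l → cong (_≡ᵇ 2 + t) (lab-1 l))) (P₁.inner-roots L₁ L₁≤1 full₁))
          (trans (cnt-cong b₀ (λ s _ → cong (_≡ᵇ a + s) (lab-2 s))) (P₂.inner-roots L₁ L₁≤1 full₂)))) ⟩
      suc (ι (L₁ ≡ᵇ 1) + ((d₁ ∸ 1) + (d₂ ∸ 1))) ∎
      where open ≡-Reasoning

  col : ℕ → ℕ
  col zero    = 0
  col (suc j) = if suc j ≤ᵇ ℓ₁ then 1 else 2

  col≤2 : ∀ i → col i ≤ 2
  col≤2 zero = z≤n
  col≤2 (suc j) with suc j ≤ᵇ ℓ₁
  ... | true  = s≤s z≤n
  ... | false = s≤s (s≤s z≤n)

  open ThreeClasses m col col≤2 public

  col-1 : ∀ t → t < ℓ₁ → col (suc t) ≡ 1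
  col-1 t l = if-true (≤ᵇ-true l)

  col-2 : ∀ s → col (suc (ℓ₁ + s)) ≡ 2
  col-2 s = if-false (≤ᵇ-false (s≤s (ℕP.m≤m+n ℓ₁ s)))

  cnt-split : ∀ (p : ℕ → Bool) → cnt m p ≡ ι (p 0) + (cnt ℓ₁ (λ t → p (suc t)) + cnt ℓ₂ (λ s → p (suc (ℓ₁ + s))))
  cnt-split p = trans (cong (λ z → cnt z p) m≡) (cong (λ z → ι (p 0) + z) (cnt-++ ℓ₁ ℓ₂ (p ∘ suc)))

  cnt-class : ∀ (p : ℕ → Bool) → cnt m (λ i → p i ∧ (col i ≡ᵇ 0)) ≡ ι (p 0)
                  × cnt m (λ i → p i ∧ (col i ≡ᵇ 1)) ≡ cnt ℓ₁ (λ t → p (suc t))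
                  × cnt m (λ i → p i ∧ (col i ≡ᵇ 2)) ≡ cnt ℓ₂ (λ s → p (suc (ℓ₁ + s)))
  cnt-class p = zeroth , first , second
    where
    out : ∀ {c c′ : ℕ} x → c ≡ c′ → ∀ k → c′ ≢ k → (x ∧ (c ≡ᵇ k)) ≡ false
    out x refl k ne = trans (cong (x ∧_) (≡ᵇ-false ne)) (BoolP.∧-zeroʳ x)
    inn : ∀ {c c′ : ℕ} x → c ≡ c′ → (x ∧ (c ≡ᵇ c′)) ≡ x
    inn {c} x refl = trans (cong (x ∧_) (≡ᵇ-true {c} refl)) (BoolP.∧-identityʳ x)
    zeroth : cnt m (λ i → p i ∧ (col i ≡ᵇ 0)) ≡ ι (p 0)
    zeroth = trans (cnt-split (λ i → p i ∧ (col i ≡ᵇ 0))) (trans (cong₂ _+_ (cong ι (BoolP.∧-identityʳ (p 0))) (cong₂ _+_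
      (cnt-false ℓ₁ (λ t l → out (p (suc t)) (col-1 t l) 0 (λ ()))) (cnt-false ℓ₂ (λ s l → out (p (suc (ℓ₁ + s))) (col-2 s) 0 (λ ()))))) (ℕP.+-identityʳ _))
    first : cnt m (λ i → p i ∧ (col i ≡ᵇ 1)) ≡ cnt ℓ₁ (λ t → p (suc t))
    first = trans (cnt-split (λ i → p i ∧ (col i ≡ᵇ 1))) (trans (cong₂ _+_ (cong ι (BoolP.∧-zeroʳ (p 0))) (cong₂ _+_
      (cnt-cong ℓ₁ (λ t l → inn (p (suc t)) (col-1 t l))) (cnt-false ℓ₂ (λ s l → out (p (suc (ℓ₁ + s))) (col-2 s) 1 (λ ()))))) (ℕP.+-identityʳ _))
    second : cnt m (λ i → p i ∧ (col i ≡ᵇ 2)) ≡ cnt ℓ₂ (λ s → p (suc (ℓ₁ + s)))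
    second = trans (cnt-split (λ i → p i ∧ (col i ≡ᵇ 2))) (cong₂ _+_ (cong ι (BoolP.∧-zeroʳ (p 0))) (cong₂ _+_
      (cnt-false ℓ₁ (λ t l → out (p (suc t)) (col-1 t l) 2 (λ ()))) (cnt-cong ℓ₂ (λ s l → inn (p (suc (ℓ₁ + s))) (col-2 s)))))

  ∣P∣ : ∣ P 0 ∣ ≡ 1 × ∣ P 1 ∣ ≡ ℓ₁ × ∣ P 2 ∣ ≡ ℓ₂
  ∣P∣ = trans (size 0) (proj₁ (cnt-class (λ _ → true))) , trans (size 1) (trans (proj₁ (proj₂ (cnt-class (λ _ → true)))) (cnt-true ℓ₁ (λ _ _ → refl))) ,
        trans (size 2) (trans (proj₂ (proj₂ (cnt-class (λ _ → true)))) (cnt-true ℓ₂ (λ _ _ → refl)))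
    where
    size : ∀ c → ∣ P c ∣ ≡ cnt m (λ i → true ∧ (col i ≡ᵇ c))
    size c = trans (∣∣-cnt (P c)) (cnt-cong m (bit-tabulate m (λ i → col i ≡ᵇ c)))

  module _ (A : Subset m) where
    open Rank A

    co-class : ∣ (⊤ ─ A) ∩ P 0 ∣ ≡ d₀ × ∣ (⊤ ─ A) ∩ P 1 ∣ ≡ d₁ × ∣ (⊤ ─ A) ∩ P 2 ∣ ≡ d₂
    co-class = trans (size 0) (proj₁ (cnt-class (λ i → not (bit A i)))) ,
      trans (size 1) (trans (proj₁ (proj₂ (cnt-class (λ i → not (bit A i))))) (sym (P₁.missing-cnt ℓ₁ 0))) ,
      trans (size 2) (trans (proj₂ (proj₂ (cnt-class (λ i → not (bit A i))))) (sym (P₂.missing-cnt ℓ₂ 0)))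
      where
      size : ∀ c → ∣ (⊤ ─ A) ∩ P c ∣ ≡ cnt m (λ i → not (bit A i) ∧ (col i ≡ᵇ c))
      size c = trans (∣∩P∣ c (⊤ ─ A)) (cnt-cong m (λ i l → cong (_∧ (col i ≡ᵇ c)) (bit-⊤─ A i l)))

    ∣A∣ : ∣ A ∣ + (d₀ + (d₁ + d₂)) ≡ suc (ℓ₁ + ℓ₂)
    ∣A∣ = trans (cong₂ _+_ (∣∣-cnt A) (trans (cong (λ z → d₀ + z) (cong₂ _+_ (P₁.missing-cnt ℓ₁ 0) (P₂.missing-cnt ℓ₂ 0))) (sym (cnt-split (not ∘ bit A)))))
      (trans (cnt-not m (bit A)) m≡)

    L₁≡1 : (L₁ ≡ᵇ 1) ≡ (not (d₀ ≡ᵇ 0) ∧ not (d₁ ≡ᵇ 0) ∧ not (d₂ ≡ᵇ 0))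
    L₁≡1 rewrite P₁.full⇔missing ℓ₁ 0 | P₂.full⇔missing ℓ₂ 0 with bit A 0 | d₁ ≡ᵇ 0 | d₂ ≡ᵇ 0
    ... | true  | _     | _     = refl
    ... | false | true  | _     = refl
    ... | false | false | true  = refl
    ... | false | false | false = refl

    d₁≤ : d₁ ≤ ℓ₁
    d₁≤ = subst (_≤ ℓ₁) (sym (P₁.missing-cnt ℓ₁ 0)) (ℕP.≤-trans (ℕP.m≤n+m _ (cnt ℓ₁ y₁)) (ℕP.≤-reflexive (cnt-not ℓ₁ y₁)))

    d₂≤ : d₂ ≤ ℓ₂
    d₂≤ = subst (_≤ ℓ₂) (sym (P₂.missing-cnt ℓ₂ 0)) (ℕP.≤-trans (ℕP.m≤n+m _ (cnt ℓ₂ y₂)) (ℕP.≤-reflexive (cnt-not ℓ₂ y₂)))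

    -- The number of absent edges is the sum of the dᵢ ∸ 1 plus the number of arcs hit. The latter
    -- is its truncation at 2, plus one if all three arcs are hit, which is when vertex 1 is a root.
    -- The arc with the shared edge has one edge only, so d₀ ∸ 1 is zero.
    balance : suc (d₀ + (d₁ + d₂)) ≡ (d₀ ⊓ 1 + d₁ ⊓ 1 + d₂ ⊓ 1) ⊓ 2 + suc (ι (L₁ ≡ᵇ 1) + ((d₁ ∸ 1) + (d₂ ∸ 1)))
    balance rewrite L₁≡1 with bit A 0 | d₁ | d₂
    ... | true  | zero  | zero  = refl
    ... | true  | suc j | zero  rewrite ℕP.⊓-zeroʳ j = refl
    ... | true  | zero  | suc k rewrite ℕP.⊓-zeroʳ k = refl
    ... | true  | suc j | suc k rewrite ℕP.⊓-zeroʳ j | ℕP.⊓-zeroʳ k | ℕP.+-suc j k = refl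
    ... | false | zero  | zero  = refl
    ... | false | suc j | zero  rewrite ℕP.⊓-zeroʳ j = refl
    ... | false | zero  | suc k rewrite ℕP.⊓-zeroʳ k = refl
    ... | false | suc j | suc k rewrite ℕP.⊓-zeroʳ j | ℕP.+-suc j k = refl

    open Graphic V m (cEnds a b) A using (components)

    components≤ : components ≤ V
    components≤ = subst (_≤ V) (sym components-count) (subst (suc (ι (L₁ ≡ᵇ 1) + ((d₁ ∸ 1) + (d₂ ∸ 1))) ≤_) (sym V≡)
      (s≤s (ℕP.+-mono-≤ (ι≤1 (L₁ ≡ᵇ 1)) (ℕP.+-mono-≤ (ℕP.∸-monoˡ-≤ 1 d₁≤) (ℕP.∸-monoˡ-≤ 1 d₂≤)))))
      where
      ι≤1 : ∀ x → ι x ≤ 1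
      ι≤1 true  = s≤s z≤n
      ι≤1 false = z≤n

    rank-formula : (V ∸ components) + 2 ≡ ∣ A ∣ + ρ (⊤ ─ A)
    rank-formula = ℕP.+-cancelʳ-≡ (components + D) _ _ (begin
      (V ∸ components) + 2 + (components + D) ≡⟨ shuffle (V ∸ components) components D ⟩
      ((V ∸ components) + components) + 2 + D ≡⟨ cong (λ z → z + 2 + D) (trans (ℕP.m∸n+n≡m components≤) V≡) ⟩
      suc (suc (a₀ + b₀)) + 2 + D ≡⟨ shuffle₂ a₀ b₀ D ⟩
      suc (ℓ₁ + ℓ₂) + suc D ≡⟨ cong₂ _+_ (sym ∣A∣) balance ⟩
      (∣ A ∣ + D) + ((d₀ ⊓ 1 + d₁ ⊓ 1 + d₂ ⊓ 1) ⊓ 2 + suc (ι (L₁ ≡ᵇ 1) + ((d₁ ∸ 1) + (d₂ ∸ 1)))) ≡⟨ cong₂ (λ x y → (∣ A ∣ + D) + (x + y)) ρ≡ (sym components-count) ⟩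
      (∣ A ∣ + D) + (ρ (⊤ ─ A) + components) ≡⟨ shuffle₃ (∣ A ∣) D (ρ (⊤ ─ A)) components ⟩
      ∣ A ∣ + ρ (⊤ ─ A) + (components + D) ∎)
      where
      open ≡-Reasoning
      D : ℕ
      D = d₀ + (d₁ + d₂)
      shuffle : ∀ x y z → x + 2 + (y + z) ≡ (x + y) + 2 + z
      shuffle = ℕR.solve-∀
      shuffle₂ : ∀ x y z → suc (suc (x + y)) + 2 + z ≡ suc (suc x + suc y) + suc z
      shuffle₂ = ℕR.solve-∀
      shuffle₃ : ∀ x y z w → (x + y) + (z + w) ≡ x + z + (w + y)
      shuffle₃ = ℕR.solve-∀
      ρ≡ : (d₀ ⊓ 1 + d₁ ⊓ 1 + d₂ ⊓ 1) ⊓ 2 ≡ ρ (⊤ ─ A)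
      ρ≡ = sym (cong (_⊓ 2) (cong₂ _+_ (cong₂ _+_ (cong (_⊓ 1) (proj₁ co-class)) (cong (_⊓ 1) (proj₁ (proj₂ co-class)))) (cong (_⊓ 1) (proj₂ (proj₂ co-class)))))

-- Coefficients and correction terms

coeff-sub : ∀ p q i → coeff (p -P q) i ≡ coeff p i -ᶻ coeff q i
coeff-sub p q i = begin
  coeff (p -P q) i ≡⟨ sym (ev-δ (p -P q) i) ⟩
  ev (p -P q) (δ i) ≡⟨ ev-+P p (negP q) (δ i) ⟩
  ev p (δ i) +ᶻ ev (negP q) (δ i) ≡⟨ cong₂ _+ᶻ_ (ev-δ p i) (trans (ev-scale -1ℤ q (δ i)) (trans (ℤP.-1*i≡-i _) (cong -_ (ev-δ q i)))) ⟩
  coeff p i -ᶻ coeff q i ∎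
  where open ≡-Reasoning

coeff-scale : ∀ c p i → coeff (scaleP c p) i ≡ c *ᶻ coeff p i
coeff-scale c p i = trans (sym (ev-δ (scaleP c p) i)) (trans (ev-scale c p (δ i)) (cong (c *ᶻ_) (ev-δ p i)))

coeff-sumP : ∀ {a} {A : Set a} (xs : List A) (f : A → Poly) i → coeff (sumP (map f xs)) i ≡ ΣL xs (λ x → coeff (f x) i)
coeff-sumP xs f i = trans (sym (ev-δ (sumP (map f xs)) i)) (trans (ev-sumP xs f (δ i)) (ΣL-cong xs (λ {x} _ → ev-δ (f x) i)))

ΣL-upTo : ∀ n (f : ℕ → ℤ) → ΣL (upTo n) f ≡ Sum< n f
ΣL-upTo n f = go n id
  where
  go : ∀ n (h : ℕ → ℕ) → ΣL (applyUpTo h n) f ≡ Sum< n (f ∘ h)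
  go zero    h = refl
  go (suc n) h = cong (f (h 0) +ᶻ_) (go n (h ∘ suc))

Sum<-telescope : ∀ n (b : ℕ → ℤ) → Sum< n (λ t → b (suc t) -ᶻ b t) ≡ b n -ᶻ b 0
Sum<-telescope zero    b = sym (ℤP.+-inverseʳ (b 0))
Sum<-telescope (suc n) b = trans (cong ((b 1 -ᶻ b 0) +ᶻ_) (Sum<-telescope n (b ∘ suc))) (lem (b 0) (b 1) (b (suc n)))
  where
  lem : ∀ x y z → (y -ᶻ x) +ᶻ (z -ᶻ y) ≡ z -ᶻ x
  lem = ℤR.solve-∀

Sum<-unique : ∀ n {k} (f : ℕ → ℤ) → k < n → (∀ j → j ≢ k → f j ≡ 0ℤ) → Sum< n f ≡ f k
Sum<-unique (suc n) {zero}  f _       h = trans (cong (f 0 +ᶻ_) (zeros n (λ j → h (suc j) (λ ())))) (ℤP.+-identityʳ (f 0))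
  where
  zeros : ∀ n {g : ℕ → ℤ} → (∀ j → g j ≡ 0ℤ) → Sum< n g ≡ 0ℤ
  zeros zero    h = refl
  zeros (suc n) h = cong₂ _+ᶻ_ (h 0) (zeros n (h ∘ suc))
Sum<-unique (suc n) {suc k} f (s≤s l) h = trans (cong₂ _+ᶻ_ (h 0 (λ ())) (Sum<-unique n (f ∘ suc) l (λ j ne → h (suc j) (ne ∘ ℕP.suc-injective)))) (ℤP.+-identityˡ _)

module _ {N : RawMatroid} (isN : IsMatroid N) (ll : Loopless N) where
  open MatroidTheory N isN

  rank-pos-of-nonempty : ∀ {A} → A ⊆ ground N → 0 < ∣ A ∣ → 1 ≤ rk N A
  rank-pos-of-nonempty {A} A⊆E p with e , m ← nonempty {A = A} p =
    ℕP.≤-trans (ℕP.n≢0⇒n>0 (λ z → ll e (A⊆E m , z))) (rk-mono A⊆E (⁅⁆-⊆ m))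

  size≥3 : ∣ ground N ∣ ≡ rk N (ground N) + 2 → ∃ λ k → ∣ ground N ∣ ≡ suc (suc (suc k))
  size≥3 h with rk N (ground N) in eq
  ... | suc k = k , trans h (cong suc (ℕP.+-comm k 2))
  ... | zero  = case ℕP.≤-trans (rank-pos-of-nonempty id (subst (0 <_) (sym h) (s≤s z≤n))) (ℕP.≤-reflexive eq) of λ ()

  -- The complement of a line has nullity 1 and no loops, hence at least two elements. This keeps n
  -- - a at least 2 for all a up to |S|, as `coeff-corrTerm` requires.
  line-size : ∀ {s} → DualRanks (ground N) (rk N) s → s (ground N) ≡ 2 → ∀ {S} → S ⊆ ground N → s S ≡ 1 → ∣ S ∣ + 2 ≤ ∣ ground N ∣
  line-size {s} key sE {S} S⊆E sS = ℕP.≤-trans (ℕP.≤-reflexive (ℕP.+-comm ∣ S ∣ 2)) (ℕP.≤-trans (ℕP.+-monoˡ-≤ ∣ S ∣ two) (ℕP.≤-reflexive (∣─∣ S⊆E)))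
    where
    E = ground N
    co-size : suc (rk N (E ─ S)) ≡ ∣ E ─ S ∣
    co-size = ℕP.+-cancelʳ-≡ 1 _ _ (trans (cong (λ z → suc z) (ℕP.+-comm (rk N (E ─ S)) 1)) (trans (ℕP.+-comm 2 (rk N (E ─ S))) (trans (cong (λ z → rk N (E ─ S) + z) (sym sE))
      (trans (key (SubP.p─q⊆p E S)) (cong (λ z → ∣ E ─ S ∣ + z) (trans (cong s (─-involutive S⊆E)) sS))))))
    two : 2 ≤ ∣ E ─ S ∣
    two = subst (2 ≤_) co-size (s≤s (rank-pos-of-nonempty (SubP.p─q⊆p E S) (subst (0 <_) co-size (s≤s z≤n))))

module Corrections {F : RawMatroid → Poly} (X : LineExpansion F) where
  open LineExpansion X
  open UnifCorankTwo X public

  module _ (a₀ b₀ : ℕ) where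
    open Theta a₀ b₀
    private
      N = C a b

    ρ⊤ : ρ ⊤ ≡ 2
    ρ⊤ = trans (cong (_⊓ 2) (cong₂ _+_ (cong₂ _+_ (full 0 (proj₁ ∣P∣)) (full 1 (proj₁ (proj₂ ∣P∣)))) (full 2 (proj₂ (proj₂ ∣P∣))))) refl
      where
      full : ∀ c {k} → ∣ P c ∣ ≡ suc k → f c ⊤ ≡ 1
      full c {k} h = trans (cong (λ z → ∣ z ∣ ⊓ 1) (SubP.∩-identityˡ (P c))) (trans (cong (_⊓ 1) h) (cong suc (ℕP.⊓-zeroʳ k)))

    C-dual : DualRanks ⊤ (rk N) ρ
    C-dual {A} _ = trans (cong (λ z → rk N A + z) ρ⊤) (rank-formula A)

    C-isMatroid : IsMatroid N
    C-isMatroid = dual-isMatroid {E = ⊤} {rk N} {ρ} ρ-isMatroid (λ {A} → C-dual {A})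

    ρ-⊥ : ρ ⊥ ≡ 0
    ρ-⊥ = MatroidTheory.rk-⊥ (mkRaw m ⊤ ρ) ρ-isMatroid

    ∈L : ∀ {S} → S ∈ˡ L → 0 < ∣ S ∣ × ∣ S ∣ < ℓ₁ + ℓ₂
    ∈L (here refl) = subst (0 <_) (sym (proj₁ ∣P∣)) (s≤s z≤n) , subst (_< ℓ₁ + ℓ₂) (sym (proj₁ ∣P∣)) (s≤s (ℕP.≤-trans (s≤s z≤n) (ℕP.m≤n+m ℓ₂ a₀)))
    ∈L (there (here refl)) = subst (0 <_) (sym (proj₁ (proj₂ ∣P∣))) (s≤s z≤n) , subst (_< ℓ₁ + ℓ₂) (sym (proj₁ (proj₂ ∣P∣))) (ℕP.m<m+n ℓ₁ (s≤s z≤n))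
    ∈L (there (there (here refl))) = subst (0 <_) (sym (proj₂ (proj₂ ∣P∣))) (s≤s z≤n) , subst (_< ℓ₁ + ℓ₂) (sym (proj₂ (proj₂ ∣P∣))) (ℕP.m<n+m ℓ₂ (s≤s z≤n))

    -- If `e` were a loop, the other edges would have dual rank 1 and lie in a single class, but
    -- every class misses at least two edges.
    C-loopless : Loopless N
    C-loopless e (_ , z) = big (filter-some (D ⊆ᵇ_) L (ℕP.≤-reflexive (sym one)))
      where
      D : Subset m
      D = ⊤ ─ ⁅ e ⁆
      ∣D∣ : ∣ D ∣ ≡ ℓ₁ + ℓ₂
      ∣D∣ = ℕP.suc-injective (trans (ℕP.+-comm 1 ∣ D ∣) (trans (cong (λ z → ∣ D ∣ + z) (sym (SubP.∣⁅x⁆∣≡1 e))) (trans (∣─∣ {E = ⊤} (SubP.⊆-max ⁅ e ⁆)) (trans (SubP.∣⊤∣≡n m) m≡))))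
      ρD : ρ D ≡ 1
      ρD = ℕP.suc-injective (trans (cong (_+ ρ D) (sym (SubP.∣⁅x⁆∣≡1 e))) (trans (sym (C-dual {⁅ e ⁆} (SubP.⊆-max ⁅ e ⁆))) (cong₂ _+_ z ρ⊤)))
      one : length (filterᵇ (D ⊆ᵇ_) L) ≡ 1
      one = ℕP.+-cancelʳ-≡ 1 _ _ (trans (cong (λ z → length (filterᵇ (D ⊆ᵇ_) L) + z) (sym ρD)) (count {D} (subst (0 <_) (sym ∣D∣) (s≤s z≤n))))
      big : ¬ (∃ λ S → S ∈ˡ L × (D ⊆ᵇ S) ≡ true)
      big (S , S∈L , h) = ℕP.<⇒≱ (proj₂ (∈L S∈L)) (subst (_≤ ∣ S ∣) ∣D∣ (SubP.p⊆q⇒∣p∣≤∣q∣ (dec-true⁻ (D ⊆? S) h)))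

    C-isCorankTwo : IsCorankTwo N ρ L
    C-isCorankTwo = record
      { dual = dual-complement {E = ⊤} {rk N} {ρ} ρ-⊥ (λ {A} → C-dual {A})
      ; size = sym (trans (cong (λ z → rk N ⊤ + z) (sym ρ⊤)) (trans (C-dual {⊤} id) (trans (cong (λ z → ∣ ⊤ {m} ∣ + z) (trans (cong ρ (SubP.p─⊤≡⊥ (⊤ {m}))) ρ-⊥)) (ℕP.+-identityʳ _))))
      ; ρ⊥ = ρ-⊥
      ; pos = λ {D} _ → ρ-pos {D}
      ; count = λ {D} _ → count {D}
      ; line = λ {S} S∈L → SubP.⊆-max S , ℕP.≤-antisym (atMost S∈L) (ρ-pos {S} (proj₁ (∈L S∈L))) }
      where
      atMost : ∀ {S} → S ∈ˡ L → ρ S ≤ 1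
      atMost {S} S∈L = ℕP.+-cancelˡ-≤ 1 _ _ (ℕP.≤-trans (ℕP.+-monoˡ-≤ (ρ S) (length-pos (∈-filterᵇ⁺ (S ⊆ᵇ_) L S∈L (dec-true (S ⊆? S) id)))) (ℕP.≤-reflexive (count {S} (proj₁ (∈L S∈L)))))

    coeff-C : ∀ i → coeff (F N) i ≡ α m i -ᶻ (β m ℓ₁ i +ᶻ β m ℓ₂ i)
    coeff-C i = trans (expand N C-isMatroid C-loopless ρ L C-isCorankTwo i)
      (trans (cong (λ k → α k i -ᶻ (β k ∣ P 0 ∣ i +ᶻ (β k ∣ P 1 ∣ i +ᶻ (β k ∣ P 2 ∣ i +ᶻ 0ℤ)))) (SubP.∣⊤∣≡n m))
        (cong (α m i -ᶻ_) (trans (cong₂ _+ᶻ_ (trans (cong (λ z → β m z i) (proj₁ ∣P∣)) (point m i))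
          (cong₂ _+ᶻ_ (cong (λ z → β m z i) (proj₁ (proj₂ ∣P∣))) (trans (ℤP.+-identityʳ _) (cong (λ z → β m z i) (proj₂ (proj₂ ∣P∣))))))
          (ℤP.+-identityˡ _))))

  coeff-corrTerm : ∀ n t → suc (suc t) + 2 ≤ n → ∀ i → coeff (corrTerm F n (suc (suc t))) i ≡ β n (suc (suc t)) i -ᶻ β n (suc t) i
  coeff-corrTerm n t l i = begin
    coeff (corrTerm F n a) i ≡⟨ cong₂ (λ y z → coeff (F (C a y) -P (F (Unif (suc t) a) *P F (Unif (z ∸ 1) z))) i) eq₁ eq₂ ⟩
    coeff (F (C a (suc c)) -P (F (Unif (suc t) a) *P F (Unif (c ∸ 1) c))) i ≡⟨ coeff-sub (F (C a (suc c))) _ i ⟩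
    coeff (F (C a (suc c))) i -ᶻ coeff (F (Unif (suc t) a) *P F (Unif (c ∸ 1) c)) i ≡⟨ cong₂ _-ᶻ_ (coeff-C t (suc c₀) i) (product t c₀ i) ⟩
    (α m i -ᶻ (β m (suc t) i +ᶻ β m c i)) -ᶻ (α (a + c) i -ᶻ (β (a + c) a i +ᶻ β (a + c) c i)) ≡⟨ cong₂ (λ y z → (α y i -ᶻ (β y (suc t) i +ᶻ β y c i)) -ᶻ (α z i -ᶻ (β z a i +ᶻ β z c i))) m≡n a+c≡n ⟩
    (α n i -ᶻ (β n (suc t) i +ᶻ β n c i)) -ᶻ (α n i -ᶻ (β n a i +ᶻ β n c i)) ≡⟨ lem (α n i) (β n (suc t) i) (β n c i) (β n a i) ⟩
    β n a i -ᶻ β n (suc t) i ∎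
    where
    open ≡-Reasoning
    a = suc (suc t)
    -- The second circuit has `c = n ∸ a` elements; the bound on `n` makes this at least 2.
    c₀ = n ∸ (a + 2)
    c = suc (suc c₀)
    m = Theta.m t (suc c₀)
    a+c≡n : a + c ≡ n
    a+c≡n = trans (sym (ℕP.+-assoc a 2 c₀)) (ℕP.m+[n∸m]≡n l)
    m≡n : m ≡ n
    m≡n = trans (cong suc (ℕP.+-suc t c)) a+c≡n
    eq₂ : n ∸ a ≡ c
    eq₂ = trans (cong (_∸ a) (sym a+c≡n)) (ℕP.m+n∸m≡n a c)
    eq₁ : n + 1 ∸ a ≡ suc c
    eq₁ = trans (cong (λ z → z + 1 ∸ a) (sym a+c≡n)) (trans (cong (_∸ a) (ℕP.+-assoc a c 1)) (trans (ℕP.m+n∸m≡n a (c + 1)) (ℕP.+-comm c 1)))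
    lem : ∀ x u v w → (x -ᶻ (u +ᶻ v)) -ᶻ (x -ᶻ (w +ᶻ v)) ≡ w -ᶻ u
    lem = ℤR.solve-∀

  coeff-sumRange : ∀ n s → suc s + 2 ≤ n → ∀ i → coeff (sumRange 2 (suc s) (corrTerm F n)) i ≡ β n (suc s) i
  coeff-sumRange n s l i = begin
    coeff (sumRange 2 (suc s) (corrTerm F n)) i ≡⟨ coeff-sumP (upTo s) (λ t → corrTerm F n (2 + t)) i ⟩
    ΣL (upTo s) (λ t → coeff (corrTerm F n (2 + t)) i) ≡⟨ ΣL-upTo s _ ⟩
    Sum< s (λ t → coeff (corrTerm F n (2 + t)) i) ≡⟨ Sum<-cong s (λ t t<s → coeff-corrTerm n t (ℕP.≤-trans (ℕP.+-monoˡ-≤ 2 (s≤s t<s)) l) i) ⟩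
    Sum< s (λ t → β n (suc (suc t)) i -ᶻ β n (suc t) i) ≡⟨ Sum<-telescope s (λ t → β n (suc t) i) ⟩
    β n (suc s) i -ᶻ β n 1 i ≡⟨ cong (β n (suc s) i -ᶻ_) (point n i) ⟩
    β n (suc s) i +ᶻ 0ℤ ≡⟨ ℤP.+-identityʳ _ ⟩
    β n (suc s) i ∎
    where open ≡-Reasoning

-- Stressed subsets and lines of the dual

ΣL-swap : ∀ {a b} {A : Set a} {B : Set b} (xs : List A) (ys : List B) (f : A → B → ℤ) →
          ΣL xs (λ x → ΣL ys (f x)) ≡ ΣL ys (λ y → ΣL xs (λ x → f x y))
ΣL-swap []       ys f = sym (ΣL-zero ys (λ _ → refl))
ΣL-swap (x ∷ xs) ys f = trans (cong (ΣL ys (f x) +ᶻ_) (ΣL-swap xs ys f)) (sym (ΣL-+ ys (f x) _))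

all-list⁺ : ∀ {a} {A : Set a} (p : A → Bool) xs → (∀ x → p x ≡ true) → all p xs ≡ true
all-list⁺ p []       h = refl
all-list⁺ p (x ∷ xs) h = cong₂ _∧_ (h x) (all-list⁺ p xs h)

all-list⁻ : ∀ {a} {A : Set a} (p : A → Bool) xs → all p xs ≡ true → ∀ {x} → x ∈ˡ xs → p x ≡ true
all-list⁻ p (x ∷ xs) h (here refl) = proj₁ (∧-true⁻ {p x} h)
all-list⁻ p (x ∷ xs) h (there m)   = all-list⁻ p xs (proj₂ (∧-true⁻ {p x} h)) m

Uniform : RawMatroid → Set
Uniform M = ∀ {B} → B ⊆ ground M → rk M B ≡ ∣ B ∣ ⊓ rk M (ground M)

isUniformᵇ⇒Uniform : ∀ M → isUniformᵇ M ≡ true → Uniform M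
isUniformᵇ⇒Uniform M h {B} s with ∨-true⁻ {not (B ⊆ᵇ ground M)} (all-list⁻ _ (subsets (amb M)) h (subsets-complete B))
... | inj₂ e = ≡ᵇ-true⁻ e
... | inj₁ e with () ← trans (sym e) (cong not (dec-true (B ⊆? ground M) s))

Uniform⇒isUniformᵇ : ∀ M → Uniform M → isUniformᵇ M ≡ true
Uniform⇒isUniformᵇ M u = all-list⁺ _ (subsets (amb M)) step
  where
  step : ∀ B → (not (B ⊆ᵇ ground M) ∨ (rk M B ≡ᵇ (∣ B ∣ ⊓ rk M (ground M)))) ≡ true
  step B with B ⊆? ground M
  ... | yes s = ≡ᵇ-true (u s)
  ... | no  _ = refl

⊈-witness : ∀ {n} {X Y : Subset n} → ¬ (X ⊆ Y) → ∃ λ e → e ∈ X × e ∉ Y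
⊈-witness {X = X} {Y} h with FinP.any? (λ e → (e ∈? X) ×-dec (¬? (e ∈? Y)))
... | yes w = w
... | no  w = ⊥-elim (h (λ {x} m → decidable-stable (x ∈? Y) (λ n → w (x , m , n))))

module Stressed (M : RawMatroid) (isM : IsMatroid M) (ll : Loopless M) (nc : NoColoops M)
                (corank : rk M (ground M) + 2 ≡ ∣ ground M ∣) where
  open MatroidTheory M isM

  private
    E = ground M
    r = rk M
    n = ∣ E ∣

  -- The usual dual rank; `rk-∪-bound` shows that the subtraction is never truncated.
  s : Subset (amb M) → ℕ
  s T = ∣ T ∣ + r (E ─ T) ∸ r E

  s-dual : DualRanks E s r
  s-dual {A} A⊆E = ℕP.m∸n+n≡m (rk-∪-bound A⊆E)

  Mˢ : RawMatroid
  Mˢ = mkRaw (amb M) E s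

  s-isMatroid : IsMatroid Mˢ
  s-isMatroid = dual-isMatroid {E = E} {s} {r} isM (λ {A} → s-dual {A})

  key : DualRanks E r s
  key {A} = dual-sym {E = E} {r} {s} rk-⊥ (λ {A} → s-dual {A}) {A}

  s-loopless : Loopless Mˢ
  s-loopless e (m , z) = nc e (m , ℕP.≤-reflexive (trans (cong (_+ r (E - e)) (sym (SubP.∣⁅x⁆∣≡1 e))) (trans (sym (s-dual (⁅⁆-⊆ m))) (cong (_+ r E) z))))

  sE : s E ≡ 2
  sE = ℕP.+-cancelʳ-≡ (r E) _ _ (trans (s-dual {E} id) (trans (cong (λ z → n + z) (trans (cong r (─-self E)) rk-⊥)) (trans (ℕP.+-identityʳ n) (trans (sym corank) (ℕP.+-comm (r E) 2)))))

  module S = MatroidTheory Mˢ s-isMatroid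
  open RankTwo {E = E} {s} s-isMatroid s-loopless sE public

  nullity : ∀ {S} → S ⊆ E → s S ≡ 1 → ∣ E ─ S ∣ ≡ suc (r (E ─ S))
  nullity {S} S⊆E sS = ℕP.suc-injective (trans (ℕP.+-comm 1 _) (trans (cong (λ z → ∣ E ─ S ∣ + z) (sym (trans (cong s (─-involutive S⊆E)) sS)))
    (trans (sym (key (SubP.p─q⊆p E S))) (trans (cong (λ z → r (E ─ S) + z) sE) (ℕP.+-comm (r (E ─ S)) 2)))))

  nullity⁻ : ∀ {S} → S ⊆ E → ∣ E ─ S ∣ ≡ suc (r (E ─ S)) → s S ≡ 1
  nullity⁻ {S} S⊆E h = ℕP.+-cancelˡ-≡ (suc (r (E ─ S))) _ _ (trans (cong₂ _+_ (sym h) (sym (cong s (─-involutive S⊆E))))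
    (trans (sym (key (SubP.p─q⊆p E S))) (trans (cong (λ z → r (E ─ S) + z) sE) (ℕP.+-suc (r (E ─ S)) 1))))

  independent-mono : ∀ {B X} → X ⊆ E → B ⊆ X → r X ≡ ∣ X ∣ → r B ≡ ∣ B ∣
  independent-mono {B} {X} X⊆E B⊆X eq = ℕP.≤-antisym (rk≤ (X⊆E ∘ B⊆X)) (ℕP.+-cancelˡ-≤ ∣ X ─ B ∣ _ _ (begin
    ∣ X ─ B ∣ + ∣ B ∣ ≡⟨ ∣─∣ B⊆X ⟩
    ∣ X ∣ ≡⟨ sym eq ⟩
    r X ≡⟨ cong r (sym (─-∪ B⊆X)) ⟩
    r ((X ─ B) ∪ B) ≤⟨ ℕP.m≤m+n _ _ ⟩
    r ((X ─ B) ∪ B) + r ((X ─ B) ∩ B) ≤⟨ rk-submod (X⊆E ∘ SubP.p─q⊆p X B) (X⊆E ∘ B⊆X) ⟩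
    r (X ─ B) + r B ≤⟨ ℕP.+-monoˡ-≤ (r B) (rk≤ (X⊆E ∘ SubP.p─q⊆p X B)) ⟩
    ∣ X ─ B ∣ + r B ∎))
    where open ℕP.≤-Reasoning

  s-add : ∀ {S e} → S ⊆ E → e ∈ E → e ∉ S → s (S ∪ ⁅ e ⁆) + r E ≡ suc ∣ S ∣ + r ((E ─ S) ─ ⁅ e ⁆)
  s-add {S} {e} S⊆E e∈E e∉S = trans (s-dual (∪-⊆ S⊆E (⁅⁆-⊆ e∈E))) (cong₂ _+_ (∣∪⁅⁆∣ e∉S) (cong r (sym (SubP.p─q─r≡p─q∪r E S ⁅ e ⁆))))

  ∣-⁅⁆∣ : ∀ {A : Subset (amb M)} {e} → e ∈ A → suc ∣ A ─ ⁅ e ⁆ ∣ ≡ ∣ A ∣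
  ∣-⁅⁆∣ {A} {e} m = trans (ℕP.+-comm 1 _) (trans (cong (λ z → ∣ A ─ ⁅ e ⁆ ∣ + z) (sym (SubP.∣⁅x⁆∣≡1 e))) (∣─∣ (⁅⁆-⊆ m)))

  -- A uniform set with one element more than its rank is a circuit: removing `e` from it keeps the
  -- rank, so adding `e` to `S` raises the dual rank.
  stressed⇒flat : ∀ {S} → S ⊆ E → Uniform (restrict M (E ─ S)) → ∣ E ─ S ∣ ≡ suc (r (E ─ S)) → Flat Mˢ S
  stressed⇒flat {S} S⊆E unif h = S⊆E , λ {e} e∈E e∉S eq →
    let e∈A = ∈─⁺ e∈E e∉S
        ∣A-e∣ = ℕP.suc-injective (trans (∣-⁅⁆∣ e∈A) h)
        r-eq : r ((E ─ S) ─ ⁅ e ⁆) ≡ r (E ─ S)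
        r-eq = trans (unif (SubP.p─q⊆p (E ─ S) ⁅ e ⁆)) (trans (cong (_⊓ r (E ─ S)) ∣A-e∣) (ℕP.⊓-idem (r (E ─ S))))
    in ℕP.1+n≢n (sym (trans (sym (s-dual S⊆E)) (trans (cong (_+ r E) (sym eq)) (trans (s-add S⊆E e∈E e∉S) (cong (λ z → suc ∣ S ∣ + z) r-eq)))))

  -- By flatness `S ∪ ⁅ e ⁆` has dual rank 2 for each `e` off `S`, so `A ─ ⁅ e ⁆` has the rank of
  -- `A` and is independent; every proper subset of `A` lies in such a set.
  flat⇒restrict-uniform : ∀ {S} → Flat Mˢ S → s S ≡ 1 → Uniform (restrict M (E ─ S))
  flat⇒restrict-uniform {S} (S⊆E , fl) sS {B} B⊆A with (E ─ S) ⊆? B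
  ... | yes A⊆B rewrite ⊆-antisym B⊆A A⊆B = sym (ℕP.m≥n⇒m⊓n≡n (rk≤ (SubP.p─q⊆p E S)))
  ... | no  A⊈B with e , e∈A , e∉B ← ⊈-witness A⊈B = trans rB (sym (ℕP.m≤n⇒m⊓n≡m ∣B∣≤))
    where
    A = E ─ S
    e∈E = proj₁ (∈─⁻ {p = E} {S} e∈A)
    e∉S = proj₂ (∈─⁻ {p = E} {S} e∈A)
    two : s (S ∪ ⁅ e ⁆) ≡ 2
    two with rank-cases {S ∪ ⁅ e ⁆} (∪-⊆ S⊆E (⁅⁆-⊆ e∈E)) (∣∣-pos (SubP.q⊆p∪q S ⁅ e ⁆ (SubP.x∈⁅x⁆ e)))
    ... | inj₂ t = t
    ... | inj₁ o = ⊥-elim (fl e∈E e∉S (trans o (sym sS)))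
    ∣A-e∣ : ∣ A ─ ⁅ e ⁆ ∣ ≡ r A
    ∣A-e∣ = ℕP.suc-injective (trans (∣-⁅⁆∣ e∈A) (nullity S⊆E sS))
    rA-e : r (A ─ ⁅ e ⁆) ≡ r A
    rA-e = ℕP.+-cancelˡ-≡ (suc ∣ S ∣) _ _ (trans (sym (s-add S⊆E e∈E e∉S)) (trans (cong (_+ r E) two) (cong suc (trans (cong (_+ r E) (sym sS)) (s-dual S⊆E)))))
    B⊆A-e : B ⊆ A ─ ⁅ e ⁆
    B⊆A-e {x} m = ∈─⁺ (B⊆A m) (λ m′ → e∉B (subst (_∈ B) (SubP.x∈⁅y⁆⇒x≡y e m′) m))
    rB : r B ≡ ∣ B ∣
    rB = independent-mono (λ m → SubP.p─q⊆p E S (SubP.p─q⊆p A ⁅ e ⁆ m)) B⊆A-e (trans rA-e (sym ∣A-e∣))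
    ∣B∣≤ : ∣ B ∣ ≤ r A
    ∣B∣≤ = ℕP.≤-trans (SubP.p⊆q⇒∣p∣≤∣q∣ B⊆A-e) (ℕP.≤-reflexive ∣A-e∣)

  -- The dual of M/A is the dual of M restricted to `S`, where all nonempty sets have rank 1. So `B`
  -- is independent in M/A unless `B = S`, and `S` has one element more than its rank there.
  flat⇒contract-uniform : ∀ {S} → Flat Mˢ S → s S ≡ 1 → Uniform (contract M (E ─ S))
  flat⇒contract-uniform {S} (S⊆E , _) sS {B} B⊆ = go ∣ S ─ B ∣ refl
    where
    open ≡-Reasoning
    A = E ─ S
    k = r A
    B⊆S : B ⊆ S
    B⊆S m = subst (_ ∈_) (─-involutive S⊆E) (B⊆ m)
    rE : r ((E ─ A) ∪ A) ≡ r E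
    rE = cong r (─-∪ (SubP.p─q⊆p E S))
    ∣S∣ : ∣ S ∣ + k ≡ suc (r E)
    ∣S∣ = trans (sym (s-dual S⊆E)) (cong (_+ r E) sS)
    compl : E ─ (B ∪ A) ≡ S ─ B
    compl = ⊆-antisym
      (λ m → let x∈E , x∉ = ∈─⁻ {p = E} {B ∪ A} m in
             ∈─⁺ (decidable-stable (_ ∈? S) (λ x∉S → x∉ (SubP.q⊆p∪q B A (∈─⁺ x∈E x∉S)))) (λ x∈B → x∉ (SubP.p⊆p∪q A x∈B)))
      (λ m → let x∈S , x∉B = ∈─⁻ {p = S} {B} m in
             ∈─⁺ (S⊆E x∈S) (λ m′ → [ x∉B , (λ x∈A → proj₂ (∈─⁻ {p = E} {S} x∈A) x∈S) ]′ (SubP.x∈p∪q⁻ B A m′)))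
    ∣B∪A∣ : ∣ B ∪ A ∣ ≡ ∣ B ∣ + suc k
    ∣B∪A∣ = trans (∣∪∣-disjoint (λ b a → proj₂ (∈─⁻ {p = E} {S} a) (B⊆S b))) (cong (λ z → ∣ B ∣ + z) (nullity S⊆E sS))
    rBA : r (B ∪ A) + 2 ≡ ∣ B ∣ + suc k + s (S ─ B)
    rBA = trans (cong (λ z → r (B ∪ A) + z) (sym sE)) (trans (key (∪-⊆ (λ m → S⊆E (B⊆S m)) (SubP.p─q⊆p E S))) (cong₂ _+_ ∣B∪A∣ (cong s compl)))
    go : ∀ j → ∣ S ─ B ∣ ≡ j → r (B ∪ A) ∸ k ≡ ∣ B ∣ ⊓ (r ((E ─ A) ∪ A) ∸ k)
    go zero h = begin
      r (B ∪ A) ∸ k ≡⟨ cong (λ X → r X ∸ k) (cong₂ _∪_ (trans B≡S (sym (─-involutive S⊆E))) refl) ⟩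
      r ((E ─ A) ∪ A) ∸ k ≡⟨ sym (ℕP.m≥n⇒m⊓n≡n (ℕP.≤-trans (ℕP.≤-reflexive (cong (_∸ k) rE)) le)) ⟩
      ∣ B ∣ ⊓ (r ((E ─ A) ∪ A) ∸ k) ∎
      where
      B≡S : B ≡ S
      B≡S = ⊆-card-≡ B⊆S (ℕP.≤-reflexive (trans (sym (∣─∣ B⊆S)) (cong (_+ ∣ B ∣) h)))
      le : r E ∸ k ≤ ∣ B ∣
      le = ℕP.m≤n+o⇒m∸n≤o (r E) k (ℕP.≤-trans (ℕP.n≤1+n (r E)) (ℕP.≤-reflexive (trans (sym ∣S∣) (trans (cong (λ X → ∣ X ∣ + k) (sym B≡S)) (ℕP.+-comm ∣ B ∣ k)))))
    go (suc j) h = begin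
      r (B ∪ A) ∸ k ≡⟨ cong (_∸ k) rBA′ ⟩
      ∣ B ∣ + k ∸ k ≡⟨ ℕP.m+n∸n≡m ∣ B ∣ k ⟩
      ∣ B ∣ ≡⟨ sym (ℕP.m≤n⇒m⊓n≡m le) ⟩
      ∣ B ∣ ⊓ (r ((E ─ A) ∪ A) ∸ k) ∎
      where
      one : s (S ─ B) ≡ 1
      one = ℕP.≤-antisym (ℕP.≤-trans (S.rk-mono S⊆E (SubP.p─q⊆p S B)) (ℕP.≤-reflexive sS)) (rank-pos (λ m → S⊆E (SubP.p─q⊆p S B m)) (subst (0 <_) (sym h) (s≤s z≤n)))
      rBA′ : r (B ∪ A) ≡ ∣ B ∣ + k
      rBA′ = ℕP.+-cancelʳ-≡ 2 _ _ (trans rBA (trans (cong (λ z → ∣ B ∣ + suc k + z) one) (shuffle ∣ B ∣ k)))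
        where
        shuffle : ∀ x y → x + suc y + 1 ≡ x + y + 2
        shuffle = ℕR.solve-∀
      le : ∣ B ∣ ≤ r ((E ─ A) ∪ A) ∸ k
      le = ℕP.m+n≤o⇒m≤o∸n ∣ B ∣ (ℕP.≤-trans (ℕP.≤-reflexive (sym rBA′)) (rk-mono (subst (_⊆ E) (sym (─-∪ (SubP.p─q⊆p E S))) id) (∪-mono {A = B} {A} B⊆ id)))

  stressed≡line : ∀ {S} → S ⊆ E →
    (isStressedᵇ M (E ─ S) ∧ (∣ E ─ S ∣ ≡ᵇ suc (r (E ─ S)))) ≡ (isFlatᵇ Mˢ S ∧ (s S ≡ᵇ 1))
  stressed≡line {S} S⊆E = ≡true⇔ to from
    where
    A = E ─ S
    to : (isStressedᵇ M A ∧ (∣ A ∣ ≡ᵇ suc (r A))) ≡ true → (isFlatᵇ Mˢ S ∧ (s S ≡ᵇ 1)) ≡ true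
    to h with st , nu ← ∧-true⁻ {isStressedᵇ M A} h with _ , st ← ∧-true⁻ {A ⊆ᵇ E} st with _ , ur ← ∧-true⁻ {isUniformᵇ (contract M A)} st =
      cong₂ _∧_ (Flat⇒isFlatᵇ Mˢ S (stressed⇒flat S⊆E (isUniformᵇ⇒Uniform (restrict M A) ur) (≡ᵇ-true⁻ nu))) (≡ᵇ-true (nullity⁻ S⊆E (≡ᵇ-true⁻ nu)))
    from : (isFlatᵇ Mˢ S ∧ (s S ≡ᵇ 1)) ≡ true → (isStressedᵇ M A ∧ (∣ A ∣ ≡ᵇ suc (r A))) ≡ true
    from h with fl , o ← ∧-true⁻ {isFlatᵇ Mˢ S} h = cong₂ _∧_ (cong₂ _∧_ (dec-true (A ⊆? E) (SubP.p─q⊆p E S)) (cong₂ _∧_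
      (Uniform⇒isUniformᵇ (contract M A) (flat⇒contract-uniform (isFlatᵇ⇒Flat Mˢ S fl) (≡ᵇ-true⁻ o)))
      (Uniform⇒isUniformᵇ (restrict M A) (flat⇒restrict-uniform (isFlatᵇ⇒Flat Mˢ S fl) (≡ᵇ-true⁻ o)))))
      (≡ᵇ-true (nullity S⊆E (≡ᵇ-true⁻ o)))

  -- A stressed set counts towards λ_k only for k equal to its rank, which the range of k covers;
  -- exchanging the sums leaves a sum over stressed sets, and complements turn these into lines.
  stressed-sum : ∀ (G : ℕ → ℤ) → ΣL (upTo (suc n)) (λ k → + stressedCount M k *ᶻ G k) ≡ ΣL flatLines (λ S → G (r (E ─ S)))
  stressed-sum G = begin
    ΣL (upTo (suc n)) (λ k → + stressedCount M k *ᶻ G k)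
      ≡⟨ ΣL-cong (upTo (suc n)) (λ {k} _ → sym (ΣL-count (p k) (subsets (amb M)) (G k))) ⟩
    ΣL (upTo (suc n)) (λ k → ΣL (subsets (amb M)) (λ A → if p k A then G k else 0ℤ))
      ≡⟨ ΣL-swap (upTo (suc n)) (subsets (amb M)) (λ k A → if p k A then G k else 0ℤ) ⟩
    ΣL (subsets (amb M)) (λ A → ΣL (upTo (suc n)) (λ k → if p k A then G k else 0ℤ))
      ≡⟨ ΣL-cong (subsets (amb M)) (λ {A} _ → trans (ΣL-upTo (suc n) (λ k → if p k A then G k else 0ℤ)) (one-rank A)) ⟩
    ΣL (subsets (amb M)) (λ A → if q A then G (r A) else 0ℤ)
      ≡⟨ sym (ΣL-filter q (subsets (amb M)) (λ A → G (r A))) ⟩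
    ΣL (filterᵇ q (subsets (amb M))) (λ A → G (r A))
      ≡⟨ ΣL-filter-subsets E q _ q⇒⊆ ⟩
    Σ⊆ E (λ A → if q A then G (r A) else 0ℤ)
      ≡⟨ Σ⊆-compl E _ ⟩
    Σ⊆ E (λ S → if q (E ─ S) then G (r (E ─ S)) else 0ℤ)
      ≡⟨ Σ⊆-cong E (λ S S⊆E → if-cong (stressed≡line S⊆E)) ⟩
    Σ⊆ E (λ S → if isFlatᵇ Mˢ S ∧ (s S ≡ᵇ 1) then G (r (E ─ S)) else 0ℤ)
      ≡⟨ sym (ΣL-filter-subsets E _ _ (λ S h → proj₁ (isFlatᵇ⇒Flat Mˢ S (proj₁ (∧-true⁻ {isFlatᵇ Mˢ S} h))))) ⟩
    ΣL flatLines (λ S → G (r (E ─ S))) ∎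
    where
    open ≡-Reasoning
    p : ℕ → Subset (amb M) → Bool
    p k A = isStressedᵇ M A ∧ (r A ≡ᵇ k) ∧ (∣ A ∣ ≡ᵇ suc k)
    q : Subset (amb M) → Bool
    q A = isStressedᵇ M A ∧ (∣ A ∣ ≡ᵇ suc (r A))
    q⇒⊆ : ∀ A → q A ≡ true → A ⊆ E
    q⇒⊆ A h = dec-true⁻ (A ⊆? E) (proj₁ (∧-true⁻ {A ⊆ᵇ E} (proj₁ (∧-true⁻ {isStressedᵇ M A} h))))
    one-rank : ∀ A → Sum< (suc n) (λ k → if p k A then G k else 0ℤ) ≡ (if q A then G (r A) else 0ℤ)
    one-rank A with isStressedᵇ M A in st
    ... | false = trans (Sum<-unique (suc n) {0} (λ _ → 0ℤ) (s≤s z≤n) (λ _ _ → refl)) refl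
    ... | true = trans (Sum<-unique (suc n) {r A} (λ k → if (r A ≡ᵇ k) ∧ (∣ A ∣ ≡ᵇ suc k) then G k else 0ℤ) (s≤s (ℕP.≤-trans (rk≤ A⊆E) (SubP.p⊆q⇒∣p∣≤∣q∣ A⊆E)))
                   (λ k ne → if-false (cong (_∧ (∣ A ∣ ≡ᵇ suc k)) (≡ᵇ-false (λ e → ne (sym e))))))
                   (if-cong (cong (_∧ (∣ A ∣ ≡ᵇ suc (r A))) (≡ᵇ-true {r A} refl)))
      where
      A⊆E : A ⊆ E
      A⊆E = dec-true⁻ (A ⊆? E) (proj₁ (∧-true⁻ {A ⊆ᵇ E} st))

-- The formulas for both polynomials

module Theorem {F : RawMatroid → Poly} (X : LineExpansion F) where
  open LineExpansion X
  open Corrections X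
  open ≡-Reasoning

  corank-two : (M : RawMatroid) → IsMatroid M → Loopless M → NoColoops M → rk M (ground M) + 2 ≡ ∣ ground M ∣ → F M ≈P rhsCorank2 F M
  corank-two M isM ll nc corank i = begin
    coeff (F M) i ≡⟨ expand M isM ll s flatLines (flatLines-isCorankTwo {rk M} (λ {A} → key {A})) i ⟩
    α n i -ᶻ ΣL flatLines (λ S → β n ∣ S ∣ i) ≡⟨ cong₂ _-ᶻ_ (sym (unif (size≥3 isM ll (sym corank)))) (sym total) ⟩
    coeff (F (Unif (n ∸ 2) n)) i -ᶻ coeff corr i ≡⟨ sym (coeff-sub (F (Unif (n ∸ 2) n)) corr i) ⟩
    coeff (rhsCorank2 F M) i ∎
    where
    open Stressed M isM ll nc corank
    E = ground M
    n = ∣ E ∣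
    part : ℕ → Poly
    part k = sumRange 2 (n ∸ k ∸ 1) (corrTerm F n)
    corr : Poly
    corr = sumP (map (λ k → scaleP (+ stressedCount M k) (part k)) (upTo (suc n)))
    unif : (∃ λ k → n ≡ suc (suc (suc k))) → coeff (F (Unif (n ∸ 2) n)) i ≡ α n i
    unif (k , eq) = subst (λ z → coeff (F (Unif (z ∸ 2) z)) i ≡ α z i) (sym eq) (coeff-Unif k i)
    line : ∀ {S} → S ∈ˡ flatLines → coeff (part (rk M (E ─ S))) i ≡ β n ∣ S ∣ i
    line {S} S∈L with (S⊆E , _) , sS ← flatLines⁻ S∈L = trans (cong (λ z → coeff (sumRange 2 z (corrTerm F n)) i) size)
      (go ∣ S ∣ (S-pos sS) (line-size isM ll {s} (λ {A} → key {A}) sE S⊆E sS))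
      where
      -- The complement of `S` has one element more than its rank, so the upper limit n - r - 1 of
      -- the inner sum is |S|.
      size : n ∸ rk M (E ─ S) ∸ 1 ≡ ∣ S ∣
      size = trans (ℕP.∸-+-assoc n (rk M (E ─ S)) 1) (trans (cong (n ∸_) (trans (ℕP.+-comm _ 1) (sym (nullity S⊆E sS)))) (trans (cong (_∸ ∣ E ─ S ∣) (sym (∣─∣ S⊆E))) (ℕP.m+n∸m≡n ∣ E ─ S ∣ ∣ S ∣)))
      S-pos : ∀ {S} → s S ≡ 1 → 0 < ∣ S ∣
      S-pos {S} h = ℕP.n≢0⇒n>0 (λ z → case trans (sym h) (trans (cong s (sym (⊆-card-≡ (SubP.⊆-min S) (subst (_≤ ∣ ⊥ {amb M} ∣) (sym z) z≤n)))) S.rk-⊥) of λ ())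
      go : ∀ k → 0 < k → k + 2 ≤ n → coeff (sumRange 2 k (corrTerm F n)) i ≡ β n k i
      go (suc k) _ l = coeff-sumRange n k l i
    total : coeff corr i ≡ ΣL flatLines (λ S → β n ∣ S ∣ i)
    total = trans (coeff-sumP (upTo (suc n)) (λ k → scaleP (+ stressedCount M k) (part k)) i)
      (trans (ΣL-cong (upTo (suc n)) (λ {k} _ → coeff-scale (+ stressedCount M k) (part k) i))
        (trans (stressed-sum (λ k → coeff (part k) i)) (ΣL-cong flatLines line)))

  partition : (n : ℕ) (blocks : List (Subset n)) → IsSetPartition n blocks → (r : Subset n → ℕ) →
    IsMatroid (mkRaw n ⊤ r) → Loopless (mkRaw n ⊤ r) → r ⊤ ≡ 2 → RankOneFlatsAre n r blocks →
    Loopless (dualFull n r) → F (dualFull n r) ≈P rhsPartition F n blocks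
  partition n blocks (ne , disjoint , _) r isR llR r⊤ flats-blocks ll i = begin
    coeff (F N) i ≡⟨ expand N isN ll r blocks two i ⟩
    α ∣ ⊤ {n} ∣ i -ᶻ ΣL blocks (λ S → β ∣ ⊤ {n} ∣ ∣ S ∣ i) ≡⟨ cong (λ z → α z i -ᶻ ΣL blocks (λ S → β z ∣ S ∣ i)) (SubP.∣⊤∣≡n n) ⟩
    α n i -ᶻ ΣL blocks (λ S → β n ∣ S ∣ i) ≡⟨ cong₂ _-ᶻ_ (sym (unif (size≥3 isN ll (IsCorankTwo.size two)))) (sym (trans (coeff-sumP blocks part i) (ΣL-cong blocks block))) ⟩
    coeff (F (Unif (n ∸ 2) n)) i -ᶻ coeff (sumP (map part blocks)) i ≡⟨ sym (coeff-sub (F (Unif (n ∸ 2) n)) (sumP (map part blocks)) i) ⟩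
    coeff (rhsPartition F n blocks) i ∎
    where
    N = dualFull n r
    open MatroidTheory (mkRaw n ⊤ r) isR
    open RankTwo {E = ⊤} {r} isR llR r⊤ using (isCorankTwo)
    part : Subset n → Poly
    part S = if 2 ≤ᵇ ∣ S ∣ then sumRange 2 ∣ S ∣ (corrTerm F n) else []
    ∁≡ : ∀ {m} (A : Subset m) → ∁ A ≡ ⊤ ─ A
    ∁≡ []          = refl
    ∁≡ (true ∷ A)  = cong (false ∷_) (∁≡ A)
    ∁≡ (false ∷ A) = cong (true ∷_) (∁≡ A)
    key : DualRanks ⊤ (rk N) r
    key {A} A⊆⊤ = trans (ℕP.m∸n+n≡m (subst (λ X → r ⊤ ≤ ∣ A ∣ + r X) (sym (∁≡ A)) (rk-∪-bound A⊆⊤))) (cong (λ X → ∣ A ∣ + r X) (∁≡ A))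
    isN : IsMatroid N
    isN = dual-isMatroid {E = ⊤} {rk N} {r} isR (λ {A} → key {A})
    lines⁻ : ∀ {S} → S ∈ˡ blocks → Flat (mkRaw n ⊤ r) S × r S ≡ 1
    lines⁻ {S} m with a , b ← proj₂ (flats-blocks S) m = isFlatᵇ⇒Flat (mkRaw n ⊤ r) S (T⇒≡true a) , b
    atMostOne : ∀ {D} → D ⊆ ⊤ → 0 < ∣ D ∣ → length (filterᵇ (D ⊆ᵇ_) blocks) ≤ 1
    atMostOne {D} _ p with e , m ← nonempty {A = D} p = go blocks disjoint
      where
      none : ∀ S xs → D ⊆ S → All (λ B → Empty (S ∩ B)) xs → length (filterᵇ (D ⊆ᵇ_) xs) ≡ 0
      none S []       s []       = refl
      none S (B ∷ xs) s (d ∷ ds) with D ⊆? B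
      ... | yes t = ⊥-elim (d (e , SubP.x∈p∩q⁺ (s m , t m)))
      ... | no  _ = none S xs s ds
      go : ∀ xs → AllPairs (λ A B → Empty (A ∩ B)) xs → length (filterᵇ (D ⊆ᵇ_) xs) ≤ 1
      go []       []       = z≤n
      go (S ∷ xs) (d ∷ ds) with D ⊆? S
      ... | yes s = s≤s (ℕP.≤-reflexive (none S xs s d))
      ... | no  _ = go xs ds
    two : IsCorankTwo N r blocks
    two = isCorankTwo {rk N} (λ {A} → key {A}) blocks lines⁻ (λ {S} fl e → proj₁ (flats-blocks S) (subst T (sym (Flat⇒isFlatᵇ (mkRaw n ⊤ r) S fl)) tt , e)) atMostOne
    unif : (∃ λ k → ∣ ⊤ {n} ∣ ≡ suc (suc (suc k))) → coeff (F (Unif (n ∸ 2) n)) i ≡ α n i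
    unif (k , eq) = subst (λ z → coeff (F (Unif (z ∸ 2) z)) i ≡ α z i) (sym (trans (sym (SubP.∣⊤∣≡n n)) eq)) (coeff-Unif k i)
    block : ∀ {S} → S ∈ˡ blocks → coeff (part S) i ≡ β n ∣ S ∣ i
    block {S} S∈ with e , m ← All.lookup ne S∈ = go ∣ S ∣ (∣∣-pos m)
      (subst (∣ S ∣ + 2 ≤_) (SubP.∣⊤∣≡n n) (line-size isN ll {r} (λ {A} → key {A}) r⊤ (SubP.⊆-max S) (proj₂ (lines⁻ S∈))))
      where
      go : ∀ k → 0 < k → k + 2 ≤ n → coeff (if 2 ≤ᵇ k then sumRange 2 k (corrTerm F n) else []) i ≡ β n k i
      -- The formula skips blocks with a single element, and for them β is zero.
      go 1             _ _ = sym (point n i)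
      go (suc (suc k)) _ l = coeff-sumRange n (suc k) l i

theorem5p2 : (Q : RawMatroid → Poly) → IsInverseKL Q →
    ((M : RawMatroid) → IsMatroid M → Loopless M → NoColoops M →
    rk M (ground M) + 2 ≡ ∣ ground M ∣ →
    (Q M ≈P rhsCorank2 Q M) × (Yof Q M ≈P rhsCorank2 (Yof Q) M))
    × ((n : ℕ) (blocks : List (Subset n)) → IsSetPartition n blocks →
    (r : Subset n → ℕ) → IsMatroid (mkRaw n ⊤ r) → Loopless (mkRaw n ⊤ r) →
    r ⊤ ≡ 2 → RankOneFlatsAre n r blocks →
    Loopless (dualFull n r) →
    (Q (dualFull n r) ≈P rhsPartition Q n blocks)
    × (Yof Q (dualFull n r) ≈P rhsPartition (Yof Q) n blocks))
theorem5p2 Q isQ =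
  (λ M isM ll nc corank → Theorem.corank-two expansionQ M isM ll nc corank , Theorem.corank-two expansionY M isM ll nc corank) ,
  (λ n blocks part r isR llR r⊤ lines ll → Theorem.partition expansionQ n blocks part r isR llR r⊤ lines ll , Theorem.partition expansionY n blocks part r isR llR r⊤ lines ll)
  where open Expansions Q isQ
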